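{- Let $F$ be a graph with a color-critical edge and let $k+1=\chi(F)$. Let $H$ be a linear forest. Then $H$ is $F$-Turán-good, i.e., there is $n_0$ such that for all $n\ge n_0$, $$\mathrm{ex}(n,H,F)=\mathcal{N}(H,T(n,k)).$$ In particular, for every $k\ge 2$ and every $\ell\ge 1$, the path $P_\ell$ is $K_{k+1}$-Turán-good: for all sufficiently large $n$, among all $n$-vertex $K_{k+1}$-free graphs, the Turán graph $T(n,k)$ contains the maximum number of copies of $P_\ell$.
   Context: For graphs $H$ and $G$, $\mathcal{N}(H,G)$ denotes the number of (not necessarily induced) subgraphs of $G$ isomorphic to $H$ ("copies" of $H$ in $G$). For graphs $H,F$, $\mathrm{ex}(n,H,F)$ is the maximum of $\mathcal{N}(H,G)$ over all $n$-vertex graphs $G$ containing no subgraph isomorphic to $F$. The Turán graph $T(n,k)$ is the complete $k$-partite graph on $n$ vertices with each part of size $\lfloor n/k\rfloor$ or $\lceil n/k\rceil$. An edge of $F$ is color-critical if deleting it decreases the chromatic number $\chi(F)$. For a graph $F$ with $\chi(F)=k+1$, a graph $H$ is called $F$-Turán-good if $\mathrm{ex}(n,H,F)=\mathcal{N}(H,T(n,k))$ for all sufficiently large $n$. A linear forest is a graph each of whose connected components is a path; $P_\ell$ denotes the path on $\ell$ vertices. -}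

module Defs where

open import Data.Bool using (true; false)
open import Data.Empty using (⊥)
open import Data.Fin using (Fin; toℕ; finToFun; funToFin)
open import Data.Fin.Properties using (_≟_; all?; any?; finToFun-funToFin; toℕ≤pred[n])
open import Data.Fin.Subset using (Subset; _∈_)
open import Data.Fin.Subset.Properties using (_∈?_)
open import Data.List using (List; []; _∷_; _++_; length; filter; map; cartesianProduct; cartesianProductWith; allFin; tabulate; upTo; applyUpTo)
open import Data.List.Properties using (upTo-∷ʳ; filter-++; filter-accept; filter-reject; length-++; map-tabulate)
open import Data.Nat using (ℕ; zero; suc; _≤_; _<_; _≥_; _%_; _/_)
open import Data.Nat.Divisibility using (divides-refl)
open import Data.Nat.DivMod using ([m+kn]%n≡m%n; m<n⇒m%n≡m; m≡m%n+[m/n]*n; m%n<n; m<n⇒m/n≡0; m*n/n≡m; +-distrib-/-∣ʳ)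
import Data.Nat as ℕ
import Data.Nat.Properties as ℕ
open import Data.Product using (Σ-syntax; ∃-syntax; _×_; _,_)
open import Data.Sum using (_⊎_; inj₁; inj₂; swap; [_,_])
open import Data.Vec using (Vec; []; _∷_; lookup)
open import Function using (_∘_; id; _⇔_; mk⇔)
open import Function.Bundles using (module Equivalence)
open import Function.Definitions using (Injective)
open import Level using (0ℓ)
open import Relation.Binary using (Rel; Decidable; Symmetric)
open import Relation.Binary.Construct.Closure.ReflexiveTransitive using (Star)
open import Relation.Binary.PropositionalEquality using (_≡_; _≢_; refl; sym; trans; cong; cong₂; subst; subst₂; module ≡-Reasoning)
open import Relation.Nullary using (¬_; Dec; yes; no; does)
open import Relation.Nullary.Decidable using (map′; ¬?; _×-dec_; _⊎-dec_; _→-dec_)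
import Relation.Unary as U

record Graph (n : ℕ) : Set₁ where
  field
    Adj    : Rel (Fin n) 0ℓ
    adj?   : Decidable Adj
    symm   : Symmetric Adj
    irrefl : ∀ {v} → ¬ Adj v v

open Graph public

-- An isomorphism from H onto the graph with vertex set V and edge relation E.
record Iso {m n : ℕ} (H : Graph m) (V : Fin n → Set) (E : Rel (Fin n) 0ℓ) : Set where
  constructor mkIso
  field
    φ         : Fin m → Fin n
    injective : Injective _≡_ _≡_ φ
    onto      : ∀ v → V v ⇔ (∃[ i ] φ i ≡ v)
    edges     : ∀ i j → Adj H i j ⇔ E (φ i) (φ j)

-- Vertex set together with the rows of an adjacency matrix.
SubgraphData : ℕ → Set
SubgraphData n = Subset n × Vec (Subset n) n

module _ {n : ℕ} where

  InVertices : SubgraphData n → Fin n → Set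
  InVertices (V , _) v = v ∈ V

  InEdges : SubgraphData n → Rel (Fin n) 0ℓ
  InEdges (_ , E) u v = v ∈ lookup E u

  IsSubgraph : Graph n → SubgraphData n → Set
  IsSubgraph G S = ∀ u v → InEdges S u v →
    InEdges S v u × Adj G u v × InVertices S u × InVertices S v

  IsCopy : ∀ {m} → Graph m → Graph n → SubgraphData n → Set
  IsCopy H G S = IsSubgraph G S × Iso H (InVertices S) (InEdges S)

private
  _⇔-dec_ : {A B : Set} → Dec A → Dec B → Dec (A ⇔ B)
  a? ⇔-dec b? = map′ (λ (f , g) → mk⇔ f g)
    (λ e → Equivalence.to e , Equivalence.from e) ((a? →-dec b?) ×-dec (b? →-dec a?))

module _ {m n : ℕ} (H : Graph m) {V : Fin n → Set} {E : Rel (Fin n) 0ℓ} where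

  private
    Good : (Fin m → Fin n) → Set
    Good f = (∀ i j → f i ≡ f j → i ≡ j)
           × (∀ v → V v ⇔ (∃[ i ] f i ≡ v))
           × (∀ i j → Adj H i j ⇔ E (f i) (f j))

    good-resp : ∀ {f g} → (∀ i → f i ≡ g i) → Good f → Good g
    good-resp f≗g (inj , onto , edges) =
      (λ i j e → inj i j (trans (f≗g i) (trans e (sym (f≗g j))))) ,
      (λ v → mk⇔
        (λ x → let (i , e) = Equivalence.to (onto v) x in i , trans (sym (f≗g i)) e)
        (λ (i , e) → Equivalence.from (onto v) (i , trans (f≗g i) e))) ,
      (λ i j → subst₂ (λ a b → Adj H i j ⇔ E a b) (f≗g i) (f≗g j) (edges i j))

  iso? : U.Decidable V → Decidable E → Dec (Iso H V E)
  iso? V? E? = map′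
    (λ (k , inj , onto , edges) → mkIso (finToFun k) (λ {i} {j} → inj i j) onto edges)
    (λ (mkIso f inj onto edges) → funToFin f ,
      good-resp (λ i → sym (finToFun-funToFin f i)) ((λ i j → inj) , onto , edges))
    (any? λ k → good? (finToFun k))
    where
    good? : ∀ f → Dec (Good f)
    good? f =
      all? (λ i → all? λ j → (f i ≟ f j) →-dec (i ≟ j)) ×-dec
      all? (λ v → V? v ⇔-dec any? λ i → f i ≟ v) ×-dec
      all? (λ i → all? λ j → adj? H i j ⇔-dec E? (f i) (f j))

isCopy? : ∀ {m n} (H : Graph m) (G : Graph n) → U.Decidable (IsCopy H G)
isCopy? H G (V , E) =
  all? (λ u → all? λ v → (v ∈? lookup E u) →-dec
    ((u ∈? lookup E v) ×-dec adj? G u v ×-dec (u ∈? V) ×-dec (v ∈? V)))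
  ×-dec iso? H (_∈? V) (λ u v → v ∈? lookup E u)

vectors : {A : Set} → List A → ∀ n → List (Vec A n)
vectors xs zero    = [] ∷ []
vectors xs (suc n) = cartesianProductWith _∷_ xs (vectors xs n)

-- Every element of SubgraphData n occurs in this list exactly once.
allSubgraphData : ∀ n → List (SubgraphData n)
allSubgraphData n = cartesianProduct subsets (vectors subsets n)
  where
  subsets : List (Subset n)
  subsets = vectors (true ∷ false ∷ []) n

𝓝 : ∀ {m n} → Graph m → Graph n → ℕ
𝓝 H G = length (filter (isCopy? H G) (allSubgraphData _))

_IsFree_ : ∀ {n m} → Graph n → Graph m → Set
G IsFree F = ¬ (∃[ S ] IsCopy F G S)

-- ex(n,H,F) = c
ex[_,_,_]≡_ : ∀ {h f} → ℕ → Graph h → Graph f → ℕ → Set₁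
ex[ n , H , F ]≡ c =
  (∃[ G ] (_IsFree_ {n} G F × 𝓝 H G ≡ c)) ×
  (∀ (G : Graph n) → G IsFree F → 𝓝 H G ≤ c)

Colorable : ∀ {n} → Graph n → ℕ → Set
Colorable {n} G c = Σ[ col ∈ (Fin n → Fin c) ] (∀ u v → Adj G u v → col u ≢ col v)

-- χ(G) = c
χ[_]≡_ : ∀ {n} → Graph n → ℕ → Set
χ[ G ]≡ c = Colorable G c × (∀ d → Colorable G d → c ≤ d)

deleteEdge : ∀ {n} → Graph n → Fin n → Fin n → Graph n
deleteEdge G u v = record
  { Adj    = λ x y → Adj G x y × ¬ ((x ≡ u × y ≡ v) ⊎ (x ≡ v × y ≡ u))
  ; adj?   = λ x y → adj? G x y ×-dec
               ¬? (((x ≟ u) ×-dec (y ≟ v)) ⊎-dec ((x ≟ v) ×-dec (y ≟ u)))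
  ; symm   = λ (xy , ne) → symm G xy ,
               λ { (inj₁ (p , q)) → ne (inj₂ (q , p)) ; (inj₂ (p , q)) → ne (inj₁ (q , p)) }
  ; irrefl = λ (xx , _) → irrefl G xx
  }

ColorCritical : ∀ {n} → Graph n → Fin n → Fin n → Set
ColorCritical G u v = Adj G u v ×
  (∃[ c ] ∃[ d ] (χ[ G ]≡ c × χ[ deleteEdge G u v ]≡ d × d < c))

HasColorCriticalEdge : ∀ {n} → Graph n → Set
HasColorCriticalEdge G = ∃[ u ] ∃[ v ] ColorCritical G u v

complete : ∀ n → Graph n
complete n = record
  { Adj    = _≢_
  ; adj?   = λ u v → ¬? (u ≟ v)
  ; symm   = λ u≢v v≡u → u≢v (sym v≡u)
  ; irrefl = λ v≢v → v≢v refl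
  }

edgeless : ∀ n → Graph n
edgeless n = record
  { Adj    = λ _ _ → ⊥
  ; adj?   = λ _ _ → no λ ()
  ; symm   = λ ()
  ; irrefl = λ ()
  }

path : ∀ ℓ → Graph ℓ
path ℓ = record
  { Adj    = λ u v → toℕ v ≡ suc (toℕ u) ⊎ toℕ u ≡ suc (toℕ v)
  ; adj?   = λ u v → (toℕ v ℕ.≟ suc (toℕ u)) ⊎-dec (toℕ u ℕ.≟ suc (toℕ v))
  ; symm   = swap
  ; irrefl = [ (λ e → ℕ.1+n≢n (sym e)) , (λ e → ℕ.1+n≢n (sym e)) ]
  }

-- The parts are the residue classes modulo the number of parts; turán-balanced
-- below shows that they have the required sizes. The value for zero parts is a
-- convention only: χ(F) = k + 1 and a color-critical edge force k ≥ 1.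
turán : (n k : ℕ) → Graph n
turán n zero    = edgeless n
turán n (suc k) = record
  { Adj    = λ u v → toℕ u % suc k ≢ toℕ v % suc k
  ; adj?   = λ u v → ¬? (toℕ u % suc k ℕ.≟ toℕ v % suc k)
  ; symm   = λ ne e → ne (sym e)
  ; irrefl = λ ne → ne refl
  }

-- The connected component of v is the set of vertices reachable from v.
LinearForest : ∀ {n} → Graph n → Set
LinearForest H = ∀ v → ∃[ ℓ ] Iso (path ℓ) (Star (Adj H) v) (Adj H)

-- H is F-Turán-good, where χ(F) = k + 1.
TuránGood : ∀ {f h} → ℕ → Graph f → Graph h → Set₁
TuránGood k F H = χ[ F ]≡ suc k ×
  (∃[ n₀ ] (∀ n → n ≥ n₀ → ex[ n , H , F ]≡ 𝓝 H (turán n k)))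

partSize : (n k : ℕ) → Fin (suc k) → ℕ
partSize n k r = length (filter (λ v → toℕ v % suc k ℕ.≟ toℕ r) (allFin n))

private
  module Balanced (k : ℕ) (r : ℕ) (r≤k : r ≤ k) where

    K : ℕ
    K = suc k

    P? : U.Decidable (λ i → i % K ≡ r)
    P? i = i % K ℕ.≟ r

    cnt : ℕ → ℕ
    cnt n = length (filter P? (upTo n))

    cnt-suc : ∀ n → cnt (suc n) ≡ length (filter P? (n ∷ [])) ℕ.+ cnt n
    cnt-suc n = begin
      length (filter P? (upTo (suc n)))                  ≡⟨ cong (length ∘ filter P?) (upTo-∷ʳ n) ⟨
      length (filter P? (upTo n ++ n ∷ []))              ≡⟨ cong length (filter-++ P? (upTo n) (n ∷ [])) ⟩
      length (filter P? (upTo n) ++ filter P? (n ∷ []))  ≡⟨ length-++ (filter P? (upTo n)) ⟩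
      cnt n ℕ.+ length (filter P? (n ∷ []))              ≡⟨ ℕ.+-comm (cnt n) _ ⟩
      length (filter P? (n ∷ [])) ℕ.+ cnt n              ∎
      where open ≡-Reasoning

    cnt-suc-yes : ∀ n → n % K ≡ r → cnt (suc n) ≡ suc (cnt n)
    cnt-suc-yes n p = trans (cnt-suc n)
      (cong (λ l → length l ℕ.+ cnt n) (filter-accept P? {x = n} {xs = []} p))

    cnt-suc-no : ∀ n → n % K ≢ r → cnt (suc n) ≡ cnt n
    cnt-suc-no n p = trans (cnt-suc n)
      (cong (λ l → length l ℕ.+ cnt n) (filter-reject P? {x = n} {xs = []} p))

    mod : ∀ t q → t < K → (t ℕ.+ q ℕ.* K) % K ≡ t
    mod t q t<K = trans ([m+kn]%n≡m%n t q K) (m<n⇒m%n≡m t<K)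

    below : ∀ q t → t ≤ r → cnt (t ℕ.+ q ℕ.* K) ≡ cnt (q ℕ.* K)
    below q zero    _   = refl
    below q (suc t) t<r = trans
      (cnt-suc-no _ (λ e → ℕ.<⇒≢ t<r (trans (sym (mod t q (ℕ.<-trans t<r (ℕ.s≤s r≤k)))) e)))
      (below q t (ℕ.<⇒≤ t<r))

    above : ∀ q t → r < t → t ≤ K → cnt (t ℕ.+ q ℕ.* K) ≡ suc (cnt (q ℕ.* K))
    above q (suc t) (ℕ.s≤s r≤t) t<K with r ℕ.≟ t
    ... | yes refl = trans (cnt-suc-yes _ (mod t q t<K)) (cong suc (below q t ℕ.≤-refl))
    ... | no r≢t   = trans (cnt-suc-no _ (λ e → r≢t (trans (sym e) (mod t q t<K))))
                           (above q t (ℕ.≤∧≢⇒< r≤t r≢t) (ℕ.<⇒≤ t<K))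

    multiples : ∀ q → cnt (q ℕ.* K) ≡ q
    multiples zero    = refl
    multiples (suc q) = trans (above q K (ℕ.s≤s r≤k) ℕ.≤-refl) (cong suc (multiples q))

    ceil : ∀ t q → 0 < t → t < K → (t ℕ.+ q ℕ.* K ℕ.+ k) / K ≡ suc q
    ceil (suc t) q _ t<K = begin
      (suc t ℕ.+ q ℕ.* K ℕ.+ k) / K    ≡⟨ cong (_/ K) rearrange ⟩
      (t ℕ.+ suc q ℕ.* K) / K          ≡⟨ +-distrib-/-∣ʳ t (divides-refl (suc q)) ⟩
      t / K ℕ.+ suc q ℕ.* K / K        ≡⟨ cong₂ ℕ._+_ (m<n⇒m/n≡0 (ℕ.<⇒≤ t<K)) (m*n/n≡m (suc q) K) ⟩
      suc q                            ∎
      where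
      open ≡-Reasoning
      rearrange : suc t ℕ.+ q ℕ.* K ℕ.+ k ≡ t ℕ.+ suc q ℕ.* K
      rearrange = begin
        suc (t ℕ.+ q ℕ.* K ℕ.+ k)    ≡⟨ ℕ.+-suc (t ℕ.+ q ℕ.* K) k ⟨
        t ℕ.+ q ℕ.* K ℕ.+ K          ≡⟨ ℕ.+-assoc t (q ℕ.* K) K ⟩
        t ℕ.+ (q ℕ.* K ℕ.+ K)        ≡⟨ cong (t ℕ.+_) (ℕ.+-comm (q ℕ.* K) K) ⟩
        t ℕ.+ (K ℕ.+ q ℕ.* K)        ∎

    balanced : ∀ n → cnt n ≡ n / K ⊎ cnt n ≡ (n ℕ.+ k) / K
    balanced n with n % K ℕ.≤? r
    ... | yes t≤r = inj₁ (trans (cong cnt (m≡m%n+[m/n]*n n K))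
                    (trans (below (n / K) (n % K) t≤r) (multiples (n / K))))
    ... | no t≰r  = inj₂ (trans (cong cnt (m≡m%n+[m/n]*n n K))
                    (trans (above (n / K) (n % K) r<t (ℕ.<⇒≤ (m%n<n n K)))
                    (trans (cong suc (multiples (n / K)))
                    (trans (sym (ceil (n % K) (n / K) (ℕ.≤-<-trans ℕ.z≤n r<t) (m%n<n n K)))
                           (cong (λ x → (x ℕ.+ k) / K) (sym (m≡m%n+[m/n]*n n K)))))))
      where r<t = ℕ.≰⇒> t≰r

    length-filter-map : ∀ {A : Set} (f : A → ℕ) xs →
      length (filter (P? ∘ f) xs) ≡ length (filter P? (map f xs))
    length-filter-map f []       = refl
    length-filter-map f (x ∷ xs) with does (P? (f x))
    ... | true  = cong suc (length-filter-map f xs)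
    ... | false = length-filter-map f xs

    tabulate-applyUpTo : ∀ n (g : ℕ → ℕ) → tabulate {n = n} (g ∘ toℕ) ≡ applyUpTo g n
    tabulate-applyUpTo zero    g = refl
    tabulate-applyUpTo (suc n) g = cong (g 0 ∷_) (tabulate-applyUpTo n (g ∘ suc))

-- (n + k) / suc k is ⌈ n / (k + 1) ⌉.
turán-balanced : ∀ n k (r : Fin (suc k)) →
  partSize n k r ≡ n / suc k ⊎ partSize n k r ≡ (n ℕ.+ k) / suc k
turán-balanced n k r =
  subst (λ c → c ≡ n / suc k ⊎ c ≡ (n ℕ.+ k) / suc k) (sym eq) (B.balanced n)
  where
  module B = Balanced k (toℕ r) (toℕ≤pred[n] r)
  eq : partSize n k r ≡ B.cnt n
  eq = trans (B.length-filter-map toℕ (allFin n))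
         (cong (length ∘ filter B.P?)
           (trans (map-tabulate id toℕ) (B.tabulate-applyUpTo n id)))

{-# OPTIONS --safe #-}

-- Write κ = k - 1. Copies are counted by embeddings (each copy has as many parametrisations as
-- H has automorphisms), and a linear forest is a sequence of vertices in which some
-- consecutive pairs are joined.
--
-- Balancing is exact. For two classes of sizes a and b of a complete multipartite graph, the
-- part of a linear forest inside them is a union of alternating paths; by Vandermonde it has
-- 2ᵉ (a)_M (b)_M (a+b-2M)_r embeddings, where r counts the odd paths and e the even ones.
-- This grows when a larger class gives a vertex to a smaller one.
--
-- The rest is Simonovits' progressive induction: the surplus of an F-free graph over the Turán
-- graph strictly decreases when a vertex lying in fewer embeddings than the last vertex of the
-- Turán graph is deleted, so it suffices to treat large graphs without such light vertices.
-- There, a weighted Erdős-Stone bound gives w(2a+1) ≤ (κ/k) w(a)² + o(·) for the number w(a) of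
-- walks with a edges. Together with w(a)² ≤ n w(2a), applied to walks of length 2ⁱ a, it yields
-- w(a+1) ≤ (κ/k) n w(a) + o(·). Having almost the Turán number of embeddings therefore forces
-- w(1) ≈ (κ/k) n², and w(2) then shows that almost all degrees are close to (κ/k) n; so a
-- vertex of smaller degree would be light. Finally, minimum degree (κ/k - ε) n makes an
-- F-free graph k-colourable, since a complete k-partite subgraph plus an edge inside a part
-- already contains F.

module Submission where

open import Defs
open import Data.Bool using (Bool; true; false; _∧_; not)
open import Data.Empty using (⊥; ⊥-elim)
open import Data.Fin using (Fin; zero; suc; toℕ; punchIn; fromℕ; fromℕ<; combine; remQuot; inject₁; inject≤)
open import Data.Fin.Properties using (_≟_; all?; any?; punchInᵢ≢i; punchIn-injective; toℕ-fromℕ<; toℕ-injective; remQuot-combine; suc-injective; toℕ-fromℕ; toℕ-inject₁; toℕ≤pred[n]; inject≤-injective; inject₁-injective; injective⇒≤; ¬Fin0)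
open import Data.Fin.Induction using (<-weakInduction; >-weakInduction)
open import Data.List using (List; []; _∷_; _++_; length; filter; allFin; tabulate; cartesianProductWith) renaming (map to mapᴸ)
open import Data.Nat using (ℕ; zero; suc; _+_; _*_; _∸_; _^_; _≤_; _<_; z≤n; s≤s; _/_; _%_; >-nonZero; NonZero)
open import Data.Nat.DivMod using (m/n*n≤m; m%n<n; m≡m%n+[m/n]*n; /-monoˡ-≤)
open import Data.Nat.Properties hiding (_≟_; suc-injective)
open import Data.Nat.Properties using () renaming (_≟_ to _≟ℕ_)
open import Data.Nat.Tactic.RingSolver using (solve-∀)
open import Data.Product using (Σ-syntax; ∃-syntax; _×_; _,_; proj₁; proj₂)
open import Data.Sum using (_⊎_; inj₁; inj₂)
open import Data.Vec using (Vec; []; _∷_; lookup; map) renaming (tabulate to tabulateᵛ)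
open import Data.Vec.Properties using (map-id; lookup∘tabulate; tabulate∘lookup; tabulate-cong; []=⇒lookup; lookup⇒[]=)
open import Function using (_∘_; id; _⇔_; mk⇔)
open import Function.Bundles using (module Equivalence)
open import Relation.Binary.Definitions using (DecidableEquality)
open import Relation.Binary.PropositionalEquality using (_≡_; _≢_; refl; sym; trans; cong; cong₂; subst; subst₂; module ≡-Reasoning)
open import Relation.Nullary using (¬_; Dec; yes; no; does)
open import Relation.Nullary.Decidable using (¬?; _×-dec_; _⊎-dec_; _→-dec_; dec-true; decidable-stable)
open import Data.Fin.Subset using (Subset; _∈_)
open import Data.Fin.Subset.Properties using (⊆-antisym)
import Data.Bool.Properties as Boolₚ
import Data.Product.Properties as Productₚ
import Data.Vec.Properties as Vecₚ
open import Data.Maybe using (Maybe; just; nothing)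
open import Data.List.Membership.Propositional using () renaming (_∈_ to _∈ᴸ_)
open import Data.List.Membership.Propositional.Properties using (∈-allFin)
open import Data.List.Relation.Unary.Any using (here; there)
open import Relation.Binary.Construct.Closure.ReflexiveTransitive using (Star; ε; _◅_; _◅◅_; reverse)
open import Data.Unit using (⊤; tt)
open import Algebra.Properties.CommutativeSemigroup *-commutativeSemigroup using (x∙yz≈y∙xz; x∙yz≈yx∙z; x∙yz≈xz∙y; interchange)
open import Algebra.Properties.Semiring.Sum +-*-semiring using (∑-comm; ∑-distrib-+; sum-remove; *-distribˡ-sum; *-distribʳ-sum; sum-cong-≗) renaming (sum to ∑)

-- Finite sums and vertex sequences

-- Lightness of a vertex is measured by embeddings, not by degree, and a vertex of small degree may
-- still lie in many embeddings if its neighbours have large degrees. Hence almost all degrees are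
-- pinned down before a small degree at one vertex can be shown to cost embeddings. It then does:
-- among the positions a vertex can take in the forest, one is the end of an edge and carries the
-- factor d(z), while the other positions contribute at most their Turán share.
--
-- The bound for w(2a+1) relates only walks of about doubled length. Consecutive lengths are reached
-- by a power trick: iterated i times, the bounds compare 2ⁱ-th powers up to a constant factor, and
-- a constant factor disappears when 2ⁱ-th roots are taken.
--
-- Everything is stated in natural numbers. Fractions are cleared, an error o(nᵈ) becomes
-- `N * X ≤ N * Y + nᵈ` for every `N` and all large `n`, and inequalities carry extra summands on
-- both sides in place of subtractions.

𝟙 : {P : Set} → Dec P → ℕ
𝟙 (yes _) = 1
𝟙 (no _)  = 0

𝟙≤1 : {P : Set} (d : Dec P) → 𝟙 d ≤ 1
𝟙≤1 (yes _) = s≤s z≤n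
𝟙≤1 (no _)  = z≤n

𝟙-yes : {P : Set} (d : Dec P) → P → 𝟙 d ≡ 1
𝟙-yes (yes _) _ = refl
𝟙-yes (no ¬p) p = ⊥-elim (¬p p)

𝟙-no : {P : Set} (d : Dec P) → ¬ P → 𝟙 d ≡ 0
𝟙-no (yes p) ¬p = ⊥-elim (¬p p)
𝟙-no (no _)  _  = refl

𝟙-mono : {P Q : Set} (d : Dec P) (e : Dec Q) → (P → Q) → 𝟙 d ≤ 𝟙 e
𝟙-mono (no _)  e f = z≤n
𝟙-mono (yes p) e f = ≤-reflexive (sym (𝟙-yes e (f p)))

𝟙-cong : {P Q : Set} (d : Dec P) (e : Dec Q) → (P → Q) → (Q → P) → 𝟙 d ≡ 𝟙 e
𝟙-cong d e f g = ≤-antisym (𝟙-mono d e f) (𝟙-mono e d g)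

𝟙-pos : {P : Set} (d : Dec P) → 0 < 𝟙 d → P
𝟙-pos (yes p) _ = p

∑-mono : ∀ {n} {f g : Fin n → ℕ} → (∀ i → f i ≤ g i) → ∑ f ≤ ∑ g
∑-mono {zero}  _ = z≤n
∑-mono {suc n} h = +-mono-≤ (h zero) (∑-mono (h ∘ suc))

∑-const : ∀ n c → ∑ {n} (λ _ → c) ≡ n * c
∑-const zero    c = refl
∑-const (suc n) c = cong (c +_) (∑-const n c)

∑-≡0 : ∀ {n} {f : Fin n → ℕ} → (∀ i → f i ≡ 0) → ∑ f ≡ 0
∑-≡0 {n} h = trans (sum-cong-≗ h) (trans (∑-const n 0) (*-zeroʳ n))

∑-bound : ∀ {n} {f : Fin n → ℕ} c → (∀ i → f i ≤ c) → ∑ f ≤ n * c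
∑-bound {n} c h = ≤-trans (∑-mono h) (≤-reflexive (∑-const n c))

term≤∑ : ∀ {n} (f : Fin n → ℕ) i → f i ≤ ∑ f
term≤∑ f zero    = m≤m+n _ _
term≤∑ f (suc i) = ≤-trans (term≤∑ (f ∘ suc) i) (m≤n+m _ _)

∑-δ : ∀ {n} (a : Fin n) (f : Fin n → ℕ) → ∑ (λ i → 𝟙 (i ≟ a) * f i) ≡ f a
∑-δ {suc n} zero f = trans
  (cong₂ _+_ (*-identityˡ (f zero)) (∑-≡0 λ i → cong (_* f (suc i)) (𝟙-no (suc i ≟ zero) (λ ()))))
  (+-identityʳ (f zero))
∑-δ {suc n} (suc a) f = trans
  (sum-cong-≗ λ i → cong (_* f (suc i)) (𝟙-cong (suc i ≟ suc a) (i ≟ a) (λ { refl → refl }) (λ { refl → refl })))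
  (∑-δ a (f ∘ suc))

∑-pos : ∀ {n} (f : Fin n → ℕ) → 0 < ∑ f → ∃[ i ] 0 < f i
∑-pos {suc n} f p with f zero in eq
... | suc _ = zero , subst (0 <_) (sym eq) (s≤s z≤n)
... | zero  = let i , q = ∑-pos (f ∘ suc) p in suc i , q

∑V : ∀ {n} m → (Vec (Fin n) m → ℕ) → ℕ
∑V zero    f = f []
∑V (suc m) f = ∑ λ x → ∑V m λ xs → f (x ∷ xs)

∑V-cong : ∀ {n} m {f g : Vec (Fin n) m → ℕ} → (∀ x → f x ≡ g x) → ∑V m f ≡ ∑V m g
∑V-cong zero    h = h []
∑V-cong (suc m) h = sum-cong-≗ λ x → ∑V-cong m λ xs → h (x ∷ xs)

∑V-mono : ∀ {n} m {f g : Vec (Fin n) m → ℕ} → (∀ x → f x ≤ g x) → ∑V m f ≤ ∑V m g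
∑V-mono zero    h = h []
∑V-mono (suc m) h = ∑-mono λ x → ∑V-mono m λ xs → h (x ∷ xs)

∑V-const : ∀ {n} m c → ∑V {n} m (λ _ → c) ≡ n ^ m * c
∑V-const     zero    c = sym (*-identityˡ c)
∑V-const {n} (suc m) c = trans (sum-cong-≗ {n} λ _ → ∑V-const m c)
  (trans (∑-const n _) (sym (*-assoc n (n ^ m) c)))

∑V-+ : ∀ {n} m (f g : Vec (Fin n) m → ℕ) → ∑V m (λ x → f x + g x) ≡ ∑V m f + ∑V m g
∑V-+ zero    f g = refl
∑V-+ (suc m) f g = trans (sum-cong-≗ λ x → ∑V-+ m (λ xs → f (x ∷ xs)) (λ xs → g (x ∷ xs)))
  (∑-distrib-+ (λ x → ∑V m λ xs → f (x ∷ xs)) _)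

∑V-*ˡ : ∀ {n} m c (f : Vec (Fin n) m → ℕ) → ∑V m (λ x → c * f x) ≡ c * ∑V m f
∑V-*ˡ zero    c f = refl
∑V-*ˡ (suc m) c f = trans (sum-cong-≗ λ x → ∑V-*ˡ m c λ xs → f (x ∷ xs))
  (sym (*-distribˡ-sum c λ x → ∑V m λ xs → f (x ∷ xs)))

∑V-∑ : ∀ {n} m {p} (f : Vec (Fin n) m → Fin p → ℕ) →
  ∑V m (λ x → ∑ (f x)) ≡ ∑ λ i → ∑V m λ x → f x i
∑V-∑ zero    f = refl
∑V-∑ (suc m) f = trans (sum-cong-≗ λ x → ∑V-∑ m λ xs → f (x ∷ xs))
  (∑-comm λ x i → ∑V m λ xs → f (x ∷ xs) i)

occ : ∀ {n m} → Fin n → Vec (Fin n) m → ℕ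
occ v []       = 0
occ v (x ∷ xs) = 𝟙 (x ≟ v) + occ v xs

isZero : ℕ → ℕ
isZero zero    = 1
isZero (suc _) = 0

isZero≤1 : ∀ m → isZero m ≤ 1
isZero≤1 zero    = s≤s z≤n
isZero≤1 (suc _) = z≤n

distinct : ∀ {n m} → Vec (Fin n) m → ℕ
distinct []       = 1
distinct (x ∷ xs) = isZero (occ x xs) * distinct xs

distinct≤1 : ∀ {n m} (x : Vec (Fin n) m) → distinct x ≤ 1
distinct≤1 []       = s≤s z≤n
distinct≤1 (x ∷ xs) = *-mono-≤ (isZero≤1 (occ x xs)) (distinct≤1 xs)

A : ∀ {n} → Graph n → Fin n → Fin n → ℕ
A G u v = 𝟙 (adj? G u v)

A-sym : ∀ {n} (G : Graph n) u v → A G u v ≡ A G v u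
A-sym G u v = 𝟙-cong (adj? G u v) (adj? G v u) (symm G) (symm G)

link : ∀ {n} → Graph n → Bool → Fin n → Fin n → ℕ
link G true  u v = A G u v
link G false u v = 1

link≤1 : ∀ {n} (G : Graph n) b u v → link G b u v ≤ 1
link≤1 G true  u v = 𝟙≤1 (adj? G u v)
link≤1 G false u v = ≤-refl

-- A linear forest with m + 1 vertices is encoded by m flags, the i-th one telling whether
-- the i-th and (i+1)-st vertices are adjacent; hom is the indicator of homomorphisms.
hom : ∀ {n m} → Graph n → Vec Bool m → Vec (Fin n) (suc m) → ℕ
hom G []       _            = 1
hom G (b ∷ bs) (x ∷ y ∷ xs) = link G b x y * hom G bs (y ∷ xs)

hom≤1 : ∀ {n m} (G : Graph n) (bs : Vec Bool m) x → hom G bs x ≤ 1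
hom≤1 G []       x            = s≤s z≤n
hom≤1 G (b ∷ bs) (x ∷ y ∷ xs) = *-mono-≤ (link≤1 G b x y) (hom≤1 G bs (y ∷ xs))

emb : ∀ {n m} → Graph n → Vec Bool m → ℕ
emb {m = m} G bs = ∑V (suc m) λ x → distinct x * hom G bs x

hom-mono : ∀ {n n′ m} (G : Graph n) (G′ : Graph n′) (f : Fin n → Fin n′) →
  (∀ u v → Adj G u v → Adj G′ (f u) (f v)) → (bs : Vec Bool m) → ∀ x → hom G bs x ≤ hom G′ bs (map f x)
hom-mono G G′ f sub []           x            = ≤-refl
hom-mono G G′ f sub (true ∷ bs)  (x ∷ y ∷ xs) =
  *-mono-≤ (𝟙-mono (adj? G x y) (adj? G′ (f x) (f y)) (sub x y)) (hom-mono G G′ f sub bs (y ∷ xs))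
hom-mono G G′ f sub (false ∷ bs) (x ∷ y ∷ xs) =
  *-mono-≤ (≤-refl {1}) (hom-mono G G′ f sub bs (y ∷ xs))

-- Complete multipartite graphs

falling : ℕ → ℕ → ℕ
falling a zero    = 1
falling a (suc x) = (a ∸ x) * falling a x

falling-suc : ∀ a x → falling (suc a) (suc x) ≡ suc a * falling a x
falling-suc a zero    = refl
falling-suc a (suc x) = begin
  (a ∸ x) * falling (suc a) (suc x)   ≡⟨ cong ((a ∸ x) *_) (falling-suc a x) ⟩
  (a ∸ x) * (suc a * falling a x)     ≡⟨ x∙yz≈y∙xz (a ∸ x) (suc a) (falling a x) ⟩
  suc a * ((a ∸ x) * falling a x)     ∎
  where
  open ≡-Reasoning

falling-zero : ∀ {a x} → a < x → falling a x ≡ 0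
falling-zero {a} {suc x} (s≤s a≤x) = cong (_* falling a x) (m≤n⇒m∸n≡0 a≤x)

-- For exponent M + 1 both sides share `falling a M * falling b M`. With a = p + M and b = q + M the
-- remaining factors differ by (M+1)(p - q), which is nonnegative as b ≤ a; for M > b truncation
-- makes the left side 0.
falling-product-mono : ∀ {a b} M → b ≤ a →
  falling (suc a) M * falling b M ≤ falling a M * falling (suc b) M
falling-product-mono zero    _   = ≤-refl
falling-product-mono {a} {b} (suc M) b≤a = begin
  falling (suc a) (suc M) * ((b ∸ M) * falling b M)   ≡⟨ cong (_* ((b ∸ M) * falling b M)) (falling-suc a M) ⟩
  suc a * falling a M * ((b ∸ M) * falling b M)       ≡⟨ interchange (suc a) (falling a M) (b ∸ M) (falling b M) ⟩
  suc a * (b ∸ M) * (falling a M * falling b M)       ≤⟨ *-monoˡ-≤ (falling a M * falling b M) key ⟩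
  (a ∸ M) * suc b * (falling a M * falling b M)       ≡⟨ interchange (a ∸ M) (suc b) (falling a M) (falling b M) ⟩
  (a ∸ M) * falling a M * (suc b * falling b M)       ≡⟨ cong ((a ∸ M) * falling a M *_) (falling-suc b M) ⟨
  (a ∸ M) * falling a M * falling (suc b) (suc M)     ∎
  where
  open ≤-Reasoning
  key : suc a * (b ∸ M) ≤ (a ∸ M) * suc b
  key with M ≤? b
  ... | no M≰b = ≤-trans (≤-reflexive (trans (cong (suc a *_) (m≤n⇒m∸n≡0 (<⇒≤ (≰⇒> M≰b)))) (*-zeroʳ (suc a)))) z≤n
  ... | yes M≤b = subst₂ (λ p q → suc p * (b ∸ M) ≤ (a ∸ M) * suc q)
    (m∸n+n≡m (≤-trans M≤b b≤a)) (m∸n+n≡m M≤b) (aux (a ∸ M) (b ∸ M) (∸-monoˡ-≤ M b≤a))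
    where
    lhs : ∀ p q → suc (p + M) * q ≡ p * q + suc M * q
    lhs p q = trans (cong (_* q) (sym (+-suc p M))) (*-distribʳ-+ q p (suc M))
    rhs : ∀ p q → p * suc (q + M) ≡ p * q + p * suc M
    rhs p q = trans (cong (p *_) (sym (+-suc q M))) (*-distribˡ-+ p q (suc M))
    aux : ∀ p q → q ≤ p → suc (p + M) * q ≤ p * suc (q + M)
    aux p q q≤p = subst₂ _≤_ (sym (lhs p q)) (sym (rhs p q))
      (+-monoʳ-≤ (p * q) (≤-trans (*-monoʳ-≤ (suc M) q≤p) (≤-reflexive (*-comm (suc M) p))))

-- Counting injective sequences by their colours

size : ∀ {n k} → (Fin n → Fin k) → Fin k → ℕ
size col j = ∑ λ v → 𝟙 (col v ≟ j)

∑-size : ∀ {n k} (col : Fin n → Fin k) → ∑ (size col) ≡ n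
∑-size {n} col = begin
  ∑ (λ j → ∑ λ v → 𝟙 (col v ≟ j))      ≡⟨ ∑-comm (λ j v → 𝟙 (col v ≟ j)) ⟩
  ∑ (λ v → ∑ λ j → 𝟙 (col v ≟ j))      ≡⟨ sum-cong-≗ (λ v → trans (sum-cong-≗ λ j → trans (𝟙-cong (col v ≟ j) (j ≟ col v) sym sym) (sym (*-identityʳ _))) (∑-δ (col v) (λ _ → 1))) ⟩
  ∑ {n} (λ v → 1)                       ≡⟨ trans (∑-const n 1) (*-identityʳ n) ⟩
  n                                     ∎
  where open ≡-Reasoning

-- For an injective sequence `occ v x` is 0 or 1, so the bracket equals 1; other sequences have
-- weight 0. This splits a count of injective sequences by whether they meet `v`.
distinct-occ : ∀ {n m} v (x : Vec (Fin n) m) → distinct x * (isZero (occ v x) + occ v x) ≡ distinct x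
distinct-occ v [] = refl
distinct-occ v (x ∷ xs) with x ≟ v | occ x xs in eq
... | _        | suc _ = refl
... | yes refl | zero  rewrite eq = trans (*-identityʳ _) refl
... | no _     | zero  = trans (cong (_* (isZero (occ v xs) + occ v xs)) (+-identityʳ (distinct xs)))
    (trans (distinct-occ v xs) (sym (+-identityʳ (distinct xs))))

∑-occ : ∀ {n k m} (col : Fin n → Fin k) j (x : Vec (Fin n) m) →
  ∑ (λ v → occ v x * 𝟙 (col v ≟ j)) ≡ occ j (map col x)
∑-occ {n} col j []   = ∑-≡0 {n} {λ _ → 0} λ _ → refl
∑-occ col j (x ∷ xs) = begin
  ∑ (λ v → (𝟙 (x ≟ v) + occ v xs) * 𝟙 (col v ≟ j))
    ≡⟨ sum-cong-≗ (λ v → *-distribʳ-+ (𝟙 (col v ≟ j)) (𝟙 (x ≟ v)) (occ v xs)) ⟩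
  ∑ (λ v → 𝟙 (x ≟ v) * 𝟙 (col v ≟ j) + occ v xs * 𝟙 (col v ≟ j))
    ≡⟨ ∑-distrib-+ (λ v → 𝟙 (x ≟ v) * 𝟙 (col v ≟ j)) _ ⟩
  ∑ (λ v → 𝟙 (x ≟ v) * 𝟙 (col v ≟ j)) + ∑ (λ v → occ v xs * 𝟙 (col v ≟ j))
    ≡⟨ cong₂ _+_
         (trans (sum-cong-≗ λ v → cong (_* 𝟙 (col v ≟ j)) (𝟙-cong (x ≟ v) (v ≟ x) sym sym)) (∑-δ x λ v → 𝟙 (col v ≟ j)))
         (∑-occ col j xs) ⟩
  𝟙 (col x ≟ j) + occ j (map col xs) ∎
  where open ≡-Reasoning

-- Free and occupied vertices of colour `j` make up the class. The factor `distinct x` stays on both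
-- sides because `occ j (map col x)` counts a repeated vertex several times.
unused-of-colour : ∀ {n k m} (col : Fin n → Fin k) j (x : Vec (Fin n) m) →
  distinct x * ∑ (λ v → isZero (occ v x) * 𝟙 (col v ≟ j)) ≡ distinct x * (size col j ∸ occ j (map col x))
unused-of-colour col j x with distinct x in eq
... | zero  = refl
... | suc d = cong (suc d *_) (begin
  ∑ (λ v → isZero (occ v x) * 𝟙 (col v ≟ j))                       ≡⟨ m+n∸n≡m _ (occ j (map col x)) ⟨
  ∑ (λ v → isZero (occ v x) * 𝟙 (col v ≟ j)) + occ j (map col x) ∸ occ j (map col x)
    ≡⟨ cong (_∸ occ j (map col x)) total ⟩
  size col j ∸ occ j (map col x)                                    ∎)
  where
  open ≡-Reasoning
  one : ∀ v → isZero (occ v x) + occ v x ≡ 1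
  one v = *-cancelˡ-≡ _ 1 (suc d) (trans (subst (λ t → t * (isZero (occ v x) + occ v x) ≡ t) eq (distinct-occ v x)) (sym (*-identityʳ (suc d))))
  total : ∑ (λ v → isZero (occ v x) * 𝟙 (col v ≟ j)) + occ j (map col x) ≡ size col j
  total = begin
    ∑ (λ v → isZero (occ v x) * 𝟙 (col v ≟ j)) + occ j (map col x)
      ≡⟨ cong (∑ (λ v → isZero (occ v x) * 𝟙 (col v ≟ j)) +_) (∑-occ col j x) ⟨
    ∑ (λ v → isZero (occ v x) * 𝟙 (col v ≟ j)) + ∑ (λ v → occ v x * 𝟙 (col v ≟ j))
      ≡⟨ ∑-distrib-+ (λ v → isZero (occ v x) * 𝟙 (col v ≟ j)) _ ⟨
    ∑ (λ v → isZero (occ v x) * 𝟙 (col v ≟ j) + occ v x * 𝟙 (col v ≟ j))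
      ≡⟨ sum-cong-≗ (λ v → trans (sym (*-distribʳ-+ (𝟙 (col v ≟ j)) (isZero (occ v x)) (occ v x)))
           (trans (cong (_* 𝟙 (col v ≟ j)) (one v)) (*-identityˡ _))) ⟩
    size col j ∎

-- The number of injective vertex sequences with prescribed colours, given the class sizes.
lifts : ∀ {k m} → (Fin k → ℕ) → Vec (Fin k) m → ℕ
lifts s []      = 1
lifts s (j ∷ κ) = (s j ∸ occ j κ) * lifts s κ

lifts-cong : ∀ {k m} {s t : Fin k → ℕ} → (∀ i → s i ≡ t i) → (κ : Vec (Fin k) m) → lifts s κ ≡ lifts t κ
lifts-cong h []      = refl
lifts-cong h (j ∷ κ) = cong₂ _*_ (cong (_∸ occ j κ) (h j)) (lifts-cong h κ)

-- The fibres of `map col` are counted one vertex at a time: once the tail is chosen, a first vertex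
-- of colour `j` is any of the `size col j ∸ occ j κ` free ones. The weight `θ` will be a
-- homomorphism indicator that factors through the colours.
∑V-by-colour : ∀ {n k} (col : Fin n → Fin k) m (θ : Vec (Fin k) m → ℕ) →
  ∑V m (λ x → distinct x * θ (map col x)) ≡ ∑V m (λ κ → lifts (size col) κ * θ κ)
∑V-by-colour col zero    θ = refl
∑V-by-colour {n} {k} col (suc m) θ = begin
  ∑ (λ v → ∑V m λ x → isZero (occ v x) * distinct x * θ (col v ∷ map col x))
    ≡⟨ ∑V-∑ m (λ x v → isZero (occ v x) * distinct x * θ (col v ∷ map col x)) ⟨
  ∑V m (λ x → ∑ λ v → isZero (occ v x) * distinct x * θ (col v ∷ map col x))
    ≡⟨ ∑V-cong m inner ⟩
  ∑V m (λ x → ∑ λ j → distinct x * ((size col j ∸ occ j (map col x)) * θ (j ∷ map col x)))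
    ≡⟨ ∑V-∑ m (λ x j → distinct x * ((size col j ∸ occ j (map col x)) * θ (j ∷ map col x))) ⟩
  ∑ (λ j → ∑V m λ x → distinct x * ((size col j ∸ occ j (map col x)) * θ (j ∷ map col x)))
    ≡⟨ sum-cong-≗ (λ j → ∑V-by-colour col m λ κ → (size col j ∸ occ j κ) * θ (j ∷ κ)) ⟩
  ∑ (λ j → ∑V m λ κ → lifts (size col) κ * ((size col j ∸ occ j κ) * θ (j ∷ κ)))
    ≡⟨ sum-cong-≗ (λ j → ∑V-cong m λ κ → x∙yz≈yx∙z (lifts (size col) κ) (size col j ∸ occ j κ) (θ (j ∷ κ))) ⟩
  ∑ (λ j → ∑V m λ κ → (size col j ∸ occ j κ) * lifts (size col) κ * θ (j ∷ κ)) ∎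
  where
  open ≡-Reasoning
  arrange : ∀ p q r s → p * q * (r * s) ≡ q * (p * r) * s
  arrange = solve-∀
  inner : ∀ x → ∑ (λ v → isZero (occ v x) * distinct x * θ (col v ∷ map col x))
              ≡ ∑ λ j → distinct x * ((size col j ∸ occ j (map col x)) * θ (j ∷ map col x))
  inner x = begin
    ∑ (λ v → isZero (occ v x) * distinct x * θ (col v ∷ map col x))
      ≡⟨ sum-cong-≗ (λ v → trans (cong (isZero (occ v x) * distinct x *_)
           (trans (sym (∑-δ (col v) λ j → θ (j ∷ map col x)))
             (sum-cong-≗ λ j → cong (_* θ (j ∷ map col x)) (𝟙-cong (j ≟ col v) (col v ≟ j) sym sym))))
           (trans (*-distribˡ-sum (isZero (occ v x) * distinct x) λ j → 𝟙 (col v ≟ j) * θ (j ∷ map col x))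
             (sum-cong-≗ λ j → arrange (isZero (occ v x)) (distinct x) (𝟙 (col v ≟ j)) (θ (j ∷ map col x))))) ⟩
    ∑ (λ v → ∑ λ j → distinct x * (isZero (occ v x) * 𝟙 (col v ≟ j)) * θ (j ∷ map col x))
      ≡⟨ ∑-comm (λ v j → distinct x * (isZero (occ v x) * 𝟙 (col v ≟ j)) * θ (j ∷ map col x)) ⟩
    ∑ (λ j → ∑ λ v → distinct x * (isZero (occ v x) * 𝟙 (col v ≟ j)) * θ (j ∷ map col x))
      ≡⟨ sum-cong-≗ (λ j → trans (sym (*-distribʳ-sum (θ (j ∷ map col x)) λ v → distinct x * (isZero (occ v x) * 𝟙 (col v ≟ j))))
           (trans (cong (_* θ (j ∷ map col x)) (trans (sym (*-distribˡ-sum (distinct x) λ v → isZero (occ v x) * 𝟙 (col v ≟ j))) (unused-of-colour col j x)))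
             (*-assoc (distinct x) _ _))) ⟩
    ∑ (λ j → distinct x * ((size col j ∸ occ j (map col x)) * θ (j ∷ map col x))) ∎

-- The coefficient functional of (αβ)ᴹ (α+β)ʳ, where α and β shift the two arguments of g.
ev : ℕ → ℕ → (ℕ → ℕ → ℕ) → ℕ
ev M zero    g = g M M
ev M (suc r) g = ev M r (λ x y → g (suc x) y) + ev M r (λ x y → g x (suc y))

ev-suc : ∀ M r g → ev M r (λ x y → g (suc x) (suc y)) ≡ ev (suc M) r g
ev-suc M zero    g = refl
ev-suc M (suc r) g = cong₂ _+_ (ev-suc M r λ x y → g (suc x) y) (ev-suc M r λ x y → g x (suc y))

fall₂ : ℕ → ℕ → ℕ → ℕ → ℕ
fall₂ a b x y = falling a x * falling b y

-- Vandermonde's identity for falling factorials.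
ev-fall₂ : ∀ a b M r x y →
  ev M r (λ i j → fall₂ a b (x + i) (y + j)) ≡
  falling a (x + M) * falling b (y + M) * falling ((a ∸ (x + M)) + (b ∸ (y + M))) r
ev-fall₂ a b M zero    x y = sym (*-identityʳ _)
ev-fall₂ a b M (suc r) x y = begin
  ev M r (λ i j → fall₂ a b (x + suc i) (y + j)) + ev M r (λ i j → fall₂ a b (x + i) (y + suc j))
    ≡⟨ cong₂ _+_ (ev-cong M r λ i j → cong (λ t → fall₂ a b t (y + j)) (+-suc x i))
                 (ev-cong M r λ i j → cong (λ t → fall₂ a b (x + i) t) (+-suc y j)) ⟩
  ev M r (λ i j → fall₂ a b (suc x + i) (y + j)) + ev M r (λ i j → fall₂ a b (x + i) (suc y + j))
    ≡⟨ cong₂ _+_ (ev-fall₂ a b M r (suc x) y) (ev-fall₂ a b M r x (suc y)) ⟩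
  falling a (suc X) * falling b Y * falling ((a ∸ suc X) + (b ∸ Y)) r +
  falling a X * falling b (suc Y) * falling ((a ∸ X) + (b ∸ suc Y)) r
    ≡⟨ step ⟩
  falling a X * falling b Y * falling ((a ∸ X) + (b ∸ Y)) (suc r) ∎
  where
  open ≡-Reasoning
  X = x + M
  Y = y + M
  ev-cong : ∀ M r {g h : ℕ → ℕ → ℕ} → (∀ i j → g i j ≡ h i j) → ev M r g ≡ ev M r h
  ev-cong M zero    e = e M M
  ev-cong M (suc r) e = cong₂ _+_ (ev-cong M r λ i j → e (suc i) j) (ev-cong M r λ i j → e i (suc j))
  pred∸ : ∀ a X → a ∸ suc X ≡ (a ∸ X) ∸ 1
  pred∸ a X = trans (cong (a ∸_) (+-comm 1 X)) (sym (∸-+-assoc a X 1))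
  -- The Pascal-type step p * falling (p-1+q) r + q * falling (p+q-1) r = falling (p+q) (r+1). The
  -- cases p = 0 and q = 0 are separate because `0 ∸ 1` is 0; there the factor 0 kills the wrong
  -- term.
  algebra : ∀ p q f g → p * f * g * falling ((p ∸ 1) + q) r + f * (q * g) * falling (p + (q ∸ 1)) r ≡ f * g * falling (p + q) (suc r)
  algebra zero    zero    f g = trans (cong (_* falling 0 r) (*-zeroʳ f))
    (sym (trans (cong (f * g *_) (falling-zero {0} {suc r} (s≤s z≤n))) (*-zeroʳ (f * g))))
  algebra zero    (suc q) f g = trans (move f (suc q) g (falling q r)) (cong (f * g *_) (sym (falling-suc q r)))
    where move : ∀ f q g t → f * (q * g) * t ≡ f * g * (q * t)
          move = solve-∀
  algebra (suc p) zero    f g = trans (cong₂ _+_ (move (suc p) f g (falling (p + 0) r)) (cong (_* falling (suc p + 0) r) (*-zeroʳ f)))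
    (trans (+-identityʳ _) (trans (cong (λ t → f * g * (suc t * falling (p + 0) r)) (sym (+-identityʳ p))) (cong (f * g *_) (sym (falling-suc (p + 0) r)))))
    where move : ∀ q f g t → q * f * g * t ≡ f * g * (q * t)
          move = solve-∀
  algebra (suc p) (suc q) f g = trans
    (cong (λ t → suc p * f * g * falling (p + suc q) r + f * (suc q * g) * falling t r) (sym (+-suc p q)))
    (trans (move p q f g (falling (p + suc q) r)) (cong (f * g *_) (sym (falling-suc (p + suc q) r))))
    where move : ∀ p q f g t → suc p * f * g * t + f * (suc q * g) * t ≡ f * g * (suc (p + suc q) * t)
          move = solve-∀
  step : falling a (suc X) * falling b Y * falling ((a ∸ suc X) + (b ∸ Y)) r +
         falling a X * falling b (suc Y) * falling ((a ∸ X) + (b ∸ suc Y)) r ≡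
         falling a X * falling b Y * falling ((a ∸ X) + (b ∸ Y)) (suc r)
  step rewrite pred∸ a X | pred∸ b Y = algebra (a ∸ X) (b ∸ Y) (falling a X) (falling b Y)

-- In Vandermonde's product the last factor depends only on the sum of the two sizes, which the move
-- preserves, so `falling-product-mono` decides. For M > b, where truncation spoils this, the left
-- side is 0.
ev-fall₂-mono : ∀ {a b} M r → b ≤ a → ev M r (fall₂ (suc a) b) ≤ ev M r (fall₂ a (suc b))
ev-fall₂-mono {a} {b} M r b≤a = subst₂ _≤_ (sym (ev-fall₂ (suc a) b M r 0 0)) (sym (ev-fall₂ a (suc b) M r 0 0)) bound
  where
  bound : falling (suc a) M * falling b M * falling ((suc a ∸ M) + (b ∸ M)) r ≤
          falling a M * falling (suc b) M * falling ((a ∸ M) + (suc b ∸ M)) r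
  bound with M ≤? b
  ... | no M≰b = ≤-trans (≤-reflexive (trans (cong (λ t → falling (suc a) M * t * falling ((suc a ∸ M) + (b ∸ M)) r) (falling-zero (≰⇒> M≰b)))
                   (cong (_* falling ((suc a ∸ M) + (b ∸ M)) r) (*-zeroʳ (falling (suc a) M))))) z≤n
  ... | yes M≤b rewrite +-∸-assoc 1 M≤b | +-∸-assoc 1 (≤-trans M≤b b≤a) | +-suc (a ∸ M) (b ∸ M) =
    *-monoˡ-≤ _ (falling-product-mono M b≤a)

-- Functionals symmetric in the two classes

Functional : Set
Functional = (ℕ → ℕ → ℕ) → ℕ

⟦_⟧ : List (ℕ × ℕ) → Functional
⟦ [] ⟧          g = 0
⟦ (M , r) ∷ l ⟧ g = ev M r g + ⟦ l ⟧ g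

-- The cone of nonnegative combinations of the (αβ)ᴹ(α+β)ʳ. An inequality between two values of such
-- a functional need only be checked on these generators, by `rep-mono`.
Representable : Functional → Set
Representable F = ∃[ l ] (∀ g → F g ≡ ⟦ l ⟧ g)

rep-≗ : {F F′ : Functional} → (∀ g → F g ≡ F′ g) → Representable F′ → Representable F
rep-≗ e (l , h) = l , λ g → trans (e g) (h g)

rep-0 : Representable (λ _ → 0)
rep-0 = [] , λ _ → refl

rep-+ : {F F′ : Functional} → Representable F → Representable F′ → Representable (λ g → F g + F′ g)
rep-+ (l , h) (l′ , h′) = l ++ l′ , λ g → trans (cong₂ _+_ (h g) (h′ g)) (sym (append l g))
  where
  append : ∀ l {l′} g → ⟦ l ++ l′ ⟧ g ≡ ⟦ l ⟧ g + ⟦ l′ ⟧ g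
  append []            g = refl
  append ((M , r) ∷ l) g = trans (cong (ev M r g +_) (append l g)) (sym (+-assoc (ev M r g) _ _))

rep-* : ∀ {F : Functional} c → Representable F → Representable (λ g → c * F g)
rep-* zero    h = rep-0
rep-* (suc c) h = rep-+ h (rep-* c h)

rep-∑ : ∀ {k} {F : Fin k → Functional} → (∀ i → Representable (F i)) → Representable (λ g → ∑ λ i → F i g)
rep-∑ {zero}  h = rep-0
rep-∑ {suc k} h = rep-+ (h zero) (rep-∑ (h ∘ suc))

rep-αβ : {F : Functional} → Representable F → Representable (λ g → F (λ x y → g (suc x) (suc y)))
rep-αβ (l , h) = shift l , λ g → trans (h _) (correct l g)
  where
  shift : List (ℕ × ℕ) → List (ℕ × ℕ)
  shift []            = []
  shift ((M , r) ∷ l) = (suc M , r) ∷ shift l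
  correct : ∀ l g → ⟦ l ⟧ (λ x y → g (suc x) (suc y)) ≡ ⟦ shift l ⟧ g
  correct []            g = refl
  correct ((M , r) ∷ l) g = cong₂ _+_ (ev-suc M r g) (correct l g)

rep-α+β : {F : Functional} → Representable F →
  Representable (λ g → F (λ x y → g (suc x) y) + F (λ x y → g x (suc y)))
rep-α+β (l , h) = shift l , λ g → trans (cong₂ _+_ (h _) (h _)) (correct l g)
  where
  shift : List (ℕ × ℕ) → List (ℕ × ℕ)
  shift []            = []
  shift ((M , r) ∷ l) = (M , suc r) ∷ shift l
  swap₄ : ∀ p q r s → (p + q) + (r + s) ≡ (p + r) + (q + s)
  swap₄ = solve-∀
  correct : ∀ l g → ⟦ l ⟧ (λ x y → g (suc x) y) + ⟦ l ⟧ (λ x y → g x (suc y)) ≡ ⟦ shift l ⟧ g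
  correct []            g = refl
  correct ((M , r) ∷ l) g = trans (swap₄ (ev M r λ x y → g (suc x) y) _ (ev M r λ x y → g x (suc y)) _)
    (cong (ev M (suc r) g +_) (correct l g))

rep-mono : {F : Functional} → Representable F → ∀ {g g′} → (∀ M r → ev M r g ≤ ev M r g′) → F g ≤ F g′
rep-mono (l , h) {g} {g′} le = subst₂ _≤_ (sym (h g)) (sym (h g′)) (go l)
  where
  go : ∀ l → ⟦ l ⟧ g ≤ ⟦ l ⟧ g′
  go []            = z≤n
  go ((M , r) ∷ l) = +-mono-≤ (le M r) (go l)

-- Alternating runs inside two classes

module TwoClasses {k : ℕ} (P Q : Fin k) (P≢Q : P ≢ Q) where

  -- Identifying Q with P keeps exactly the part of a colouring whose weight does not change when
  -- vertices move between the two classes.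
  merge : Fin k → Fin k
  merge i with i ≟ Q
  ... | yes _ = P
  ... | no  _ = i

  merge-P : merge P ≡ P
  merge-P with P ≟ Q
  ... | yes _ = refl
  ... | no  _ = refl

  merge-Q : merge Q ≡ P
  merge-Q with Q ≟ Q
  ... | yes _ = refl
  ... | no ne = ⊥-elim (ne refl)

  merge-other : ∀ {i} → i ≢ Q → merge i ≡ i
  merge-other {i} ne with i ≟ Q
  ... | yes e = ⊥-elim (ne e)
  ... | no  _ = refl

  shift : ℕ → ℕ → (ℕ → ℕ → ℕ) → ℕ → ℕ → ℕ
  shift p q g x y = g (p + x) (q + y)

  -- Weighted sum over the colourings continuing a vertex of colour j; the weight ψ does not
  -- distinguish the classes P and Q, and g records how often each of them is used.
  U : ∀ {m} → Vec Bool m → Fin k → (Vec (Fin k) m → ℕ) → Functional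
  U []       j ψ g = ψ [] * g 0 0
  U (b ∷ bs) j ψ g = ∑ λ i → link (complete k) b j i *
    U bs i (λ κ → ψ (merge i ∷ κ)) (shift (𝟙 (i ≟ P)) (𝟙 (i ≟ Q)) g)

  U-sum : ∀ {m} (bs : Vec Bool m) j ψ g →
    ∑V m (λ κ → hom (complete k) bs (j ∷ κ) * (ψ (map merge κ) * g (occ P κ) (occ Q κ))) ≡ U bs j ψ g
  U-sum []       j ψ g = *-identityˡ _
  U-sum {suc m} (b ∷ bs) j ψ g = sum-cong-≗ λ i → trans
    (∑V-cong m λ κ → *-assoc (link (complete k) b j i) (hom (complete k) bs (i ∷ κ)) _)
    (trans (∑V-*ˡ m (link (complete k) b j i) (λ κ → hom (complete k) bs (i ∷ κ) *
        (ψ (merge i ∷ map merge κ) * g (𝟙 (i ≟ P) + occ P κ) (𝟙 (i ≟ Q) + occ Q κ))))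
      (cong (link (complete k) b j i *_)
        (U-sum bs i (λ κ → ψ (merge i ∷ κ)) (shift (𝟙 (i ≟ P)) (𝟙 (i ≟ Q)) g))))

  other? : (i : Fin k) → Dec (i ≢ P × i ≢ Q)
  other? i = ¬? (i ≟ P) ×-dec ¬? (i ≟ Q)

  ∑-split : (f : Fin k → ℕ) → ∑ f ≡ f P + f Q + ∑ λ i → 𝟙 (other? i) * f i
  ∑-split f = begin
    ∑ f
      ≡⟨ sum-cong-≗ (λ i → trans (sym (*-identityˡ (f i))) (trans (cong (_* f i) (one i)) (distrib (𝟙 (i ≟ P)) (𝟙 (i ≟ Q)) (𝟙 (other? i)) (f i)))) ⟩
    ∑ (λ i → (𝟙 (i ≟ P) * f i + 𝟙 (i ≟ Q) * f i) + 𝟙 (other? i) * f i)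
      ≡⟨ ∑-distrib-+ (λ i → 𝟙 (i ≟ P) * f i + 𝟙 (i ≟ Q) * f i) _ ⟩
    ∑ (λ i → 𝟙 (i ≟ P) * f i + 𝟙 (i ≟ Q) * f i) + ∑ (λ i → 𝟙 (other? i) * f i)
      ≡⟨ cong (_+ ∑ (λ i → 𝟙 (other? i) * f i)) (trans (∑-distrib-+ (λ i → 𝟙 (i ≟ P) * f i) _) (cong₂ _+_ (∑-δ P f) (∑-δ Q f))) ⟩
    f P + f Q + ∑ (λ i → 𝟙 (other? i) * f i) ∎
    where
    open ≡-Reasoning
    distrib : ∀ p q r t → (p + q + r) * t ≡ (p * t + q * t) + r * t
    distrib = solve-∀
    one : ∀ i → 1 ≡ 𝟙 (i ≟ P) + 𝟙 (i ≟ Q) + 𝟙 (other? i)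
    one i with i ≟ P | i ≟ Q
    ... | yes p | yes q = ⊥-elim (P≢Q (trans (sym p) q))
    ... | yes _ | no _  = refl
    ... | no _  | yes _ = refl
    ... | no _  | no _  = refl

  α β : (ℕ → ℕ → ℕ) → ℕ → ℕ → ℕ
  α g x y = g (suc x) y
  β g x y = g x (suc y)

  U-at-P : ∀ {m} (bs : Vec Bool m) (ψ : Vec (Fin k) (suc m) → ℕ) g →
    U bs P (λ κ → ψ (merge P ∷ κ)) (shift (𝟙 (P ≟ P)) (𝟙 (P ≟ Q)) g) ≡ U bs P (λ κ → ψ (P ∷ κ)) (α g)
  U-at-P bs ψ g rewrite merge-P | 𝟙-yes (P ≟ P) refl | 𝟙-no (P ≟ Q) P≢Q = refl

  U-at-Q : ∀ {m} (bs : Vec Bool m) (ψ : Vec (Fin k) (suc m) → ℕ) g →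
    U bs Q (λ κ → ψ (merge Q ∷ κ)) (shift (𝟙 (Q ≟ P)) (𝟙 (Q ≟ Q)) g) ≡ U bs Q (λ κ → ψ (P ∷ κ)) (β g)
  U-at-Q bs ψ g rewrite merge-Q | 𝟙-yes (Q ≟ Q) refl | 𝟙-no (Q ≟ P) (P≢Q ∘ sym) = refl

  U-at-other : ∀ {m} (bs : Vec Bool m) {i} → i ≢ P → i ≢ Q → ∀ ψ g →
    U bs i ψ (shift (𝟙 (i ≟ P)) (𝟙 (i ≟ Q)) g) ≡ U bs i ψ g
  U-at-other bs {i} nP nQ ψ g rewrite 𝟙-no (i ≟ P) nP | 𝟙-no (i ≟ Q) nQ = refl

  -- A maximal run of vertices in P ∪ Q alternates between the two classes, so starting a run
  -- contributes either P-first or Q-first: the functional is L + R∘β after P and L + R∘α after Q.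
  Paired : (F F′ : Functional) → Set
  Paired F F′ = Σ[ L ∈ Functional ] Σ[ R ∈ Functional ] (Representable L × Representable R ×
    (∀ g → F g ≡ L g + R (β g)) × (∀ g → F′ g ≡ L g + R (α g)))

  Others : ∀ {m} → Vec Bool m → Set
  Others {m} bs = ∀ {i} → i ≢ P → i ≢ Q → (ψ : Vec (Fin k) m → ℕ) → Representable (U bs i ψ)

  Pairs : ∀ {m} → Vec Bool m → Set
  Pairs {m} bs = (ψ : Vec (Fin k) m → ℕ) → Paired (U bs P ψ) (U bs Q ψ)

  rest : ∀ {m} (bs : Vec Bool m) (c : Fin k → ℕ) (ψ : Vec (Fin k) (suc m) → ℕ) → Functional
  rest bs c ψ g = ∑ λ i → 𝟙 (other? i) * (c i * U bs i (λ κ → ψ (merge i ∷ κ)) (shift (𝟙 (i ≟ P)) (𝟙 (i ≟ Q)) g))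

  rep-rest : ∀ {m} (bs : Vec Bool m) → Others bs → ∀ c ψ → Representable (rest bs c ψ)
  rep-rest bs oth c ψ = rep-∑ one
    where
    one : ∀ i → Representable λ g → 𝟙 (other? i) * (c i * U bs i (λ κ → ψ (merge i ∷ κ)) (shift (𝟙 (i ≟ P)) (𝟙 (i ≟ Q)) g))
    one i with other? i
    ... | no _ = rep-0
    ... | yes (nP , nQ) = rep-* 1 (rep-* (c i) (rep-≗ (U-at-other bs nP nQ _) (oth nP nQ _)))

  -- A run that may start in either class gives α(L + βR) + β(L + αR) = (α+β)L + 2αβR, and the cone
  -- is stable under α+β and αβ.
  rep-both : ∀ {F F′} → Paired F F′ → Representable λ g → F (α g) + F′ (β g)
  rep-both (L , R , rL , rR , eF , eF′) = rep-≗
    (λ g → trans (cong₂ _+_ (eF (α g)) (eF′ (β g))) (arrange (L (α g)) (R (β (α g))) (L (β g))))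
    (rep-+ (rep-α+β rL) (rep-* 2 (rep-αβ rR)))
    where
    arrange : ∀ p q r → (p + q) + (r + q) ≡ (p + r) + 2 * q
    arrange = solve-∀

  -- The next vertex may enter both P and Q, either because the present one lies in a third class or
  -- because no edge is required. The two entries are then covered together by `rep-both`.
  rep-free : ∀ {m} (bs : Vec Bool m) → Others bs → Pairs bs → ∀ (c : Fin k → ℕ) → c P ≡ 1 → c Q ≡ 1 → ∀ ψ →
    Representable λ g → ∑ λ i → c i * U bs i (λ κ → ψ (merge i ∷ κ)) (shift (𝟙 (i ≟ P)) (𝟙 (i ≟ Q)) g)
  rep-free bs oth prs c cP cQ ψ = rep-≗
    (λ g → trans (∑-split _) (cong (_+ rest bs c ψ g) (cong₂ _+_
      (trans (cong₂ _*_ cP (U-at-P bs ψ g)) (*-identityˡ _))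
      (trans (cong₂ _*_ cQ (U-at-Q bs ψ g)) (*-identityˡ _)))))
    (rep-+ (rep-both (prs (λ κ → ψ (P ∷ κ)))) (rep-rest bs oth c ψ))

  mutual
    others : ∀ {m} (bs : Vec Bool m) → Others bs
    others [] nP nQ ψ = rep-* (ψ []) ((0 , 0) ∷ [] , λ g → sym (+-identityʳ _))
    others (true ∷ bs) {i} nP nQ ψ = rep-free bs (others bs) (pairs bs) (link (complete k) true i)
      (𝟙-yes (adj? (complete k) i P) nP) (𝟙-yes (adj? (complete k) i Q) nQ) ψ
    others (false ∷ bs) {i} nP nQ ψ = rep-free bs (others bs) (pairs bs) (link (complete k) false i) refl refl ψ

    pairs : ∀ {m} (bs : Vec Bool m) → Pairs bs
    pairs [] ψ = (λ g → ψ [] * g 0 0) , (λ _ → 0) ,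
      rep-* (ψ []) ((0 , 0) ∷ [] , λ g → sym (+-identityʳ _)) , rep-0 ,
      (λ g → sym (+-identityʳ _)) , (λ g → sym (+-identityʳ _))
    pairs (false ∷ bs) ψ = _ , (λ _ → 0) ,
      rep-free bs (others bs) (pairs bs) (link (complete k) false P) refl refl ψ , rep-0 ,
      (λ g → sym (+-identityʳ _)) , (λ g → sym (+-identityʳ _))
    -- After P, a next vertex in P ∪ Q must lie in Q and contributes β(L + αR). So αβR joins the
    -- part common to both starts and the old L takes the place of R; after Q it is symmetric.
    pairs (true ∷ bs) ψ with pairs bs (λ κ → ψ (P ∷ κ))
    ... | L , R , rL , rR , eP , eQ =
      (λ g → rest bs one ψ g + R (α (β g))) , L ,
      rep-+ (rep-rest bs (others bs) one ψ) (rep-αβ rR) , rL , afterP , afterQ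
      where
      one : Fin k → ℕ
      one _ = 1
      c : Fin k → Fin k → ℕ
      c = A (complete k)
      same-rest : ∀ j → (j ≡ P ⊎ j ≡ Q) → ∀ g → rest bs (c j) ψ g ≡ rest bs one ψ g
      same-rest j jPQ g = sum-cong-≗ λ i → same i
        where
        same : ∀ i → 𝟙 (other? i) * (c j i * U bs i (λ κ → ψ (merge i ∷ κ)) (shift (𝟙 (i ≟ P)) (𝟙 (i ≟ Q)) g))
                   ≡ 𝟙 (other? i) * (1 * U bs i (λ κ → ψ (merge i ∷ κ)) (shift (𝟙 (i ≟ P)) (𝟙 (i ≟ Q)) g))
        same i with other? i
        ... | no _ = refl
        ... | yes (nP , nQ) = cong (λ t → 1 * (t * U bs i (λ κ → ψ (merge i ∷ κ)) (shift (𝟙 (i ≟ P)) (𝟙 (i ≟ Q)) g)))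
          (𝟙-yes (adj? (complete k) j i) (ne jPQ))
          where
          ne : (j ≡ P ⊎ j ≡ Q) → j ≢ i
          ne (inj₁ refl) refl = nP refl
          ne (inj₂ refl) refl = nQ refl
      arrange : ∀ p q r → (p + q) + r ≡ (r + q) + p
      arrange = solve-∀
      afterP : ∀ g → U (true ∷ bs) P ψ g ≡ (rest bs one ψ g + R (α (β g))) + L (β g)
      afterP g = trans (∑-split _) (trans (cong₂ _+_ (cong₂ _+_
          (cong (_* U bs P (λ κ → ψ (merge P ∷ κ)) (shift (𝟙 (P ≟ P)) (𝟙 (P ≟ Q)) g)) (𝟙-no (adj? (complete k) P P) (λ ne → ne refl)))
          (trans (cong₂ _*_ (𝟙-yes (adj? (complete k) P Q) P≢Q) (trans (U-at-Q bs ψ g) (eQ (β g)))) (*-identityˡ _)))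
          (same-rest P (inj₁ refl) g))
        (arrange (L (β g)) (R (α (β g))) (rest bs one ψ g)))
      afterQ : ∀ g → U (true ∷ bs) Q ψ g ≡ (rest bs one ψ g + R (α (β g))) + L (α g)
      afterQ g = trans (∑-split _) (trans (cong₂ _+_ (cong₂ _+_
          (trans (cong₂ _*_ (𝟙-yes (adj? (complete k) Q P) (P≢Q ∘ sym)) (trans (U-at-P bs ψ g) (eP (α g)))) (*-identityˡ _))
          (cong (_* U bs Q (λ κ → ψ (merge Q ∷ κ)) (shift (𝟙 (Q ≟ P)) (𝟙 (Q ≟ Q)) g)) (𝟙-no (adj? (complete k) Q Q) (λ ne → ne refl))))
          (same-rest Q (inj₂ refl) g))
        (trans (cong (_+ rest bs one ψ g) (+-identityʳ _)) (arrange (L (α g)) (R (α (β g))) (rest bs one ψ g))))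

  -- Meant for merged colourings, where P stands for both classes and is skipped; the value is then
  -- independent of the sizes of P and Q.
  otherLifts : ∀ {m} → (Fin k → ℕ) → Vec (Fin k) m → ℕ
  otherLifts s []      = 1
  otherLifts s (j ∷ κ) with j ≟ P
  ... | yes _ = otherLifts s κ
  ... | no  _ = (s j ∸ occ j κ) * otherLifts s κ

  otherLifts-cong : ∀ {m} {s t : Fin k → ℕ} → (∀ i → i ≢ P → i ≢ Q → s i ≡ t i) →
    (κ : Vec (Fin k) m) → otherLifts s (map merge κ) ≡ otherLifts t (map merge κ)
  otherLifts-cong h [] = refl
  otherLifts-cong h (j ∷ κ) with merge j ≟ P
  ... | yes _ = otherLifts-cong h κ
  ... | no ne = cong₂ _*_ (cong (_∸ occ (merge j) (map merge κ)) (h (merge j) ne neQ)) (otherLifts-cong h κ)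
    where
    neQ : merge j ≢ Q
    neQ with j ≟ Q
    ... | yes _ = P≢Q
    ... | no jQ = jQ

  occ-merge : ∀ {m j} → j ≢ P → j ≢ Q → (κ : Vec (Fin k) m) → occ j (map merge κ) ≡ occ j κ
  occ-merge nP nQ [] = refl
  occ-merge {j = j} nP nQ (i ∷ κ) = cong₂ _+_ (𝟙-cong (merge i ≟ j) (i ≟ j) to from) (occ-merge nP nQ κ)
    where
    to : merge i ≡ j → i ≡ j
    to e with i ≟ Q
    ... | yes _ = ⊥-elim (nP (sym e))
    ... | no _  = e
    from : i ≡ j → merge i ≡ j
    from refl = merge-other nQ

  lifts-split : ∀ {m} s (κ : Vec (Fin k) m) →
    lifts s κ ≡ otherLifts s (map merge κ) * fall₂ (s P) (s Q) (occ P κ) (occ Q κ)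
  lifts-split s [] = refl
  lifts-split s (j ∷ κ) with j ≟ P | j ≟ Q
  ... | yes p | yes q = ⊥-elim (P≢Q (trans (sym p) q))
  ... | yes refl | no _ with P ≟ P
  ...   | no ne = ⊥-elim (ne refl)
  ...   | yes _ = trans (cong ((s P ∸ occ P κ) *_) (lifts-split s κ)) (arrange (s P ∸ occ P κ) (otherLifts s (map merge κ)) (falling (s P) (occ P κ)) (falling (s Q) (occ Q κ)))
    where
    arrange : ∀ p o f g → p * (o * (f * g)) ≡ o * (p * f * g)
    arrange = solve-∀
  lifts-split s (j ∷ κ) | no nP | yes refl with P ≟ P
  ...   | no ne = ⊥-elim (ne refl)
  ...   | yes _ = trans (cong ((s Q ∸ occ Q κ) *_) (lifts-split s κ)) (arrange (s Q ∸ occ Q κ) (otherLifts s (map merge κ)) (falling (s P) (occ P κ)) (falling (s Q) (occ Q κ)))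
    where
    arrange : ∀ p o f g → p * (o * (f * g)) ≡ o * (f * (p * g))
    arrange = solve-∀
  lifts-split s (j ∷ κ) | no nP | no nQ with j ≟ P
  ...   | yes p = ⊥-elim (nP p)
  ...   | no _  = trans (cong₂ _*_ (cong (s j ∸_) (sym (occ-merge nP nQ κ))) (lifts-split s κ)) (sym (*-assoc (s j ∸ occ j (map merge κ)) _ _))

-- Balancing the class sizes

embMulti : ∀ {k m} → (Fin k → ℕ) → Vec Bool m → ℕ
embMulti {k} {m} s bs = ∑V (suc m) λ κ → lifts s κ * hom (complete k) bs κ

-- The classes other than P and Q enter only through `otherLifts`, on which `s` and `t` agree. What
-- remains is one representable functional evaluated at `fall₂` for the two pairs of sizes, so
-- `ev-fall₂-mono` on the generators suffices.
embMulti-shift : ∀ {k m} (bs : Vec Bool m) {P Q : Fin k} → P ≢ Q → (s t : Fin k → ℕ) →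
  s P ≡ suc (t P) → t Q ≡ suc (s Q) → s Q ≤ t P → (∀ i → i ≢ P → i ≢ Q → s i ≡ t i) →
  embMulti s bs ≤ embMulti t bs
embMulti-shift {k} {m} bs {P} {Q} P≢Q s t eP eQ le eO = begin
  embMulti s bs                              ≡⟨ as-functional s ⟩
  F (otherLifts s) (fall₂ (s P) (s Q))       ≡⟨ sum-cong-≗ (λ i → ∑V-cong m λ κ → cong (λ o → hom (complete k) bs (i ∷ κ) * (o * fall₂ (s P) (s Q) (𝟙 (i ≟ P) + occ P κ) (𝟙 (i ≟ Q) + occ Q κ))) (otherLifts-cong eO (i ∷ κ))) ⟩
  F (otherLifts t) (fall₂ (s P) (s Q))       ≤⟨ rep-mono rep (λ M r → subst₂ (λ p q → ev M r (fall₂ p (s Q)) ≤ ev M r (fall₂ (t P) q)) (sym eP) (sym eQ) (ev-fall₂-mono M r le)) ⟩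
  F (otherLifts t) (fall₂ (t P) (t Q))       ≡⟨ as-functional t ⟨
  embMulti t bs                              ∎
  where
  open TwoClasses P Q P≢Q
  open ≤-Reasoning
  F : (Vec (Fin k) (suc m) → ℕ) → Functional
  F ψ g = ∑V (suc m) λ κ → hom (complete k) bs κ * (ψ (map merge κ) * g (occ P κ) (occ Q κ))
  as-functional : ∀ s → embMulti s bs ≡ F (otherLifts s) (fall₂ (s P) (s Q))
  as-functional s = ∑V-cong (suc m) λ κ → trans (*-comm (lifts s κ) (hom (complete k) bs κ)) (cong (hom (complete k) bs κ *_) (lifts-split s κ))
  rep : Representable (F (otherLifts t))
  rep = rep-≗ (λ g → sum-cong-≗ λ i → trans (U-sum bs i (λ κ → otherLifts t (merge i ∷ κ)) (shift (𝟙 (i ≟ P)) (𝟙 (i ≟ Q)) g)) (sym (*-identityˡ _)))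
    (rep-free bs (others bs) (pairs bs) (λ _ → 1) refl refl (otherLifts t))

-- Induction on the total excess `d` of `s` over `t`. If d = 0, equal sums force s = t. Otherwise
-- there are a class P in excess and a class Q in deficit, and moving one vertex from P to Q lowers
-- `d` by one.
embMulti-balanced : ∀ {k m} (bs : Vec Bool m) (t : Fin k → ℕ) → (∀ i j → t i ≤ suc (t j)) →
  ∀ d s → ∑ s ≡ ∑ t → ∑ (λ i → s i ∸ t i) ≡ d → embMulti s bs ≤ embMulti t bs
embMulti-balanced {k} {m} bs t bal zero s sum≡ d≡ = ≤-reflexive
  (∑V-cong (suc m) λ κ → cong (_* hom (complete k) bs κ) (lifts-cong s≗t κ))
  where
  s≤t : ∀ i → s i ≤ t i
  s≤t i = m∸n≡0⇒m≤n (n≤0⇒n≡0 (≤-trans (term≤∑ (λ i → s i ∸ t i) i) (≤-reflexive d≡)))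
  gap : ∑ (λ i → t i ∸ s i) ≡ 0
  gap = +-cancelˡ-≡ (∑ s) _ 0 (trans (sym (∑-distrib-+ s λ i → t i ∸ s i))
    (trans (sum-cong-≗ λ i → m+[n∸m]≡n (s≤t i)) (trans (sym sum≡) (sym (+-identityʳ _)))))
  s≗t : ∀ i → s i ≡ t i
  s≗t i = ≤-antisym (s≤t i) (m∸n≡0⇒m≤n (n≤0⇒n≡0 (≤-trans (term≤∑ (λ i → t i ∸ s i) i) (≤-reflexive gap))))
embMulti-balanced {k} {m} bs t bal (suc d) s sum≡ d≡ with ∑-pos (λ i → s i ∸ t i) (subst (0 <_) (sym d≡) (s≤s z≤n)) | any? (λ i → s i <? t i)
... | P , posP | no none = ⊥-elim (<-irrefl (sym sum≡) (strict s t P (λ i → ≮⇒≥ λ lt → none (i , lt)) (m∸n≢0⇒n<m (λ e → <-irrefl (sym e) posP))))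
  where
  strict : ∀ {k} (s t : Fin k → ℕ) P → (∀ i → t i ≤ s i) → t P < s P → ∑ t < ∑ s
  strict s t zero    le lt = +-mono-<-≤ lt (∑-mono (le ∘ suc))
  strict s t (suc P) le lt = +-mono-≤-< (le zero) (strict (s ∘ suc) (t ∘ suc) P (le ∘ suc) lt)
... | P , posP | yes (Q , sQ<tQ) = ≤-trans
    (embMulti-shift bs P≢Q s s′ eP eQ le eO)
    (embMulti-balanced bs t bal d s′ sum′ d′)
  where
  tP<sP : t P < s P
  tP<sP = m∸n≢0⇒n<m (λ e → <-irrefl (sym e) posP)
  P≢Q : P ≢ Q
  P≢Q refl = <-asym tP<sP sQ<tQ
  s′ : Fin k → ℕ
  s′ i = s i + 𝟙 (i ≟ Q) ∸ 𝟙 (i ≟ P)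
  s′+ : ∀ i → s′ i + 𝟙 (i ≟ P) ≡ s i + 𝟙 (i ≟ Q)
  s′+ i = m∸n+n≡m (bound i)
    where
    bound : ∀ i → 𝟙 (i ≟ P) ≤ s i + 𝟙 (i ≟ Q)
    bound i with i ≟ P
    ... | no _     = z≤n
    ... | yes refl = ≤-trans (≤-trans (s≤s z≤n) tP<sP) (m≤m+n (s P) _)
  ∑𝟙 : ∀ (R : Fin k) → ∑ (λ i → 𝟙 (i ≟ R)) ≡ 1
  ∑𝟙 R = trans (sum-cong-≗ λ i → sym (*-identityʳ (𝟙 (i ≟ R)))) (∑-δ R λ _ → 1)
  sum′ : ∑ s′ ≡ ∑ t
  sum′ = trans (+-cancelʳ-≡ 1 (∑ s′) (∑ s) (begin
    ∑ s′ + 1                             ≡⟨ cong (∑ s′ +_) (∑𝟙 P) ⟨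
    ∑ s′ + ∑ (λ i → 𝟙 (i ≟ P))           ≡⟨ ∑-distrib-+ s′ _ ⟨
    ∑ (λ i → s′ i + 𝟙 (i ≟ P))           ≡⟨ sum-cong-≗ s′+ ⟩
    ∑ (λ i → s i + 𝟙 (i ≟ Q))            ≡⟨ ∑-distrib-+ s _ ⟩
    ∑ s + ∑ (λ i → 𝟙 (i ≟ Q))            ≡⟨ cong (∑ s +_) (∑𝟙 Q) ⟩
    ∑ s + 1                              ∎)) sum≡
    where open ≡-Reasoning
  eP : s P ≡ suc (s′ P)
  eP = trans (sym (+-identityʳ (s P))) (trans (cong (s P +_) (sym (𝟙-no (P ≟ Q) P≢Q)))
    (trans (sym (s′+ P)) (trans (cong (s′ P +_) (𝟙-yes (P ≟ P) refl)) (+-comm (s′ P) 1))))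
  eQ : s′ Q ≡ suc (s Q)
  eQ = trans (sym (+-identityʳ (s′ Q))) (trans (cong (s′ Q +_) (sym (𝟙-no (Q ≟ P) (P≢Q ∘ sym))))
    (trans (s′+ Q) (trans (cong (s Q +_) (𝟙-yes (Q ≟ Q) refl)) (+-comm (s Q) 1))))
  eO : ∀ i → i ≢ P → i ≢ Q → s i ≡ s′ i
  eO i nP nQ = sym (trans (sym (+-identityʳ (s′ i))) (trans (cong (s′ i +_) (sym (𝟙-no (i ≟ P) nP)))
    (trans (s′+ i) (trans (cong (s i +_) (𝟙-no (i ≟ Q) nQ)) (+-identityʳ (s i))))))
  -- s Q + 1 ≤ t Q ≤ t P + 1 ≤ s P, where the middle step is the balance of `t`.
  le : s Q ≤ s′ P
  le = ≤-pred (≤-trans (≤-trans sQ<tQ (bal Q P)) (≤-trans tP<sP (≤-reflexive eP)))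
  d′ : ∑ (λ i → s′ i ∸ t i) ≡ d
  d′ = +-cancelʳ-≡ 1 _ d (begin
    ∑ (λ i → s′ i ∸ t i) + 1                       ≡⟨ cong (∑ (λ i → s′ i ∸ t i) +_) (∑𝟙 P) ⟨
    ∑ (λ i → s′ i ∸ t i) + ∑ (λ i → 𝟙 (i ≟ P))     ≡⟨ ∑-distrib-+ (λ i → s′ i ∸ t i) _ ⟨
    ∑ (λ i → s′ i ∸ t i + 𝟙 (i ≟ P))               ≡⟨ sum-cong-≗ pointwise ⟩
    ∑ (λ i → s i ∸ t i)                            ≡⟨ d≡ ⟩
    suc d                                          ≡⟨ +-comm 1 d ⟩
    d + 1                                          ∎)
    where
    open ≡-Reasoning
    at-P : s′ P ∸ t P + 1 ≡ s P ∸ t P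
    at-P = trans (+-comm _ 1) (trans (sym (+-∸-assoc 1 (≤-pred (≤-trans tP<sP (≤-reflexive eP))))) (cong (_∸ t P) (sym eP)))
    pointwise : ∀ i → s′ i ∸ t i + 𝟙 (i ≟ P) ≡ s i ∸ t i
    pointwise i = by-cases (i ≟ P) (i ≟ Q)
      where
      by-cases : Dec (i ≡ P) → Dec (i ≡ Q) → s′ i ∸ t i + 𝟙 (i ≟ P) ≡ s i ∸ t i
      by-cases (yes refl) _ = trans (cong (s′ P ∸ t P +_) (𝟙-yes (P ≟ P) refl)) at-P
      by-cases (no nP) (yes refl) = trans (cong (s′ Q ∸ t Q +_) (𝟙-no (Q ≟ P) nP))
        (trans (+-identityʳ _) (trans (cong (_∸ t Q) eQ) (trans (m≤n⇒m∸n≡0 sQ<tQ) (sym (m≤n⇒m∸n≡0 (<⇒≤ sQ<tQ))))))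
      by-cases (no nP) (no nQ) = trans (cong (s′ i ∸ t i +_) (𝟙-no (i ≟ P) nP))
        (trans (+-identityʳ _) (cong (_∸ t i) (sym (eO i nP nQ))))

-- Turán graphs and homomorphisms through a vertex

hom-reflect : ∀ {n n′ m} (G : Graph n) (G′ : Graph n′) (f : Fin n → Fin n′) →
  (∀ u v → Adj G′ (f u) (f v) → Adj G u v) → (bs : Vec Bool m) → ∀ x → hom G′ bs (map f x) ≤ hom G bs x
hom-reflect G G′ f ref []           x            = ≤-refl
hom-reflect G G′ f ref (true ∷ bs)  (x ∷ y ∷ xs) =
  *-mono-≤ (𝟙-mono (adj? G′ (f x) (f y)) (adj? G x y) (ref x y)) (hom-reflect G G′ f ref bs (y ∷ xs))
hom-reflect G G′ f ref (false ∷ bs) (x ∷ y ∷ xs) =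
  *-mono-≤ (≤-refl {1}) (hom-reflect G G′ f ref bs (y ∷ xs))

emb-mono : ∀ {n m} (G G′ : Graph n) → (∀ u v → Adj G u v → Adj G′ u v) → (bs : Vec Bool m) → emb G bs ≤ emb G′ bs
emb-mono {m = m} G G′ sub bs = ∑V-mono (suc m) λ x → *-monoʳ-≤ (distinct x)
  (subst (hom G bs x ≤_) (cong (hom G′ bs) (map-id x)) (hom-mono G G′ id sub bs x))

length-filter-tabulate : ∀ {B : Set} {n} {P : B → Set} (P? : ∀ b → Dec (P b)) (f : Fin n → B) →
  length (filter P? (tabulate f)) ≡ ∑ λ i → 𝟙 (P? (f i))
length-filter-tabulate {n = zero}  P? f = refl
length-filter-tabulate {n = suc n} P? f with P? (f zero)
... | yes _ = cong suc (length-filter-tabulate P? (f ∘ suc))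
... | no _  = length-filter-tabulate P? (f ∘ suc)

turánColour : ∀ n κ → Fin n → Fin (suc κ)
turánColour n κ v = fromℕ< (m%n<n (toℕ v) (suc κ))

turánColour-≡ : ∀ n κ {u v} → turánColour n κ u ≡ turánColour n κ v → toℕ u % suc κ ≡ toℕ v % suc κ
turánColour-≡ n κ {u} {v} e = trans (sym (toℕ-fromℕ< (m%n<n (toℕ u) (suc κ)))) (trans (cong toℕ e) (toℕ-fromℕ< (m%n<n (toℕ v) (suc κ))))

turánColour-≡⁻ : ∀ n κ {u v} → toℕ u % suc κ ≡ toℕ v % suc κ → turánColour n κ u ≡ turánColour n κ v
turánColour-≡⁻ n κ {u} {v} e = toℕ-injective (trans (toℕ-fromℕ< (m%n<n (toℕ u) (suc κ))) (trans e (sym (toℕ-fromℕ< (m%n<n (toℕ v) (suc κ))))))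

size-turán : ∀ n κ j → size (turánColour n κ) j ≡ partSize n κ j
size-turán n κ j = sym (trans (length-filter-tabulate {n = n} (λ v → toℕ v % suc κ ≟ℕ toℕ j) id)
  (sum-cong-≗ {n} λ v → 𝟙-cong (toℕ v % suc κ ≟ℕ toℕ j) (turánColour n κ v ≟ j)
    (λ e → toℕ-injective (trans (toℕ-fromℕ< (m%n<n (toℕ v) (suc κ))) e))
    (λ { refl → sym (toℕ-fromℕ< (m%n<n (toℕ v) (suc κ))) })))

partSize-upper : ∀ n κ r → suc κ * partSize n κ r ≤ n + κ
partSize-upper n κ r with turán-balanced n κ r
... | inj₁ e rewrite e = ≤-trans (≤-reflexive (*-comm (suc κ) (n / suc κ))) (≤-trans (m/n*n≤m n (suc κ)) (m≤m+n n κ))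
... | inj₂ e rewrite e = ≤-trans (≤-reflexive (*-comm (suc κ) ((n + κ) / suc κ))) (m/n*n≤m (n + κ) (suc κ))

n/[1+κ]≤partSize : ∀ n κ r → n / suc κ ≤ partSize n κ r
n/[1+κ]≤partSize n κ r with turán-balanced n κ r
... | inj₁ e rewrite e = ≤-refl
... | inj₂ e rewrite e = /-monoˡ-≤ (suc κ) (m≤m+n n κ)

partSize-balanced : ∀ n κ i j → partSize n κ i ≤ suc (partSize n κ j)
partSize-balanced n κ i j = ≤-trans (≤-pred (*-cancelˡ-< (suc κ) _ _ lt)) (s≤s (n/[1+κ]≤partSize n κ j))
  where
  q = n / suc κ
  lt : suc κ * partSize n κ i < suc κ * suc (suc q)
  lt = begin-strict
    suc κ * partSize n κ i                        ≤⟨ partSize-upper n κ i ⟩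
    n + κ                                         ≡⟨ cong (_+ κ) (m≡m%n+[m/n]*n n (suc κ)) ⟩
    n % suc κ + q * suc κ + κ                     ≤⟨ +-monoˡ-≤ κ (+-monoˡ-≤ (q * suc κ) (≤-pred (m%n<n n (suc κ)))) ⟩
    κ + q * suc κ + κ                             <⟨ s≤s (m≤m+n (κ + q * suc κ + κ) 1) ⟩
    suc (κ + q * suc κ + κ + 1)                   ≡⟨ arrange κ q ⟩
    suc κ * suc (suc q)                           ∎
    where
    open ≤-Reasoning
    arrange : ∀ κ q → suc (κ + q * suc κ + κ + 1) ≡ suc κ * suc (suc q)
    arrange = solve-∀

-- A proper colouring makes G a subgraph of the complete multipartite graph on its classes. For that
-- graph, as for the Turán graph, the count depends on the class sizes only.
emb-colourable : ∀ {n m} κ (G : Graph n) (bs : Vec Bool m) → Colorable G (suc κ) → emb G bs ≤ emb (turán n (suc κ)) bs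
emb-colourable {n} {m} κ G bs (col , proper) = begin
  emb G bs                                                    ≤⟨ ∑V-mono (suc m) (λ x → *-monoʳ-≤ (distinct x) (hom-mono G (complete (suc κ)) col proper bs x)) ⟩
  ∑V (suc m) (λ x → distinct x * hom (complete (suc κ)) bs (map col x))     ≡⟨ ∑V-by-colour col (suc m) (hom (complete (suc κ)) bs) ⟩
  embMulti (size col) bs                                      ≤⟨ embMulti-balanced bs (size T) balanced _ (size col) (trans (∑-size col) (sym (∑-size T))) refl ⟩
  embMulti (size T) bs                                        ≡⟨ ∑V-by-colour T (suc m) (hom (complete (suc κ)) bs) ⟨
  ∑V (suc m) (λ x → distinct x * hom (complete (suc κ)) bs (map T x))       ≤⟨ ∑V-mono (suc m) (λ x → *-monoʳ-≤ (distinct x) (hom-reflect (turán n (suc κ)) (complete (suc κ)) T (λ u v ne e → ne (turánColour-≡⁻ n κ {u} {v} e)) bs x)) ⟩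
  emb (turán n (suc κ)) bs                                    ∎
  where
  open ≤-Reasoning
  T = turánColour n κ
  balanced : ∀ i j → size T i ≤ suc (size T j)
  balanced i j = subst₂ (λ p q → p ≤ suc q) (sym (size-turán n κ i)) (sym (size-turán n κ j)) (partSize-balanced n κ i j)

deg : ∀ {n} → Graph n → Fin n → ℕ
deg G v = ∑ (A G v)

-- On n + 1 vertices, k times a class size is at most n + 1 + κ, and k(n+1) - (n+1+κ) = κn.
-- Measuring against n rather than n + 1 leaves no error term.
turán-deg : ∀ n κ v → κ * n ≤ suc κ * deg (turán (suc n) (suc κ)) v
turán-deg n κ v = +-cancelʳ-≤ (suc n + κ) _ _ (begin
  κ * n + (suc n + κ)                    ≡⟨ arrange κ n ⟩
  suc κ * suc n                          ≡⟨ cong (suc κ *_) total ⟨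
  suc κ * (deg T v + size col (col v))   ≡⟨ *-distribˡ-+ (suc κ) (deg T v) (size col (col v)) ⟩
  suc κ * deg T v + suc κ * size col (col v)  ≤⟨ +-monoʳ-≤ (suc κ * deg T v) (≤-trans (≤-reflexive (cong (suc κ *_) (size-turán (suc n) κ (col v)))) (partSize-upper (suc n) κ (col v))) ⟩
  suc κ * deg T v + (suc n + κ)          ∎)
  where
  open ≤-Reasoning
  T = turán (suc n) (suc κ)
  col = turánColour (suc n) κ
  arrange : ∀ κ n → κ * n + (suc n + κ) ≡ suc κ * suc n
  arrange = solve-∀
  one : ∀ u → A T v u + 𝟙 (col u ≟ col v) ≡ 1
  one u with toℕ v % suc κ ≟ℕ toℕ u % suc κ
  ... | yes e = 𝟙-yes (col u ≟ col v) (turánColour-≡⁻ (suc n) κ {u} {v} (sym e))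
  ... | no ne = cong suc (𝟙-no (col u ≟ col v) (λ e → ne (turánColour-≡ (suc n) κ {v} {u} (sym e))))
  total : deg T v + size col (col v) ≡ suc n
  total = trans (sym (∑-distrib-+ (A T v) (λ u → 𝟙 (col u ≟ col v)))) (trans (sum-cong-≗ one) (trans (∑-const (suc n) 1) (*-identityʳ (suc n))))

-- Deleting a vertex

deleteVertex : ∀ {n} → Graph (suc n) → Fin (suc n) → Graph n
deleteVertex G v = record
  { Adj    = λ x y → Adj G (punchIn v x) (punchIn v y)
  ; adj?   = λ x y → adj? G (punchIn v x) (punchIn v y)
  ; symm   = symm G
  ; irrefl = irrefl G
  }

through : ∀ {n m} → Graph n → Vec Bool m → Fin n → ℕ
through {m = m} G bs v = ∑V (suc m) λ x → distinct x * hom G bs x * occ v x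

∑V-punchIn : ∀ {n} m (v : Fin (suc n)) (f : Vec (Fin (suc n)) m → ℕ) →
  ∑V m (λ x → isZero (occ v x) * f x) ≡ ∑V m (λ y → f (map (punchIn v) y))
∑V-punchIn zero    v f = +-identityʳ _
∑V-punchIn (suc m) v f = begin
  ∑ (λ x → ∑V m λ xs → isZero (𝟙 (x ≟ v) + occ v xs) * f (x ∷ xs))
    ≡⟨ sum-remove {i = v} (λ x → ∑V m λ xs → isZero (𝟙 (x ≟ v) + occ v xs) * f (x ∷ xs)) ⟩
  ∑V m (λ xs → isZero (𝟙 (v ≟ v) + occ v xs) * f (v ∷ xs)) +
  ∑ (λ y → ∑V m λ xs → isZero (𝟙 (punchIn v y ≟ v) + occ v xs) * f (punchIn v y ∷ xs))
    ≡⟨ cong₂ _+_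
         (trans (∑V-cong m λ xs → cong (λ t → isZero (t + occ v xs) * f (v ∷ xs)) (𝟙-yes (v ≟ v) refl)) (trans (∑V-const m 0) (*-zeroʳ (suc _ ^ m))))
         (sum-cong-≗ λ y → trans (∑V-cong m λ xs → cong (λ t → isZero (t + occ v xs) * f (punchIn v y ∷ xs)) (𝟙-no (punchIn v y ≟ v) (punchInᵢ≢i v y)))
           (∑V-punchIn m v λ xs → f (punchIn v y ∷ xs))) ⟩
  ∑ (λ y → ∑V m λ ys → f (punchIn v y ∷ map (punchIn v) ys)) ∎
  where open ≡-Reasoning

occ-map : ∀ {n n′ m} (f : Fin n → Fin n′) → (∀ {i j} → f i ≡ f j → i ≡ j) → ∀ v (x : Vec (Fin n) m) → occ (f v) (map f x) ≡ occ v x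
occ-map f inj v []       = refl
occ-map f inj v (x ∷ xs) = cong₂ _+_ (𝟙-cong (f x ≟ f v) (x ≟ v) inj (cong f)) (occ-map f inj v xs)

distinct-map : ∀ {n n′ m} (f : Fin n → Fin n′) → (∀ {i j} → f i ≡ f j → i ≡ j) → (x : Vec (Fin n) m) → distinct (map f x) ≡ distinct x
distinct-map f inj []       = refl
distinct-map f inj (x ∷ xs) = cong₂ _*_ (cong isZero (occ-map f inj x xs)) (distinct-map f inj xs)

emb-deleteVertex : ∀ {n m} (G : Graph (suc n)) (bs : Vec Bool m) v → emb G bs ≡ emb (deleteVertex G v) bs + through G bs v
emb-deleteVertex {m = m} G bs v = begin
  emb G bs
    ≡⟨ ∑V-cong (suc m) (λ x → trans (cong (_* hom G bs x) (sym (distinct-occ v x))) (arrange (distinct x) (isZero (occ v x)) (occ v x) (hom G bs x))) ⟩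
  ∑V (suc m) (λ x → isZero (occ v x) * (distinct x * hom G bs x) + distinct x * hom G bs x * occ v x)
    ≡⟨ ∑V-+ (suc m) (λ x → isZero (occ v x) * (distinct x * hom G bs x)) (λ x → distinct x * hom G bs x * occ v x) ⟩
  ∑V (suc m) (λ x → isZero (occ v x) * (distinct x * hom G bs x)) + through G bs v
    ≡⟨ cong (_+ through G bs v) (trans (∑V-punchIn (suc m) v (λ x → distinct x * hom G bs x))
         (∑V-cong (suc m) λ y → cong₂ _*_ (distinct-map (punchIn v) (λ {i} {j} → punchIn-injective v i j) y)
           (≤-antisym (hom-reflect (deleteVertex G v) G (punchIn v) (λ _ _ a → a) bs y) (hom-mono (deleteVertex G v) G (punchIn v) (λ _ _ a → a) bs y)))) ⟩
  emb (deleteVertex G v) bs + through G bs v ∎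
  where
  open ≡-Reasoning
  arrange : ∀ d z o h → d * (z + o) * h ≡ z * (d * h) + d * h * o
  arrange = solve-∀

toℕ-punchIn-fromℕ : ∀ n (i : Fin n) → toℕ (punchIn (fromℕ n) i) ≡ toℕ i
toℕ-punchIn-fromℕ (suc n) zero    = refl
toℕ-punchIn-fromℕ (suc n) (suc i) = cong suc (toℕ-punchIn-fromℕ n i)

-- Deleting the last vertex leaves all other residues unchanged, so the Turán graphs are nested.
emb-turán-suc : ∀ {m} n κ (bs : Vec Bool m) →
  emb (turán (suc n) (suc κ)) bs ≡ emb (turán n (suc κ)) bs + through (turán (suc n) (suc κ)) bs (fromℕ n)
emb-turán-suc n κ bs = trans (emb-deleteVertex (turán (suc n) (suc κ)) bs (fromℕ n))
  (cong (_+ through (turán (suc n) (suc κ)) bs (fromℕ n)) (≤-antisym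
    (emb-mono D T (λ u v → subst₂ (λ p q → p % suc κ ≢ q % suc κ) (toℕ-punchIn-fromℕ n u) (toℕ-punchIn-fromℕ n v)) bs)
    (emb-mono T D (λ u v → subst₂ (λ p q → p % suc κ ≢ q % suc κ) (sym (toℕ-punchIn-fromℕ n u)) (sym (toℕ-punchIn-fromℕ n v))) bs)))
  where
  T = turán n (suc κ)
  D = deleteVertex (turán (suc n) (suc κ)) (fromℕ n)

-- The adjacency matrix for `true` and the all-ones matrix for `false`, applied to a vector. Both
-- are symmetric, which `split-sum` and `op-adjoint` rely on.
op : ∀ {n} → Graph n → Bool → (Fin n → ℕ) → Fin n → ℕ
op G b y v = ∑ λ u → link G b v u * y u

W : ∀ {n m} → Graph n → Vec Bool m → Fin n → ℕ
W G []       _ = 1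
W G (b ∷ bs)   = op G b (W G bs)

W-sum : ∀ {n m} (G : Graph n) (bs : Vec Bool m) v → ∑V m (λ xs → hom G bs (v ∷ xs)) ≡ W G bs v
W-sum G []       v = refl
W-sum {m = suc m} G (b ∷ bs) v = sum-cong-≗ λ u →
  trans (∑V-*ˡ m (link G b v u) λ us → hom G bs (u ∷ us)) (cong (link G b v u *_) (W-sum G bs u))

homThrough : ∀ {n m} → Graph n → Vec Bool m → Fin n → ℕ
homThrough {m = m} G bs z = ∑V (suc m) λ x → hom G bs x * occ z x

-- The homomorphisms through z, summed over the position of z; y weighs the part before the
-- current position.
split : ∀ {n m} → Graph n → Fin n → (Fin n → ℕ) → Vec Bool m → ℕ
split G z y []       = y z
split G z y (b ∷ bs) = y z * W G (b ∷ bs) z + split G z (op G b y) bs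

link-sym : ∀ {n} (G : Graph n) b u v → link G b u v ≡ link G b v u
link-sym G true  u v = A-sym G u v
link-sym G false u v = refl

-- Either z is the first vertex, or the symmetry of `link` lets the weight of the first vertex be
-- summed into a weight `op G b y` of the second. The induction therefore needs an arbitrary `y`.
split-sum : ∀ {n m} (G : Graph n) z y (bs : Vec Bool m) →
  ∑ (λ v → y v * ∑V m λ xs → hom G bs (v ∷ xs) * occ z (v ∷ xs)) ≡ split G z y bs
split-sum G z y [] = trans (sum-cong-≗ λ v → arrange (y v) (𝟙 (v ≟ z))) (∑-δ z y)
  where
  arrange : ∀ p q → p * (1 * (q + 0)) ≡ q * p
  arrange = solve-∀
split-sum {m = suc m} G z y (b ∷ bs) = begin
  ∑ (λ v → y v * ∑V (suc m) λ xs → hom G (b ∷ bs) (v ∷ xs) * occ z (v ∷ xs))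
    ≡⟨ sum-cong-≗ (λ v → trans (cong (y v *_) (inner v)) (distr (y v) (𝟙 (v ≟ z)) (W G (b ∷ bs) v) (∑ λ u → link G b v u * R u))) ⟩
  ∑ (λ v → 𝟙 (v ≟ z) * (y v * W G (b ∷ bs) v) + y v * ∑ λ u → link G b v u * R u)
    ≡⟨ ∑-distrib-+ (λ v → 𝟙 (v ≟ z) * (y v * W G (b ∷ bs) v)) _ ⟩
  ∑ (λ v → 𝟙 (v ≟ z) * (y v * W G (b ∷ bs) v)) + ∑ (λ v → y v * ∑ λ u → link G b v u * R u)
    ≡⟨ cong₂ _+_ (∑-δ z λ v → y v * W G (b ∷ bs) v) swapped ⟩
  y z * W G (b ∷ bs) z + ∑ (λ u → op G b y u * R u)
    ≡⟨ cong (y z * W G (b ∷ bs) z +_) (split-sum G z (op G b y) bs) ⟩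
  split G z y (b ∷ bs) ∎
  where
  open ≡-Reasoning
  R : Fin _ → ℕ
  R u = ∑V m λ us → hom G bs (u ∷ us) * occ z (u ∷ us)
  distr : ∀ p q r s → p * (q * r + s) ≡ q * (p * r) + p * s
  distr = solve-∀
  expand : ∀ l h q o → l * h * (q + o) ≡ q * (l * h) + l * (h * o)
  expand = solve-∀
  inner : ∀ v → ∑V (suc m) (λ xs → hom G (b ∷ bs) (v ∷ xs) * occ z (v ∷ xs)) ≡ 𝟙 (v ≟ z) * W G (b ∷ bs) v + ∑ λ u → link G b v u * R u
  inner v = begin
    ∑ (λ u → ∑V m λ us → link G b v u * hom G bs (u ∷ us) * (𝟙 (v ≟ z) + occ z (u ∷ us)))
      ≡⟨ sum-cong-≗ (λ u → trans (∑V-cong m λ us → expand (link G b v u) (hom G bs (u ∷ us)) (𝟙 (v ≟ z)) (occ z (u ∷ us)))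
           (trans (∑V-+ m (λ us → 𝟙 (v ≟ z) * (link G b v u * hom G bs (u ∷ us))) _)
             (cong₂ _+_ (∑V-*ˡ m (𝟙 (v ≟ z)) (λ us → link G b v u * hom G bs (u ∷ us))) (∑V-*ˡ m (link G b v u) λ us → hom G bs (u ∷ us) * occ z (u ∷ us))))) ⟩
    ∑ (λ u → 𝟙 (v ≟ z) * ∑V m (λ us → link G b v u * hom G bs (u ∷ us)) + link G b v u * R u)
      ≡⟨ ∑-distrib-+ (λ u → 𝟙 (v ≟ z) * ∑V m (λ us → link G b v u * hom G bs (u ∷ us))) _ ⟩
    ∑ (λ u → 𝟙 (v ≟ z) * ∑V m (λ us → link G b v u * hom G bs (u ∷ us))) + ∑ (λ u → link G b v u * R u)
      ≡⟨ cong (_+ ∑ (λ u → link G b v u * R u)) (trans (sym (*-distribˡ-sum (𝟙 (v ≟ z)) λ u → ∑V m (λ us → link G b v u * hom G bs (u ∷ us)))) (cong (𝟙 (v ≟ z) *_) (W-sum G (b ∷ bs) v))) ⟩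
    𝟙 (v ≟ z) * W G (b ∷ bs) v + ∑ (λ u → link G b v u * R u) ∎
  swapped : ∑ (λ v → y v * ∑ λ u → link G b v u * R u) ≡ ∑ (λ u → op G b y u * R u)
  swapped = begin
    ∑ (λ v → y v * ∑ λ u → link G b v u * R u)      ≡⟨ sum-cong-≗ (λ v → *-distribˡ-sum (y v) λ u → link G b v u * R u) ⟩
    ∑ (λ v → ∑ λ u → y v * (link G b v u * R u))    ≡⟨ ∑-comm (λ v u → y v * (link G b v u * R u)) ⟩
    ∑ (λ u → ∑ λ v → y v * (link G b v u * R u))    ≡⟨ sum-cong-≗ (λ u → trans (sum-cong-≗ λ v → trans (x∙yz≈yx∙z (y v) (link G b v u) (R u)) (cong (λ t → t * y v * R u) (link-sym G b v u))) (sym (*-distribʳ-sum (R u) λ v → link G b u v * y v))) ⟩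
    ∑ (λ u → op G b y u * R u)                      ∎

homThrough-split : ∀ {n m} (G : Graph n) (bs : Vec Bool m) z → homThrough G bs z ≡ split G z (λ _ → 1) bs
homThrough-split {n} {m} G bs z = trans (sum-cong-≗ {n} λ v → sym (*-identityˡ (∑V m λ xs → hom G bs (v ∷ xs) * occ z (v ∷ xs)))) (split-sum G z (λ _ → 1) bs)

through≤homThrough : ∀ {n m} (G : Graph n) (bs : Vec Bool m) z → through G bs z ≤ homThrough G bs z
through≤homThrough {m = m} G bs z = ∑V-mono (suc m) λ x → *-monoˡ-≤ (occ z x)
  (≤-trans (*-monoˡ-≤ (hom G bs x) (distinct≤1 x)) (≤-reflexive (*-identityˡ _)))

∑-occ-all : ∀ {n m} (x : Vec (Fin n) m) → ∑ (λ v → occ v x) ≡ m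
∑-occ-all {n} []   = ∑-≡0 {n} {λ _ → 0} λ _ → refl
∑-occ-all (x ∷ xs) = trans (∑-distrib-+ (λ v → 𝟙 (x ≟ v)) _) (cong₂ _+_
  (trans (sum-cong-≗ λ v → trans (𝟙-cong (x ≟ v) (v ≟ x) sym sym) (sym (*-identityʳ _))) (∑-δ x λ _ → 1)) (∑-occ-all xs))

∑-homThrough : ∀ {n m} (G : Graph n) (bs : Vec Bool m) → ∑ (homThrough G bs) ≡ suc m * ∑ (W G bs)
∑-homThrough {n} {m} G bs = begin
  ∑ (λ z → ∑V (suc m) λ x → hom G bs x * occ z x)       ≡⟨ ∑V-∑ (suc m) (λ x z → hom G bs x * occ z x) ⟨
  ∑V (suc m) (λ x → ∑ λ z → hom G bs x * occ z x)       ≡⟨ ∑V-cong (suc m) (λ x → trans (sym (*-distribˡ-sum (hom G bs x) λ z → occ z x)) (trans (cong (hom G bs x *_) (∑-occ-all x)) (*-comm (hom G bs x) (suc m)))) ⟩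
  ∑V (suc m) (λ x → suc m * hom G bs x)                 ≡⟨ ∑V-*ˡ (suc m) (suc m) (hom G bs) ⟩
  suc m * ∑V (suc m) (hom G bs)                         ≡⟨ cong (suc m *_) (sum-cong-≗ (W-sum G bs)) ⟩
  suc m * ∑ (W G bs)                                    ∎
  where open ≡-Reasoning

-- Sequences that are not injective

collisions : ∀ {n m} → Vec (Fin n) m → ℕ
collisions []       = 0
collisions (x ∷ xs) = occ x xs + collisions xs

-- A sequence that is not injective has a coinciding pair, so passing from homomorphisms to
-- embeddings costs at most the number of such pairs.
1≤distinct+collisions : ∀ {n m} (x : Vec (Fin n) m) → 1 ≤ distinct x + collisions x
1≤distinct+collisions []       = ≤-refl
1≤distinct+collisions (x ∷ xs) with occ x xs
... | zero  = ≤-trans (1≤distinct+collisions xs) (+-monoˡ-≤ _ (m≤m+n (distinct xs) 0))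
... | suc _ = s≤s z≤n

∑V-occ : ∀ {n} m (z : Fin n) → n * ∑V m (occ z) ≤ m * n ^ m
∑V-occ {n} zero    z = ≤-reflexive (*-zeroʳ n)
∑V-occ {n} (suc m) z = begin
  n * ∑ (λ x → ∑V m λ xs → 𝟙 (x ≟ z) + occ z xs)
    ≡⟨ cong (n *_) (trans (sum-cong-≗ λ x → ∑V-+ m (λ _ → 𝟙 (x ≟ z)) (occ z)) (∑-distrib-+ (λ x → ∑V m λ _ → 𝟙 (x ≟ z)) _)) ⟩
  n * (∑ (λ x → ∑V m λ _ → 𝟙 (x ≟ z)) + ∑ {n} (λ _ → ∑V m (occ z)))
    ≡⟨ cong (n *_) (cong₂ _+_ (trans (sum-cong-≗ λ x → trans (∑V-const m (𝟙 (x ≟ z))) (*-comm (n ^ m) (𝟙 (x ≟ z)))) (∑-δ z λ _ → n ^ m)) (∑-const n _)) ⟩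
  n * (n ^ m + n * ∑V m (occ z))   ≤⟨ *-monoʳ-≤ n (+-monoʳ-≤ (n ^ m) (∑V-occ m z)) ⟩
  n * (n ^ m + m * n ^ m)          ≡⟨ arrange n m (n ^ m) ⟩
  suc m * (n * n ^ m)              ∎
  where
  open ≤-Reasoning
  arrange : ∀ n m p → n * (p + m * p) ≡ suc m * (n * p)
  arrange = solve-∀

∑V-collisions : ∀ {n} m → n * ∑V {n} m collisions ≤ m * m * n ^ m
∑V-collisions {n} zero    = ≤-reflexive (*-zeroʳ n)
∑V-collisions {n} (suc m) = begin
  n * ∑ {n} (λ x → ∑V m λ xs → occ x xs + collisions xs)
    ≡⟨ cong (n *_) (trans (sum-cong-≗ {n} λ x → ∑V-+ m (occ x) collisions) (∑-distrib-+ {n} (λ x → ∑V m (occ x)) (λ _ → ∑V m collisions))) ⟩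
  n * (∑ {n} (λ x → ∑V m (occ x)) + ∑ {n} (λ _ → ∑V m collisions))
    ≡⟨ cong (n *_) (cong₂ _+_ (trans (sym (∑V-∑ m λ xs x → occ x xs)) (trans (∑V-cong m ∑-occ-all) (∑V-const m m))) (∑-const n _)) ⟩
  n * (n ^ m * m + n * ∑V m collisions)  ≤⟨ *-monoʳ-≤ n (+-monoʳ-≤ (n ^ m * m) (∑V-collisions m)) ⟩
  n * (n ^ m * m + m * m * n ^ m)        ≤⟨ m≤m+n _ (suc m * (n * n ^ m)) ⟩
  n * (n ^ m * m + m * m * n ^ m) + suc m * (n * n ^ m)  ≡⟨ arrange n m (n ^ m) ⟩
  suc m * suc m * (n * n ^ m)            ∎
  where
  open ≤-Reasoning
  arrange : ∀ n m p → n * (p * m + m * m * p) + suc m * (n * p) ≡ suc m * suc m * (n * p)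
  arrange = solve-∀

-- Passing through z fixes one vertex and a collision fixes another, so the sum is of order nᵐ⁻²;
-- the two losses appear as factors n on the left. The cubic constant is crude.
∑V-collisions-occ : ∀ {n} m (z : Fin n) → n * (n * ∑V m (λ x → collisions x * occ z x)) ≤ m * m * m * n ^ m
∑V-collisions-occ {n} zero    z = ≤-reflexive (trans (cong (n *_) (*-zeroʳ n)) (*-zeroʳ n))
∑V-collisions-occ {n} (suc m) z = begin
  n * (n * ∑ (λ x → ∑V m λ xs → (occ x xs + collisions xs) * (𝟙 (x ≟ z) + occ z xs)))
    ≡⟨ cong (λ t → n * (n * t)) (trans (sym (∑V-∑ m λ xs x → (occ x xs + collisions xs) * (𝟙 (x ≟ z) + occ z xs))) (∑V-cong m inner)) ⟩
  n * (n * ∑V m (λ xs → suc m * occ z xs + collisions xs + n * (collisions xs * occ z xs)))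
    ≡⟨ cong (λ t → n * (n * t)) (trans (∑V-+ m (λ xs → suc m * occ z xs + collisions xs) _)
         (cong₂ _+_ (trans (∑V-+ m (λ xs → suc m * occ z xs) _) (cong (_+ ∑V m collisions) (∑V-*ˡ m (suc m) (occ z)))) (∑V-*ˡ m n λ xs → collisions xs * occ z xs))) ⟩
  n * (n * (suc m * O + C + n * B))                          ≡⟨ distr n (suc m) O C B ⟩
  n * (suc m * (n * O) + n * C + n * (n * B))                ≤⟨ *-monoʳ-≤ n (+-mono-≤ (+-mono-≤ (*-monoʳ-≤ (suc m) (∑V-occ m z)) (∑V-collisions m)) (∑V-collisions-occ m z)) ⟩
  n * (suc m * (m * n ^ m) + m * m * n ^ m + m * m * m * n ^ m)  ≤⟨ m≤m+n _ (suc (m * m + 2 * m) * (n * n ^ m)) ⟩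
  n * (suc m * (m * n ^ m) + m * m * n ^ m + m * m * m * n ^ m) + suc (m * m + 2 * m) * (n * n ^ m)  ≡⟨ arrange n m (n ^ m) ⟩
  suc m * suc m * suc m * (n * n ^ m)                        ∎
  where
  open ≤-Reasoning
  O = ∑V m (occ z)
  C = ∑V {n} m collisions
  B = ∑V m (λ xs → collisions xs * occ z xs)
  distr : ∀ n s o c b → n * (n * (s * o + c + n * b)) ≡ n * (s * (n * o) + n * c + n * (n * b))
  distr = solve-∀
  arrange : ∀ n m p → n * (suc m * (m * p) + m * m * p + m * m * m * p) + suc (m * m + 2 * m) * (n * p) ≡ suc m * suc m * suc m * (n * p)
  arrange = solve-∀
  pieces : ∀ a c i o → (a + c) * (i + o) ≡ (i * (a + c) + o * a) + c * o
  pieces = solve-∀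
  collect : ∀ o c m n → (o + c + o * m) + n * (c * o) ≡ suc m * o + c + n * (c * o)
  collect = solve-∀
  inner : ∀ xs → ∑ (λ x → (occ x xs + collisions xs) * (𝟙 (x ≟ z) + occ z xs)) ≡ suc m * occ z xs + collisions xs + n * (collisions xs * occ z xs)
  inner xs = trans (sum-cong-≗ λ x → pieces (occ x xs) (collisions xs) (𝟙 (x ≟ z)) (occ z xs))
    (trans (∑-distrib-+ (λ x → 𝟙 (x ≟ z) * (occ x xs + collisions xs) + occ z xs * occ x xs) _)
    (trans (cong₂ _+_ (trans (∑-distrib-+ (λ x → 𝟙 (x ≟ z) * (occ x xs + collisions xs)) _)
        (cong₂ _+_ (∑-δ z λ x → occ x xs + collisions xs) (trans (sym (*-distribˡ-sum (occ z xs) λ x → occ x xs)) (cong (occ z xs *_) (∑-occ-all xs))))) (∑-const n _))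
      (collect (occ z xs) (collisions xs) m n)))

homThrough≤ : ∀ {n m} (G : Graph n) (bs : Vec Bool m) z →
  homThrough G bs z ≤ through G bs z + ∑V (suc m) (λ x → collisions x * occ z x)
homThrough≤ {m = m} G bs z = ≤-trans
  (∑V-mono (suc m) λ x → bound x)
  (≤-reflexive (∑V-+ (suc m) (λ x → distinct x * hom G bs x * occ z x) (λ x → collisions x * occ z x)))
  where
  open ≤-Reasoning
  distr : ∀ d c h o → (d + c) * (h * o) ≡ d * h * o + h * (c * o)
  distr = solve-∀
  bound : ∀ x → hom G bs x * occ z x ≤ distinct x * hom G bs x * occ z x + collisions x * occ z x
  bound x = begin
    hom G bs x * occ z x                               ≡⟨ *-identityˡ _ ⟨
    1 * (hom G bs x * occ z x)                         ≤⟨ *-monoˡ-≤ (hom G bs x * occ z x) (1≤distinct+collisions x) ⟩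
    (distinct x + collisions x) * (hom G bs x * occ z x)   ≡⟨ distr (distinct x) (collisions x) (hom G bs x) (occ z x) ⟩
    distinct x * hom G bs x * occ z x + hom G bs x * (collisions x * occ z x)
      ≤⟨ +-monoʳ-≤ _ (≤-trans (*-monoˡ-≤ _ (hom≤1 G bs x)) (≤-reflexive (*-identityˡ _))) ⟩
    distinct x * hom G bs x * occ z x + collisions x * occ z x ∎

edgeCount : ∀ {m} → Vec Bool m → ℕ
edgeCount []           = 0
edgeCount (true ∷ bs)  = suc (edgeCount bs)
edgeCount (false ∷ bs) = edgeCount bs

module LowerBound {n : ℕ} (G : Graph (suc n)) (κ : ℕ) (minDeg : ∀ v → κ * n ≤ suc κ * deg G v) where

  op-true-lower : ∀ e m y → (∀ v → κ ^ e * n ^ m ≤ suc κ ^ e * y v) → ∀ v → κ ^ suc e * n ^ suc m ≤ suc κ ^ suc e * op G true y v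
  op-true-lower e m y le v = begin
    κ * κ ^ e * (n * n ^ m)                            ≡⟨ interchange κ (κ ^ e) n (n ^ m) ⟩
    κ * n * (κ ^ e * n ^ m)                            ≤⟨ *-monoˡ-≤ (κ ^ e * n ^ m) (minDeg v) ⟩
    suc κ * deg G v * (κ ^ e * n ^ m)                  ≡⟨ *-assoc (suc κ) (deg G v) _ ⟩
    suc κ * (deg G v * (κ ^ e * n ^ m))                ≡⟨ cong (suc κ *_) (*-distribʳ-sum (κ ^ e * n ^ m) (A G v)) ⟩
    suc κ * ∑ (λ u → A G v u * (κ ^ e * n ^ m))        ≤⟨ *-monoʳ-≤ (suc κ) (∑-mono λ u → *-monoʳ-≤ (A G v u) (le u)) ⟩
    suc κ * ∑ (λ u → A G v u * (suc κ ^ e * y u))      ≡⟨ cong (suc κ *_) (trans (sum-cong-≗ λ u → x∙yz≈y∙xz (A G v u) (suc κ ^ e) (y u)) (sym (*-distribˡ-sum (suc κ ^ e) λ u → A G v u * y u))) ⟩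
    suc κ * (suc κ ^ e * op G true y v)                ≡⟨ *-assoc (suc κ) (suc κ ^ e) _ ⟨
    suc κ * suc κ ^ e * op G true y v                  ∎
    where
    open ≤-Reasoning

  op-false-lower : ∀ e m y → (∀ v → κ ^ e * n ^ m ≤ suc κ ^ e * y v) → ∀ v → κ ^ e * n ^ suc m ≤ suc κ ^ e * op G false y v
  op-false-lower e m y le v = begin
    κ ^ e * (n * n ^ m)                   ≤⟨ *-monoʳ-≤ (κ ^ e) (*-monoˡ-≤ (n ^ m) (n≤1+n n)) ⟩
    κ ^ e * (suc n * n ^ m)               ≡⟨ x∙yz≈y∙xz (κ ^ e) (suc n) (n ^ m) ⟩
    suc n * (κ ^ e * n ^ m)               ≡⟨ ∑-const (suc n) (κ ^ e * n ^ m) ⟨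
    ∑ {suc n} (λ u → κ ^ e * n ^ m)       ≤⟨ ∑-mono (λ u → ≤-trans (le u) (≤-reflexive (cong (suc κ ^ e *_) (sym (*-identityˡ (y u)))))) ⟩
    ∑ (λ u → suc κ ^ e * (1 * y u))       ≡⟨ *-distribˡ-sum (suc κ ^ e) (λ u → 1 * y u) ⟨
    suc κ ^ e * op G false y v            ∎
    where
    open ≤-Reasoning

  W-lower : ∀ {m} (bs : Vec Bool m) v → κ ^ edgeCount bs * n ^ m ≤ suc κ ^ edgeCount bs * W G bs v
  W-lower []           v = ≤-refl
  W-lower {suc m} (true ∷ bs)  v = op-true-lower (edgeCount bs) m (W G bs) (W-lower bs) v
  W-lower {suc m} (false ∷ bs) v = op-false-lower (edgeCount bs) m (W G bs) (W-lower bs) v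

  product-lower : ∀ {e m e′ m′ p q} → κ ^ e * n ^ m ≤ suc κ ^ e * p → κ ^ e′ * n ^ m′ ≤ suc κ ^ e′ * q →
    κ ^ (e + e′) * n ^ (m + m′) ≤ suc κ ^ (e + e′) * (p * q)
  product-lower {e} {m} {e′} {m′} {p} {q} h h′ rewrite ^-distribˡ-+-* κ e e′ | ^-distribˡ-+-* n m m′ | ^-distribˡ-+-* (suc κ) e e′ =
    subst₂ _≤_ (interchange (κ ^ e) (n ^ m) (κ ^ e′) (n ^ m′)) (interchange (suc κ ^ e) p (suc κ ^ e′) q) (*-mono-≤ h h′)

  -- `e` and `p` count the edges and the flags already absorbed into the weight `y`. Each of the m +
  -- 1 positions of z gives one term, and all of them obey the same lower bound; a missing edge
  -- offers n + 1 choices, of which n are claimed.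
  split-lower : ∀ {m} e p y (bs : Vec Bool m) z → (∀ v → κ ^ e * n ^ p ≤ suc κ ^ e * y v) →
    suc m * (κ ^ (e + edgeCount bs) * n ^ (p + m)) ≤ suc κ ^ (e + edgeCount bs) * split G z y bs
  split-lower e p y [] z le rewrite +-identityʳ e | +-identityʳ p | +-identityʳ (κ ^ e * n ^ p) = le z
  split-lower {suc m} e p y (b ∷ bs) z le = ≤-trans
    (+-mono-≤ (product-lower {e} {p} {edgeCount (b ∷ bs)} {suc m} (le z) (W-lower (b ∷ bs) z)) (tail b))
    (≤-reflexive (sym (*-distribˡ-+ (suc κ ^ (e + edgeCount (b ∷ bs))) (y z * W G (b ∷ bs) z) _)))
    where
    tail : ∀ b → suc m * (κ ^ (e + edgeCount (b ∷ bs)) * n ^ (p + suc m)) ≤ suc κ ^ (e + edgeCount (b ∷ bs)) * split G z (op G b y) bs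
    tail true  rewrite +-suc e (edgeCount bs) | +-suc p m = split-lower (suc e) (suc p) (op G true y) bs z (op-true-lower e p y le)
    tail false rewrite +-suc p m = split-lower e (suc p) (op G false y) bs z (op-false-lower e p y le)

  homThrough-lower : ∀ {m} (bs : Vec Bool m) z → suc m * (κ ^ edgeCount bs * n ^ m) ≤ suc κ ^ edgeCount bs * homThrough G bs z
  homThrough-lower bs z rewrite homThrough-split G bs z = split-lower 0 0 (λ _ → 1) bs z (λ _ → ≤-refl)

-- Complete multipartite subgraphs of dense graphs

bit : Bool → ℕ
bit true  = 1
bit false = 0

card : ∀ {n} → (Fin n → Bool) → ℕ
card U = ∑ λ v → bit (U v)

pick : ∀ {n} t (U : Fin n → Bool) → t ≤ card U →
  Σ[ f ∈ (Fin t → Fin n) ] (∀ {x y} → f x ≡ f y → x ≡ y) × (∀ x → U (f x) ≡ true)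
pick zero U _ = (λ ()) , (λ {x} → λ { }) , λ ()
pick {zero} (suc t) U ()
pick {suc n} (suc t) U le with U zero in eq
... | true = f , inj , mem
  where
  rec = pick t (U ∘ suc) (≤-pred le)
  f : Fin (suc t) → Fin (suc n)
  f zero    = zero
  f (suc x) = suc (proj₁ rec x)
  inj : ∀ {x y} → f x ≡ f y → x ≡ y
  inj {zero}  {zero}  _ = refl
  inj {suc x} {suc y} e = cong suc (proj₁ (proj₂ rec) (suc-injective e))
  mem : ∀ x → U (f x) ≡ true
  mem zero    = eq
  mem (suc x) = proj₂ (proj₂ rec) x
... | false = let f , inj , mem = pick (suc t) (U ∘ suc) le in suc ∘ f , (λ e → inj (suc-injective e)) , mem

-- Pigeonhole, one Boolean test at a time: of the two halves into which a test divides the current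
-- set, one is still large enough for the remaining tests.
homogeneous : ∀ {n} m (q : Fin m → Fin n → Bool) (U : Fin n → Bool) t → t * 2 ^ m ≤ card U →
  Σ[ V ∈ (Fin n → Bool) ] t ≤ card V × (∀ v → V v ≡ true → U v ≡ true) ×
  (∀ i v w → V v ≡ true → V w ≡ true → q i v ≡ q i w)
homogeneous zero    q U t le = U , subst (_≤ card U) (*-identityʳ t) le , (λ _ e → e) , λ ()
homogeneous {n} (suc m) q U t le = choose (t * 2 ^ m ≤? card yesU)
  where
  yesU noU : Fin n → Bool
  yesU v = U v ∧ q zero v
  noU v  = U v ∧ not (q zero v)
  Result : Set
  Result = Σ[ V ∈ (Fin n → Bool) ] t ≤ card V × (∀ v → V v ≡ true → U v ≡ true) ×
    (∀ i v w → V v ≡ true → V w ≡ true → q i v ≡ q i w)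
  ∧-fst : ∀ a b → a ∧ b ≡ true → a ≡ true
  ∧-fst true _ _ = refl
  ∧-snd : ∀ a b → a ∧ b ≡ true → b ≡ true
  ∧-snd true _ e = e
  not-snd : ∀ a b → a ∧ not b ≡ true → b ≡ false
  not-snd true false _ = refl
  cards : card U ≡ card yesU + card noU
  cards = trans (sum-cong-≗ λ v → bits (U v) (q zero v)) (∑-distrib-+ (bit ∘ yesU) (bit ∘ noU))
    where
    bits : ∀ a b → bit a ≡ bit (a ∧ b) + bit (a ∧ not b)
    bits true  true  = refl
    bits true  false = refl
    bits false _     = refl
  extend : (U′ : Fin n → Bool) → (∀ v → U′ v ≡ true → U v ≡ true) →
    (∀ v w → U′ v ≡ true → U′ w ≡ true → q zero v ≡ q zero w) → t * 2 ^ m ≤ card U′ → Result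
  extend U′ sub const le′ = let V , big , V⊆U′ , hom = homogeneous m (q ∘ suc) U′ t le′ in
    V , big , (λ v e → sub v (V⊆U′ v e)) ,
    λ { zero v w ev ew → const v w (V⊆U′ v ev) (V⊆U′ w ew) ; (suc i) v w ev ew → hom i v w ev ew }
  double : ∀ t p → t * (2 * p) ≡ t * p + t * p
  double = solve-∀
  choose : Dec (t * 2 ^ m ≤ card yesU) → Result
  choose (yes big) = extend yesU (λ v → ∧-fst (U v) (q zero v))
    (λ v w ev ew → trans (∧-snd (U v) _ ev) (sym (∧-snd (U w) _ ew))) big
  choose (no small) = extend noU (λ v → ∧-fst (U v) (not (q zero v)))
    (λ v w ev ew → trans (not-snd (U v) _ ev) (sym (not-snd (U w) _ ew)))
    (+-cancelˡ-≤ (t * 2 ^ m) _ _ (≤-trans (≤-reflexive (sym (double t (2 ^ m)))) (≤-trans le (≤-trans (≤-reflexive cards) (+-monoˡ-≤ (card noU) (<⇒≤ (≰⇒> small)))))))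

-- Vertices of different parts differ because they are adjacent, so injectivity is required within
-- parts only. `S` will record positive weight, since the degree condition of `Dense` speaks only
-- about such vertices.
record Blowup {n} (G : Graph n) (S : Fin n → Set) (j t : ℕ) : Set where
  field
    part      : Fin j → Fin t → Fin n
    injective : ∀ i {x y} → part i x ≡ part i y → x ≡ y
    joined    : ∀ {i i′} → i ≢ i′ → ∀ x y → Adj G (part i x) (part i′ y)
    inside    : ∀ i x → S (part i x)

open Blowup public

wdeg : ∀ {n} → Graph n → (Fin n → ℕ) → Fin n → ℕ
wdeg G x v = ∑ λ u → A G v u * x u

-- Every vertex of positive weight sees more than a proportion (K - 1) / K of the total weight,
-- with a margin of n M / L.
record Dense {n} (G : Graph n) (x : Fin n → ℕ) (K L M : ℕ) : Set where
  field
    bounded  : ∀ v → x v ≤ M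
    positive : 0 < ∑ x
    degrees  : ∀ v → 0 < x v → L * (K * ∑ x) + n * M ≤ L * (K * wdeg G x v + ∑ x)

open Dense public

wdeg≤ : ∀ {n} (G : Graph n) x v → wdeg G x v ≤ ∑ x
wdeg≤ G x v = ∑-mono λ u → ≤-trans (*-monoˡ-≤ (x u) (𝟙≤1 (adj? G v u))) (≤-reflexive (*-identityˡ _))

does-true : {P : Set} (d : Dec P) → does d ≡ true → P
does-true (yes p) _ = p

∑-bit≤ : ∀ {n} M (x : Fin n → ℕ) → (∀ v → x v ≤ M) → (P? : ∀ v → Dec (0 < x v)) → ∑ x ≤ M * card (does ∘ P?)
∑-bit≤ M x le P? = ≤-trans (∑-mono one) (≤-reflexive (sym (*-distribˡ-sum M (bit ∘ does ∘ P?))))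
  where
  one : ∀ v → x v ≤ M * bit (does (P? v))
  one v with P? v
  ... | yes _ = ≤-trans (le v) (≤-reflexive (sym (*-identityʳ M)))
  ... | no np = ≤-trans (≮⇒≥ np) z≤n

-- A weighted degree is at most the total weight, so the margin forces nM ≤ L∑x, and ∑x is at most M
-- times the size of the support. The support thus has at least n / L vertices.
dense-start : ∀ {n} {G : Graph n} {x K L M} → 1 ≤ L → Dense G x K L M → ∀ t → L * t ≤ n → Blowup G (λ v → 0 < x v) 1 t
dense-start {n} {G} {x} {K} {L} {M} 1≤L D t Lt≤n = record
  { part      = λ _ → f
  ; injective = λ _ → inj
  ; joined    = λ { {zero} {zero} ne → ⊥-elim (ne refl) }
  ; inside    = λ _ y → does-true (P? (f y)) (mem y)
  }
  where
  open ≤-Reasoning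
  P? : ∀ v → Dec (0 < x v)
  P? v = 0 <? x v
  v₀ = ∑-pos x (positive D)
  0<M : 0 < M
  0<M = ≤-trans (proj₂ v₀) (bounded D (proj₁ v₀))
  step : n * M ≤ L * (M * card (does ∘ P?))
  step = +-cancelˡ-≤ (L * (K * ∑ x)) _ _ (begin
    L * (K * ∑ x) + n * M                        ≤⟨ degrees D (proj₁ v₀) (proj₂ v₀) ⟩
    L * (K * wdeg G x (proj₁ v₀) + ∑ x)          ≤⟨ *-monoʳ-≤ L (+-mono-≤ (*-monoʳ-≤ K (wdeg≤ G x (proj₁ v₀))) (∑-bit≤ M x (bounded D) P?)) ⟩
    L * (K * ∑ x + M * card (does ∘ P?))         ≡⟨ *-distribˡ-+ L (K * ∑ x) _ ⟩
    L * (K * ∑ x) + L * (M * card (does ∘ P?))  ∎)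
  t≤card : t ≤ card (does ∘ P?)
  t≤card = *-cancelˡ-≤ L {{>-nonZero 1≤L}} (≤-trans Lt≤n (*-cancelˡ-≤ M {{>-nonZero 0<M}}
    (≤-trans (≤-reflexive (*-comm M n)) (≤-trans step (≤-reflexive (x∙yz≈y∙xz L M (card (does ∘ P?))))))))
  picked = pick t (does ∘ P?) t≤card
  f = proj₁ picked
  inj : ∀ {x y} → f x ≡ f y → x ≡ y
  inj = proj₁ (proj₂ picked)
  mem = proj₂ (proj₂ picked)

∑-one-small : ∀ {j} (c : Fin j → ℕ) T t i → (∀ i → c i ≤ T) → c i ≤ t → ∑ c + T ≤ j * T + t
∑-one-small {suc j} c T t i le small = begin
  ∑ c + T                             ≡⟨ cong (_+ T) (sum-remove {i = i} c) ⟩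
  c i + ∑ (λ i′ → c (punchIn i i′)) + T    ≤⟨ +-monoˡ-≤ T (+-mono-≤ small (∑-bound {j} T λ i′ → le (punchIn i i′))) ⟩
  t + j * T + T                       ≡⟨ arrange t (j * T) T ⟩
  suc j * T + t                       ∎
  where
  open ≤-Reasoning
  arrange : ∀ a b c → a + b + c ≡ c + b + a
  arrange = solve-∀

-- The Erdős-Stone step. `C` counts weighted edges into the given parts: `lower` uses the degrees,
-- and `upper` uses that a vertex with fewer than t neighbours in some part loses nearly a whole
-- part. Hence at least n / (2LK) vertices have t neighbours in every part, and `homogeneous` finds
-- t of them with identical neighbourhoods in the parts.
dense-step : ∀ {n} {G : Graph n} {x K L M} → 1 ≤ L → 1 ≤ K → Dense G x K L M → ∀ j t → 1 ≤ t → 1 ≤ j → j ≤ K →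
  2 * (L * K) * (t * 2 ^ (j * (2 * (L * K * t)))) ≤ n →
  Blowup G (λ v → 0 < x v) j (2 * (L * K * t)) → Blowup G (λ v → 0 < x v) (suc j) t
dense-step {n} {G} {x} {K} {L} {M} 1≤L 1≤K D j t 1≤t 1≤j j≤K large B = record
  { part = new ; injective = new-inj ; joined = new-joined ; inside = new-inside }
  where
  -- This size makes the allowance `L * K * t * X` for bad vertices at most half of the margin
  -- `T * (n * M)`.
  T = 2 * (L * K * t)
  a = part B
  X = ∑ x
  c : Fin j → Fin n → ℕ
  c i u = ∑ λ y → A G u (a i y)
  Good : Fin n → Set
  Good u = 0 < x u × (∀ i → t ≤ c i u)
  good? : ∀ u → Dec (Good u)
  good? u = (0 <? x u) ×-dec all? (λ i → t ≤? c i u)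
  U : Fin n → Bool
  U u = does (good? u)
  Xg = ∑ λ u → x u * bit (U u)
  C = ∑ λ u → x u * ∑ λ i → c i u

  C-as-degrees : C ≡ ∑ λ i → ∑ λ y → wdeg G x (a i y)
  C-as-degrees = begin
    ∑ (λ u → x u * ∑ λ i → c i u)                        ≡⟨ sum-cong-≗ (λ u → *-distribˡ-sum (x u) λ i → c i u) ⟩
    ∑ (λ u → ∑ λ i → x u * c i u)                        ≡⟨ ∑-comm (λ u i → x u * c i u) ⟩
    ∑ (λ i → ∑ λ u → x u * c i u)                        ≡⟨ sum-cong-≗ (λ i → trans (sum-cong-≗ λ u → *-distribˡ-sum (x u) λ y → A G u (a i y)) (∑-comm λ u y → x u * A G u (a i y))) ⟩
    ∑ (λ i → ∑ λ y → ∑ λ u → x u * A G u (a i y))        ≡⟨ sum-cong-≗ (λ i → sum-cong-≗ λ y → sum-cong-≗ λ u → trans (*-comm (x u) _) (cong (_* x u) (A-sym G u (a i y)))) ⟩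
    ∑ (λ i → ∑ λ y → wdeg G x (a i y))                   ∎
    where open ≡-Reasoning

  open ≤-Reasoning

  lower : j * T * (L * (K * X) + n * M) ≤ L * K * C + j * T * (L * X)
  lower = begin
    j * T * (L * (K * X) + n * M)                                     ≡⟨ *-assoc j T _ ⟩
    j * (T * (L * (K * X) + n * M))                                   ≡⟨ trans (sym (∑-const j _)) (sum-cong-≗ {j} λ _ → sym (∑-const T _)) ⟩
    ∑ {j} (λ i → ∑ {T} λ y → L * (K * X) + n * M)                     ≤⟨ ∑-mono (λ i → ∑-mono λ y → degrees D (a i y) (inside B i y)) ⟩
    ∑ (λ i → ∑ λ y → L * (K * wdeg G x (a i y) + X))                  ≡⟨ sum-cong-≗ (λ i → trans (sum-cong-≗ λ y → distr L K (wdeg G x (a i y)) X) (trans (∑-distrib-+ (λ y → L * K * wdeg G x (a i y)) _) (cong₂ _+_ (sym (*-distribˡ-sum (L * K) λ y → wdeg G x (a i y))) (∑-const T _)))) ⟩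
    ∑ (λ i → L * K * ∑ (λ y → wdeg G x (a i y)) + T * (L * X))        ≡⟨ trans (∑-distrib-+ (λ i → L * K * ∑ (λ y → wdeg G x (a i y))) _) (cong₂ _+_ (sym (*-distribˡ-sum (L * K) λ i → ∑ λ y → wdeg G x (a i y))) (∑-const j _)) ⟩
    L * K * ∑ (λ i → ∑ λ y → wdeg G x (a i y)) + j * (T * (L * X))    ≡⟨ cong₂ _+_ (cong (L * K *_) (sym C-as-degrees)) (sym (*-assoc j T _)) ⟩
    L * K * C + j * T * (L * X)                                       ∎
    where
    distr : ∀ l k d x → l * (k * d + x) ≡ l * k * d + l * x
    distr = solve-∀

  c≤T : ∀ i u → c i u ≤ T
  c≤T i u = ≤-trans (∑-bound 1 λ y → 𝟙≤1 (adj? G u (a i y))) (≤-reflexive (*-identityʳ T))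

  upper : C + T * X ≤ (j * T + t) * X + T * Xg
  upper = begin
    C + T * X                                                    ≡⟨ cong (C +_) (*-distribˡ-sum T x) ⟩
    C + ∑ (λ u → T * x u)                                        ≡⟨ ∑-distrib-+ (λ u → x u * ∑ λ i → c i u) _ ⟨
    ∑ (λ u → x u * ∑ (λ i → c i u) + T * x u)                    ≤⟨ ∑-mono one ⟩
    ∑ (λ u → (j * T + t) * x u + T * (x u * bit (U u)))          ≡⟨ trans (∑-distrib-+ (λ u → (j * T + t) * x u) _) (cong₂ _+_ (sym (*-distribˡ-sum (j * T + t) x)) (sym (*-distribˡ-sum T λ u → x u * bit (U u)))) ⟩
    (j * T + t) * X + T * Xg                                     ∎
    where
    factor : ∀ x c t → x * c + t * x ≡ x * (c + t)
    factor = solve-∀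
    factor′ : ∀ x c t b → x * (c + t * b) ≡ c * x + t * (x * b)
    factor′ = solve-∀
    one : ∀ u → x u * ∑ (λ i → c i u) + T * x u ≤ (j * T + t) * x u + T * (x u * bit (U u))
    one u = begin
      x u * ∑ (λ i → c i u) + T * x u            ≡⟨ factor (x u) (∑ λ i → c i u) T ⟩
      x u * (∑ (λ i → c i u) + T)                ≤⟨ weighted (good? u) ⟩
      x u * ((j * T + t) + T * bit (U u))        ≡⟨ factor′ (x u) (j * T + t) T (bit (U u)) ⟩
      (j * T + t) * x u + T * (x u * bit (U u))  ∎
      where
      cases : (g : Dec (Good u)) → 0 < x u → ∑ (λ i → c i u) + T ≤ (j * T + t) + T * bit (does g)
      cases (yes _) _ = +-mono-≤ (≤-trans (∑-bound T λ i → c≤T i u) (m≤m+n (j * T) t)) (≤-reflexive (sym (*-identityʳ T)))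
      cases (no ¬g) pos with any? (λ i → c i u <? t)
      ... | yes (i , lt) = ≤-trans (∑-one-small (λ i → c i u) T t i (λ i → c≤T i u) (<⇒≤ lt)) (m≤m+n _ _)
      ... | no none = ⊥-elim (¬g (pos , λ i → ≮⇒≥ λ lt → none (i , lt)))
      weighted : (g : Dec (Good u)) → x u * (∑ (λ i → c i u) + T) ≤ x u * ((j * T + t) + T * bit (does g))
      weighted g with 0 <? x u
      ... | yes pos = *-monoʳ-≤ (x u) (cases g pos)
      ... | no npos rewrite n≤0⇒n≡0 (≮⇒≥ npos) = z≤n

  -- The summand `T * X` saved on bad vertices pays for `j * T * (L * X)`, the slack in the degree
  -- condition; this is where j ≤ K enters.
  combined : T * (n * M) ≤ L * K * t * X + L * K * T * Xg
  combined = +-cancelʳ-≤ (j * T * (L * (K * X)) + L * K * (T * X)) _ _ (begin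
    T * (n * M) + (j * T * (L * (K * X)) + L * K * (T * X))           ≤⟨ +-monoˡ-≤ _ (≤-trans (≤-reflexive (sym (*-identityˡ _))) (*-monoˡ-≤ (T * (n * M)) 1≤j)) ⟩
    j * (T * (n * M)) + (j * T * (L * (K * X)) + L * K * (T * X))     ≡⟨ a₁ j T (n * M) (L * (K * X)) (L * K) X ⟩
    j * T * (L * (K * X) + n * M) + L * K * (T * X)                   ≤⟨ +-monoˡ-≤ _ lower ⟩
    L * K * C + j * T * (L * X) + L * K * (T * X)                     ≡⟨ a₂ (L * K) C j T L X ⟩
    L * K * (C + T * X) + j * (T * (L * X))                           ≤⟨ +-mono-≤ (*-monoʳ-≤ (L * K) upper) (*-monoˡ-≤ (T * (L * X)) j≤K) ⟩
    L * K * ((j * T + t) * X + T * Xg) + K * (T * (L * X))            ≡⟨ a₃ L K j T t X Xg ⟩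
    L * K * t * X + L * K * T * Xg + (j * T * (L * (K * X)) + L * K * (T * X))  ∎)
    where
    a₁ : ∀ j T m q p X → j * (T * m) + (j * T * q + p * (T * X)) ≡ j * T * (q + m) + p * (T * X)
    a₁ = solve-∀
    a₂ : ∀ p C j T L X → p * C + j * T * (L * X) + p * (T * X) ≡ p * (C + T * X) + j * (T * (L * X))
    a₂ = solve-∀
    a₃ : ∀ L K j T t X Y → L * K * ((j * T + t) * X + T * Y) + K * (T * (L * X)) ≡ L * K * t * X + L * K * T * Y + (j * T * (L * (K * X)) + L * K * (T * X))
    a₃ = solve-∀

  1≤LKt : 1 ≤ L * K * t
  1≤LKt = *-mono-≤ (*-mono-≤ 1≤L 1≤K) 1≤t

  X≤ : X ≤ n * M
  X≤ = ∑-bound M (bounded D)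

  nM≤ : n * M ≤ 2 * (L * K) * Xg
  nM≤ = *-cancelˡ-≤ (L * K * t) {{>-nonZero 1≤LKt}} (+-cancelˡ-≤ (L * K * t * (n * M)) _ _ (begin
    L * K * t * (n * M) + L * K * t * (n * M)       ≡⟨ a₁ (L * K * t) (n * M) ⟩
    T * (n * M)                                     ≤⟨ combined ⟩
    L * K * t * X + L * K * T * Xg                  ≤⟨ +-monoˡ-≤ _ (*-monoʳ-≤ (L * K * t) X≤) ⟩
    L * K * t * (n * M) + L * K * T * Xg            ≡⟨ cong (L * K * t * (n * M) +_) (a₂ (L * K) t Xg) ⟩
    L * K * t * (n * M) + L * K * t * (2 * (L * K) * Xg)  ∎))
    where
    a₁ : ∀ p q → p * q + p * q ≡ 2 * p * q
    a₁ = solve-∀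
    a₂ : ∀ p t y → p * (2 * (p * t)) * y ≡ p * t * (2 * p * y)
    a₂ = solve-∀

  0<M : 0 < M
  0<M = let v , pos = ∑-pos x (positive D) in ≤-trans pos (bounded D v)

  n≤card : n ≤ 2 * (L * K) * card U
  n≤card = *-cancelˡ-≤ M {{>-nonZero 0<M}} (begin
    M * n                        ≡⟨ *-comm M n ⟩
    n * M                        ≤⟨ nM≤ ⟩
    2 * (L * K) * Xg             ≤⟨ *-monoʳ-≤ (2 * (L * K)) (≤-trans (∑-mono λ u → *-monoˡ-≤ (bit (U u)) (bounded D u)) (≤-reflexive (sym (*-distribˡ-sum M (bit ∘ U))))) ⟩
    2 * (L * K) * (M * card U)   ≡⟨ x∙yz≈y∙xz (2 * (L * K)) M (card U) ⟩
    M * (2 * (L * K) * card U)   ∎)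

  manyGood : t * 2 ^ (j * T) ≤ card U
  manyGood = *-cancelˡ-≤ (2 * (L * K)) {{>-nonZero (*-mono-≤ (s≤s (z≤n {1})) (*-mono-≤ 1≤L 1≤K))}} (≤-trans large n≤card)

  q : Fin (j * T) → Fin n → Bool
  q e u = let i , y = remQuot T e in does (adj? G u (a i y))

  H = homogeneous (j * T) q U t manyGood
  V = proj₁ H
  V⊆U = proj₁ (proj₂ (proj₂ H))

  picked = pick t V (proj₁ (proj₂ H))
  f = proj₁ picked
  f-inj : ∀ {x y} → f x ≡ f y → x ≡ y
  f-inj = proj₁ (proj₂ picked)
  f∈V = proj₂ (proj₂ picked)

  -- Any chosen vertex can serve as reference: all have the same neighbours in the parts, so t of
  -- its neighbours in each part are joined to every chosen vertex.
  y₀ : Fin t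
  y₀ = fromℕ< 1≤t
  u₀ = f y₀
  u₀-good : Good u₀
  u₀-good = does-true (good? u₀) (V⊆U u₀ (f∈V y₀))

  card-c : ∀ i → card (λ y → does (adj? G u₀ (a i y))) ≡ c i u₀
  card-c i = sum-cong-≗ λ y → bit-𝟙 (adj? G u₀ (a i y))
    where
    bit-𝟙 : {P : Set} (d : Dec P) → bit (does d) ≡ 𝟙 d
    bit-𝟙 (yes _) = refl
    bit-𝟙 (no _)  = refl

  sel : ∀ i → Σ[ g ∈ (Fin t → Fin T) ] (∀ {x y} → g x ≡ g y → x ≡ y) × (∀ y → does (adj? G u₀ (a i (g y))) ≡ true)
  sel i = pick t (λ y → does (adj? G u₀ (a i y))) (≤-trans (proj₂ u₀-good i) (≤-reflexive (sym (card-c i))))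

  cross : ∀ i y z → Adj G (f y) (a i (proj₁ (sel i) z))
  cross i y z = does-true (adj? G (f y) (a i w)) (trans (same (f y) (f∈V y)) (proj₂ (proj₂ (sel i)) z))
    where
    w = proj₁ (sel i) z
    same : ∀ u → V u ≡ true → does (adj? G u (a i w)) ≡ does (adj? G u₀ (a i w))
    same u u∈V = subst (λ p → does (adj? G u (a (proj₁ p) (proj₂ p))) ≡ does (adj? G u₀ (a (proj₁ p) (proj₂ p))))
      (remQuot-combine i w) (proj₂ (proj₂ (proj₂ H)) (combine i w) u u₀ u∈V (f∈V y₀))

  new : Fin (suc j) → Fin t → Fin n
  new zero    = f
  new (suc i) = a i ∘ proj₁ (sel i)
  new-inj : ∀ i {x y} → new i x ≡ new i y → x ≡ y
  new-inj zero    e = f-inj e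
  new-inj (suc i) e = proj₁ (proj₂ (sel i)) (injective B i e)
  new-joined : ∀ {i i′} → i ≢ i′ → ∀ x y → Adj G (new i x) (new i′ y)
  new-joined {zero}  {zero}   ne x y = ⊥-elim (ne refl)
  new-joined {zero}  {suc i}  ne x y = cross i x y
  new-joined {suc i} {zero}   ne x y = symm G (cross i y x)
  new-joined {suc i} {suc i′} ne x y = joined B (ne ∘ cong suc) _ _
  new-inside : ∀ i y → 0 < x (new i y)
  new-inside zero    y = proj₁ (does-true (good? (f y)) (V⊆U (f y) (f∈V y)))
  new-inside (suc i) y = inside B i _

-- Adding a part shrinks the earlier ones from 2LKt to t, so the induction on j treats all t at
-- once.
dense-blowup : ∀ K L → 1 ≤ L → ∀ j → j ≤ K → ∀ t → 1 ≤ t → ∃[ n₀ ] (∀ {n} (G : Graph n) x M → n₀ ≤ n →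
  Dense G x K L M → Blowup G (λ v → 0 < x v) (suc j) t)
dense-blowup K L 1≤L zero    _   t 1≤t = L * t , λ G x M le D → dense-start 1≤L D t le
dense-blowup K L 1≤L (suc j) j<K t 1≤t =
  let n₁ , rec = dense-blowup K L 1≤L j (<⇒≤ j<K) (2 * (L * K * t)) (*-mono-≤ (s≤s (z≤n {1})) (*-mono-≤ (*-mono-≤ 1≤L 1≤K) 1≤t))
      n₂ = 2 * (L * K) * (t * 2 ^ (suc j * (2 * (L * K * t))))
  in n₁ + n₂ , λ G x M le D → dense-step 1≤L 1≤K D (suc j) t 1≤t (s≤s z≤n) j<K (≤-trans (m≤n+m n₂ n₁) le)
       (rec G x M (≤-trans (m≤m+n n₁ n₂) le) D)
  where
  1≤K : 1 ≤ K
  1≤K = ≤-trans (s≤s z≤n) j<K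

-- Copies and embeddings

∈-tabulate⁻ : ∀ {n} {P : Fin n → Set} (P? : ∀ v → Dec (P v)) {v} → v ∈ tabulateᵛ (does ∘ P?) → P v
∈-tabulate⁻ P? {v} v∈ = from (P? v) (trans (sym (lookup∘tabulate (does ∘ P?) v)) ([]=⇒lookup v∈))
  where
  from : {P : Set} (d : Dec P) → does d ≡ true → P
  from (yes p) _ = p

∈-tabulate⁺ : ∀ {n} {P : Fin n → Set} (P? : ∀ v → Dec (P v)) {v} → P v → v ∈ tabulateᵛ (does ∘ P?)
∈-tabulate⁺ P? {v} p = lookup⇒[]= v _ (trans (lookup∘tabulate (does ∘ P?) v) (dec-true (P? v) p))

subset-ext : ∀ {n} {p q : Subset n} → (∀ v → v ∈ p → v ∈ q) → (∀ v → v ∈ q → v ∈ p) → p ≡ q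
subset-ext p⊆q q⊆p = ⊆-antisym (λ {v} → p⊆q v) (λ {v} → q⊆p v)

vec-ext : ∀ {B : Set} {n} {xs ys : Vec B n} → (∀ i → lookup xs i ≡ lookup ys i) → xs ≡ ys
vec-ext {xs = xs} {ys} e = trans (sym (tabulate∘lookup xs)) (trans (tabulate-cong e) (tabulate∘lookup ys))

module _ {m n : ℕ} (H : Graph m) (φ : Fin m → Fin n) where

  ImageVertex : Fin n → Set
  ImageVertex v = ∃[ i ] φ i ≡ v

  ImageEdge : Fin n → Fin n → Set
  ImageEdge u v = ∃[ i ] ∃[ j ] (φ i ≡ u × φ j ≡ v × Adj H i j)

  imageVertex? : ∀ v → Dec (ImageVertex v)
  imageVertex? v = any? λ i → φ i ≟ v

  imageEdge? : ∀ u v → Dec (ImageEdge u v)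
  imageEdge? u v = any? λ i → any? λ j → (φ i ≟ u) ×-dec (φ j ≟ v) ×-dec adj? H i j

  image : SubgraphData n
  image = tabulateᵛ (does ∘ imageVertex?) , tabulateᵛ λ u → tabulateᵛ (does ∘ imageEdge? u)

  Spans : SubgraphData n → Set
  Spans S = (∀ v → InVertices S v ⇔ ImageVertex v) × (∀ u v → InEdges S u v ⇔ ImageEdge u v)

  image-row : ∀ u → lookup (proj₂ image) u ≡ tabulateᵛ (does ∘ imageEdge? u)
  image-row u = lookup∘tabulate (λ u → tabulateᵛ (does ∘ imageEdge? u)) u

  image-spans : Spans image
  image-spans = (λ v → mk⇔ (∈-tabulate⁻ imageVertex?) (∈-tabulate⁺ imageVertex?)) ,
    λ u v → mk⇔ (λ e → ∈-tabulate⁻ (imageEdge? u) (subst (v ∈_) (image-row u) e))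
                (λ e → subst (v ∈_) (sym (image-row u)) (∈-tabulate⁺ (imageEdge? u) e))

  spans-unique : ∀ S S′ → Spans S → Spans S′ → S ≡ S′
  spans-unique _ _ (v , e) (v′ , e′) = cong₂ _,_
    (subset-ext (λ x → from (v′ x) ∘ to (v x)) (λ x → from (v x) ∘ to (v′ x)))
    (vec-ext λ u → subset-ext (λ x → from (e′ u x) ∘ to (e u x)) (λ x → from (e u x) ∘ to (e′ u x)))
    where open Equivalence

IsEmb : ∀ {m n} → Graph m → Graph n → (Fin m → Fin n) → Set
IsEmb H G φ = (∀ i j → φ i ≡ φ j → i ≡ j) × (∀ i j → Adj H i j → Adj G (φ i) (φ j))

isEmb? : ∀ {m n} (H : Graph m) (G : Graph n) φ → Dec (IsEmb H G φ)
isEmb? H G φ = all? (λ i → all? λ j → (φ i ≟ φ j) →-dec (i ≟ j)) ×-dec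
               all? (λ i → all? λ j → adj? H i j →-dec adj? G (φ i) (φ j))

emb⇒copy : ∀ {m n} (H : Graph m) (G : Graph n) φ S → IsEmb H G φ → Spans H φ S → IsCopy H G S
emb⇒copy H G φ S (inj , hom) (vs , es) = sub , mkIso φ (inj _ _) vs
  (λ i j → mk⇔ (λ a → from (es _ _) (i , j , refl , refl , a)) (back i j))
  where
  open Equivalence
  sub : IsSubgraph G S
  sub u v e with to (es u v) e
  ... | i , j , refl , refl , a = from (es _ _) (j , i , refl , refl , symm H a) , hom i j a ,
    from (vs _) (i , refl) , from (vs _) (j , refl)
  back : ∀ i j → InEdges S (φ i) (φ j) → Adj H i j
  back i j e with to (es _ _) e
  ... | i′ , j′ , ei , ej , a with inj _ _ ei | inj _ _ ej
  ...   | refl | refl = a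

copy⇒emb : ∀ {m n} (H : Graph m) (G : Graph n) S → IsCopy H G S → ∃[ φ ] (IsEmb H G φ × Spans H φ S)
copy⇒emb H G S (sub , mkIso φ inj vs es) = φ ,
  ((λ i j → inj) , λ i j a → proj₁ (proj₂ (sub _ _ (to (es i j) a)))) ,
  vs , λ u v → mk⇔ (forth u v) λ { (i , j , refl , refl , a) → to (es i j) a }
  where
  open Equivalence
  forth : ∀ u v → InEdges S u v → ImageEdge H φ u v
  forth u v e with sub u v e
  ... | _ , _ , u∈ , v∈ with to (vs u) u∈ | to (vs v) v∈
  ...   | i , refl | j , refl = i , j , refl , refl , from (es i j) e

free⇒no-emb : ∀ {m n} {F : Graph m} {G : Graph n} → G IsFree F → ∀ φ → ¬ IsEmb F G φ
free⇒no-emb {F = F} {G} free φ e = free (image F φ , emb⇒copy F G φ (image F φ) e (image-spans F φ))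

-- Double counting of pairs (subgraph, parametrisation)

∑L : {B : Set} → (B → ℕ) → List B → ℕ
∑L f []       = 0
∑L f (x ∷ xs) = f x + ∑L f xs

∑L-cong : {B : Set} {f g : B → ℕ} → (∀ x → f x ≡ g x) → ∀ xs → ∑L f xs ≡ ∑L g xs
∑L-cong h []       = refl
∑L-cong h (x ∷ xs) = cong₂ _+_ (h x) (∑L-cong h xs)

∑L-*ʳ : ∀ {B : Set} (f : B → ℕ) c xs → ∑L (λ x → f x * c) xs ≡ ∑L f xs * c
∑L-*ʳ f c []       = refl
∑L-*ʳ f c (x ∷ xs) = trans (cong (f x * c +_) (∑L-*ʳ f c xs)) (sym (*-distribʳ-+ c (f x) _))

∑L-++ : {B : Set} (f : B → ℕ) → ∀ xs ys → ∑L f (xs ++ ys) ≡ ∑L f xs + ∑L f ys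
∑L-++ f []       ys = refl
∑L-++ f (x ∷ xs) ys = trans (cong (f x +_) (∑L-++ f xs ys)) (sym (+-assoc (f x) _ _))

∑L-map : {B C : Set} (f : C → ℕ) (g : B → C) → ∀ xs → ∑L f (mapᴸ g xs) ≡ ∑L (f ∘ g) xs
∑L-map f g []       = refl
∑L-map f g (x ∷ xs) = cong (f (g x) +_) (∑L-map f g xs)

∑L-product : {B C D : Set} (f : D → ℕ) (g : B → C → D) → ∀ xs ys →
  ∑L f (cartesianProductWith g xs ys) ≡ ∑L (λ x → ∑L (λ y → f (g x y)) ys) xs
∑L-product f g []       ys = refl
∑L-product f g (x ∷ xs) ys = trans (∑L-++ f (mapᴸ (g x) ys) _) (cong₂ _+_ (∑L-map f (g x) ys) (∑L-product f g xs ys))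

∑L-filter : {B : Set} {P : B → Set} (P? : ∀ b → Dec (P b)) → ∀ xs → length (filter P? xs) ≡ ∑L (𝟙 ∘ P?) xs
∑L-filter P? [] = refl
∑L-filter P? (x ∷ xs) with P? x
... | yes _ = cong suc (∑L-filter P? xs)
... | no _  = ∑L-filter P? xs

-- Completeness and freedom from repetitions in one equation, the form that `once-δ` sums against.
Once : {B : Set} (_≟ᴮ_ : DecidableEquality B) → List B → Set
Once _≟ᴮ_ xs = ∀ a → ∑L (λ x → 𝟙 (x ≟ᴮ a)) xs ≡ 1

once-δ : {B : Set} (_≟ᴮ_ : DecidableEquality B) (xs : List B) → Once _≟ᴮ_ xs → ∀ a (f : B → ℕ) →
  ∑L (λ x → 𝟙 (x ≟ᴮ a) * f x) xs ≡ f a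
once-δ _≟ᴮ_ xs once a f = trans (∑L-cong same xs)
  (trans (∑L-*ʳ (λ x → 𝟙 (x ≟ᴮ a)) (f a) xs) (trans (cong (_* f a) (once a)) (*-identityˡ _)))
  where
  same : ∀ x → 𝟙 (x ≟ᴮ a) * f x ≡ 𝟙 (x ≟ᴮ a) * f a
  same x with x ≟ᴮ a
  ... | yes refl = refl
  ... | no _     = refl

once-product : {B C D : Set} (_≟ᴮ_ : DecidableEquality B) (_≟ᶜ_ : DecidableEquality C) (_≟ᴰ_ : DecidableEquality D)
  (g : B → C → D) → (∀ {b c b′ c′} → g b c ≡ g b′ c′ → b ≡ b′ × c ≡ c′) → (∀ d → ∃[ b ] ∃[ c ] d ≡ g b c) →
  ∀ xs ys → Once _≟ᴮ_ xs → Once _≟ᶜ_ ys → Once _≟ᴰ_ (cartesianProductWith g xs ys)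
once-product _≟ᴮ_ _≟ᶜ_ _≟ᴰ_ g inj onto xs ys ox oy d with onto d
... | b , c , refl = trans (∑L-product (λ x → 𝟙 (x ≟ᴰ g b c)) g xs ys) (trans (∑L-cong row xs) (ox b))
  where
  split-eq : ∀ x y → 𝟙 (g x y ≟ᴰ g b c) ≡ 𝟙 (y ≟ᶜ c) * 𝟙 (x ≟ᴮ b)
  split-eq x y with x ≟ᴮ b | y ≟ᶜ c
  ... | yes refl | yes refl = 𝟙-yes (g x y ≟ᴰ g x y) refl
  ... | yes _    | no ne    = 𝟙-no (g x y ≟ᴰ g b c) (ne ∘ proj₂ ∘ inj)
  ... | no ne    | yes _    = 𝟙-no (g x y ≟ᴰ g b c) (ne ∘ proj₁ ∘ inj)
  ... | no ne    | no _     = 𝟙-no (g x y ≟ᴰ g b c) (ne ∘ proj₁ ∘ inj)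
  row : ∀ x → ∑L (λ y → 𝟙 (g x y ≟ᴰ g b c)) ys ≡ 𝟙 (x ≟ᴮ b)
  row x = trans (∑L-cong (split-eq x) ys) (trans (∑L-*ʳ (λ y → 𝟙 (y ≟ᶜ c)) (𝟙 (x ≟ᴮ b)) ys) (trans (cong (_* 𝟙 (x ≟ᴮ b)) (oy c)) (*-identityˡ _)))

once-vectors : {B : Set} (_≟ᴮ_ : DecidableEquality B) (xs : List B) → Once _≟ᴮ_ xs → ∀ m → Once (Vecₚ.≡-dec _≟ᴮ_) (vectors xs m)
once-vectors _≟ᴮ_ xs ox zero [] = refl
once-vectors _≟ᴮ_ xs ox (suc m) = once-product _≟ᴮ_ (Vecₚ.≡-dec _≟ᴮ_) (Vecₚ.≡-dec _≟ᴮ_) _∷_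
  Vecₚ.∷-injective (λ { (x ∷ xs) → x , xs , refl }) xs (vectors xs m) ox (once-vectors _≟ᴮ_ xs ox m)

_≟ˢ_ : ∀ {n} → DecidableEquality (SubgraphData n)
_≟ˢ_ = Productₚ.≡-dec (Vecₚ.≡-dec Boolₚ._≟_) (Vecₚ.≡-dec (Vecₚ.≡-dec Boolₚ._≟_))

once-subgraphs : ∀ n → Once _≟ˢ_ (allSubgraphData n)
once-subgraphs n = once-product (Vecₚ.≡-dec Boolₚ._≟_) (Vecₚ.≡-dec (Vecₚ.≡-dec Boolₚ._≟_)) _≟ˢ_ _,_
  (λ { refl → refl , refl }) (λ { (V , E) → V , E , refl })
  subsets (vectors subsets n) once-subsets (once-vectors (Vecₚ.≡-dec Boolₚ._≟_) subsets once-subsets n)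
  where
  subsets = vectors (true ∷ false ∷ []) n
  bools : Once Boolₚ._≟_ (true ∷ false ∷ [])
  bools true  = refl
  bools false = refl
  once-subsets = once-vectors Boolₚ._≟_ (true ∷ false ∷ []) bools n

_≟ᵛ_ : ∀ {n m} → DecidableEquality (Vec (Fin n) m)
_≟ᵛ_ = Vecₚ.≡-dec _≟_

∑V-∑L : ∀ {n} m {B : Set} (f : Vec (Fin n) m → B → ℕ) xs → ∑V m (λ x → ∑L (f x) xs) ≡ ∑L (λ b → ∑V m λ x → f x b) xs
∑V-∑L {n} m f []   = trans (∑V-const m 0) (*-zeroʳ (n ^ m))
∑V-∑L m f (b ∷ xs) = trans (∑V-+ m (λ x → f x b) _) (cong (∑V m (λ x → f x b) +_) (∑V-∑L m f xs))

∑V-∑V : ∀ {n n′} m m′ (f : Vec (Fin n) m → Vec (Fin n′) m′ → ℕ) →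
  ∑V m (λ x → ∑V m′ (f x)) ≡ ∑V m′ λ y → ∑V m λ x → f x y
∑V-∑V zero    m′ f = refl
∑V-∑V (suc m) m′ f = trans (sum-cong-≗ λ x → ∑V-∑V m m′ λ xs → f (x ∷ xs))
  (sym (∑V-∑ m′ λ y x → ∑V m λ xs → f (x ∷ xs) y))

∑V-δ : ∀ {n} m (a : Vec (Fin n) m) (f : Vec (Fin n) m → ℕ) → ∑V m (λ x → 𝟙 (x ≟ᵛ a) * f x) ≡ f a
∑V-δ zero    []      f = *-identityˡ _
∑V-δ (suc m) (a ∷ as) f = trans (sum-cong-≗ λ x → trans (∑V-cong m λ xs → cong (_* f (x ∷ xs)) (pair x xs))
    (trans (∑V-cong m λ xs → *-assoc (𝟙 (x ≟ a)) (𝟙 (xs ≟ᵛ as)) _)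
    (trans (∑V-*ˡ m (𝟙 (x ≟ a)) λ xs → 𝟙 (xs ≟ᵛ as) * f (x ∷ xs)) (cong (𝟙 (x ≟ a) *_) (∑V-δ m as λ xs → f (x ∷ xs))))))
  (∑-δ a λ x → f (x ∷ as))
  where
  pair : ∀ x xs → 𝟙 ((x ∷ xs) ≟ᵛ (a ∷ as)) ≡ 𝟙 (x ≟ a) * 𝟙 (xs ≟ᵛ as)
  pair x xs with x ≟ a | xs ≟ᵛ as
  ... | yes _ | yes _ = refl
  ... | yes _ | no _  = refl
  ... | no _  | yes _ = refl
  ... | no _  | no _  = refl

∑V-pos : ∀ {n} m (f : Vec (Fin n) m → ℕ) → 0 < ∑V m f → ∃[ x ] 0 < f x
∑V-pos zero    f p = [] , p
∑V-pos (suc m) f p = let x , q = ∑-pos _ p ; xs , r = ∑V-pos m _ q in x ∷ xs , r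

∑V-≤1 : ∀ {n} m (f : Vec (Fin n) m → ℕ) → (∀ x → f x ≤ 1) → (∀ x y → 0 < f x → 0 < f y → x ≡ y) → ∑V m f ≤ 1
∑V-≤1 m f le unique with 0 <? ∑V m f
... | no npos = ≤-trans (≮⇒≥ npos) z≤n
... | yes pos with ∑V-pos m f pos
...   | a , fa = ≤-trans (∑V-mono m bound) (≤-reflexive (∑V-δ m a λ _ → 1))
  where
  bound : ∀ x → f x ≤ 𝟙 (x ≟ᵛ a) * 1
  bound x with x ≟ᵛ a
  ... | yes _ = le x
  ... | no ne = ≮⇒≥ λ fx → ne (unique x a fx fa)

-- Counting along a partial injection. `r` is the indicator of the graph of `g`, zero off P: summed
-- over y against Q it reaches the indicator of P, and summed over x it is at most 1 by injectivity.
count-≤ : ∀ {n n′} m m′ {P : Vec (Fin n) m → Set} {Q : Vec (Fin n′) m′ → Set} (P? : ∀ x → Dec (P x)) (Q? : ∀ y → Dec (Q y)) →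
  (g : ∀ x → P x → Vec (Fin n′) m′) → (∀ x p → Q (g x p)) → (∀ x x′ p p′ → g x p ≡ g x′ p′ → x ≡ x′) →
  ∑V m (𝟙 ∘ P?) ≤ ∑V m′ (𝟙 ∘ Q?)
count-≤ {n} {n′} m m′ {P} {Q} P? Q? g gQ inj = begin
  ∑V m (𝟙 ∘ P?)                                    ≤⟨ ∑V-mono m hit ⟩
  ∑V m (λ x → ∑V m′ λ y → r x y (P? x) * 𝟙 (Q? y))   ≡⟨ ∑V-∑V m m′ (λ x y → r x y (P? x) * 𝟙 (Q? y)) ⟩
  ∑V m′ (λ y → ∑V m λ x → r x y (P? x) * 𝟙 (Q? y))   ≤⟨ ∑V-mono m′ (λ y → ∑V-le y) ⟩
  ∑V m′ (𝟙 ∘ Q?)                                   ∎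
  where
  open ≤-Reasoning
  r : ∀ x y → Dec (P x) → ℕ
  r x y (yes p) = 𝟙 (y ≟ᵛ g x p)
  r x y (no _)  = 0
  hit : ∀ x → 𝟙 (P? x) ≤ ∑V m′ λ y → r x y (P? x) * 𝟙 (Q? y)
  hit x with P? x
  ... | no _  = z≤n
  ... | yes p = ≤-reflexive (sym (trans (∑V-δ m′ (g x p) (𝟙 ∘ Q?)) (𝟙-yes (Q? (g x p)) (gQ x p))))
  r≤1 : ∀ x y d → r x y d ≤ 1
  r≤1 x y (yes p) = 𝟙≤1 (y ≟ᵛ g x p)
  r≤1 x y (no _)  = z≤n
  r-unique : ∀ y x x′ d d′ → 0 < r x y d → 0 < r x′ y d′ → x ≡ x′
  r-unique y x x′ (yes p) (yes p′) h h′ = inj x x′ p p′ (trans (sym (𝟙-pos (y ≟ᵛ g x p) h)) (𝟙-pos (y ≟ᵛ g x′ p′) h′))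
  ∑V-le : ∀ y → ∑V m (λ x → r x y (P? x) * 𝟙 (Q? y)) ≤ 𝟙 (Q? y)
  ∑V-le y = begin
    ∑V m (λ x → r x y (P? x) * 𝟙 (Q? y))   ≡⟨ trans (∑V-cong m λ x → *-comm (r x y (P? x)) (𝟙 (Q? y))) (∑V-*ˡ m (𝟙 (Q? y)) λ x → r x y (P? x)) ⟩
    𝟙 (Q? y) * ∑V m (λ x → r x y (P? x))   ≤⟨ *-monoʳ-≤ (𝟙 (Q? y)) (∑V-≤1 m _ (λ x → r≤1 x y (P? x)) (λ x x′ → r-unique y x x′ (P? x) (P? x′))) ⟩
    𝟙 (Q? y) * 1                           ≡⟨ *-identityʳ _ ⟩
    𝟙 (Q? y)                               ∎

module _ {m n : ℕ} (H : Graph m) (G : Graph n) where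

  Parametrises : SubgraphData n → Vec (Fin n) m → Set
  Parametrises S x = IsEmb H G (lookup x) × S ≡ image H (lookup x)

  parametrises? : ∀ S x → Dec (Parametrises S x)
  parametrises? S x = isEmb? H G (lookup x) ×-dec (S ≟ˢ image H (lookup x))

  parametrisations : SubgraphData n → ℕ
  parametrisations S = ∑V m (𝟙 ∘ parametrises? S)

  embCount : ℕ
  embCount = ∑V m λ x → 𝟙 (isEmb? H G (lookup x))

-- The fibre of the double counting for H inside itself, a form in which `count-≤` compares it with
-- every other fibre.
automorphisms : ∀ {m} → Graph m → ℕ
automorphisms H = parametrisations H H (image H id)

spans-≗ : ∀ {m n} (H : Graph m) {φ ψ : Fin m → Fin n} S → (∀ i → φ i ≡ ψ i) → Spans H φ S → Spans H ψ S
spans-≗ H _ e (vs , es) =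
  (λ v → mk⇔ (λ h → let i , q = to (vs v) h in i , trans (sym (e i)) q) (λ (i , q) → from (vs v) (i , trans (e i) q))) ,
  (λ u v → mk⇔ (λ h → let i , j , p , q , a = to (es u v) h in i , j , trans (sym (e i)) p , trans (sym (e j)) q , a)
    (λ (i , j , p , q , a) → from (es u v) (i , j , trans (e i) p , trans (e j) q , a)))
  where open Equivalence

emb-≗ : ∀ {m n} (H : Graph m) (G : Graph n) {φ ψ : Fin m → Fin n} → (∀ i → φ i ≡ ψ i) → IsEmb H G φ → IsEmb H G ψ
emb-≗ H G e (inj , hom) = (λ i j q → inj i j (trans (e i) (trans q (sym (e j))))) ,
  (λ i j a → subst₂ (Adj G) (e i) (e j) (hom i j a))

module _ {m n : ℕ} (H : Graph m) (G : Graph n) (S : SubgraphData n) (φ : Fin m → Fin n) (emb₀ : IsEmb H G φ) (sp : Spans H φ S) where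

  open Equivalence

  -- With φ a parametrisation of S, x ↦ φ⁻¹ ∘ x turns parametrisations into automorphisms, and s ↦ φ
  -- ∘ s goes back. Both maps are injective, so this bound and the next make all fibres equally
  -- large.
  parametrisations-≤ : parametrisations H G S ≤ automorphisms H
  parametrisations-≤ = count-≤ m m (parametrises? H G S) (parametrises? H H (image H id)) σ σ-aut σ-inj
    where
    pre : ∀ x → Parametrises H G S x → ∀ i → ∃[ a ] φ a ≡ lookup x i
    pre x (_ , refl) i = to (proj₁ sp (lookup x i)) (from (proj₁ (image-spans H (lookup x)) (lookup x i)) (i , refl))
    σ : ∀ x → Parametrises H G S x → Vec (Fin m) m
    σ x p = tabulateᵛ λ i → proj₁ (pre x p i)
    φσ : ∀ x p i → φ (lookup (σ x p) i) ≡ lookup x i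
    φσ x p i = trans (cong φ (lookup∘tabulate (λ i → proj₁ (pre x p i)) i)) (proj₂ (pre x p i))
    σ-inj : ∀ x x′ p p′ → σ x p ≡ σ x′ p′ → x ≡ x′
    σ-inj x x′ p p′ e = vec-ext λ i → trans (sym (φσ x p i)) (trans (cong (λ s → φ (lookup s i)) e) (φσ x′ p′ i))
    σ-aut : ∀ x p → Parametrises H H (image H id) (σ x p)
    σ-aut x p@((inj , hom) , refl) = (s-inj , s-hom) , spans-unique H s (image H id) _ (vs , es) (image-spans H s)
      where
      s = lookup (σ x p)
      imx = image-spans H (lookup x)
      s-inj : ∀ i j → s i ≡ s j → i ≡ j
      s-inj i j e = inj i j (trans (sym (φσ x p i)) (trans (cong φ e) (φσ x p j)))
      edge : ∀ {a b} → Adj H a b → ∃[ i ] ∃[ j ] (s i ≡ a × s j ≡ b × Adj H i j)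
      edge {a} {b} ab with to (proj₂ imx (φ a) (φ b)) (from (proj₂ sp (φ a) (φ b)) (a , b , refl , refl , ab))
      ... | i , j , ei , ej , ij = i , j , proj₁ emb₀ _ _ (trans (φσ x p i) ei) , proj₁ emb₀ _ _ (trans (φσ x p j) ej) , ij
      s-hom : ∀ i j → Adj H i j → Adj H (s i) (s j)
      s-hom i j ij with to (proj₂ sp (lookup x i) (lookup x j)) (from (proj₂ imx _ _) (i , j , refl , refl , ij))
      ... | a , b , ea , eb , ab = subst₂ (Adj H) (proj₁ emb₀ _ _ (trans ea (sym (φσ x p i)))) (proj₁ emb₀ _ _ (trans eb (sym (φσ x p j)))) ab
      vs : ∀ v → InVertices (image H id) v ⇔ ImageVertex H s v
      vs v = mk⇔
        (λ _ → let i , e = to (proj₁ imx (φ v)) (from (proj₁ sp (φ v)) (v , refl)) in i , proj₁ emb₀ _ _ (trans (φσ x p i) e))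
        (λ _ → from (proj₁ (image-spans H id) v) (v , refl))
      es : ∀ u v → InEdges (image H id) u v ⇔ ImageEdge H s u v
      es u v = mk⇔
        (λ e → let a , b , ea , eb , ab = to (proj₂ (image-spans H id) u v) e in edge (subst₂ (Adj H) ea eb ab))
        (λ { (i , j , refl , refl , ij) → from (proj₂ (image-spans H id) _ _) (s i , s j , refl , refl , s-hom i j ij) })

  parametrisations-≥ : automorphisms H ≤ parametrisations H G S
  parametrisations-≥ = count-≤ m m (parametrises? H H (image H id)) (parametrises? H G S) (λ s _ → map φ s) par inj′
    where
    φs : ∀ s i → φ (lookup s i) ≡ lookup (map φ s) i
    φs s i = sym (Vecₚ.lookup-map i φ s)
    inj′ : ∀ s s′ p p′ → map φ s ≡ map φ s′ → s ≡ s′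
    inj′ s s′ _ _ e = vec-ext λ i → proj₁ emb₀ _ _ (trans (φs s i) (trans (cong (λ t → lookup t i) e) (sym (φs s′ i))))
    par : ∀ s → Parametrises H H (image H id) s → Parametrises H G S (map φ s)
    par s ((inj , hom) , eq) = emb-≗ H G (φs s) ((λ i j e → inj i j (proj₁ emb₀ _ _ e)) , λ i j a → proj₂ emb₀ _ _ (hom i j a)) ,
      spans-unique H (lookup (map φ s)) S _ (spans-≗ H S (φs s) (vs , es)) (image-spans H (lookup (map φ s)))
      where
      ims : Spans H (lookup s) (image H id)
      ims = subst (Spans H (lookup s)) (sym eq) (image-spans H (lookup s))
      vs : ∀ v → InVertices S v ⇔ ImageVertex H (φ ∘ lookup s) v
      vs v = mk⇔
        (λ h → let a , ea = to (proj₁ sp v) h ; i , ei = to (proj₁ ims a) (from (proj₁ (image-spans H id) a) (a , refl)) in i , trans (cong φ ei) ea)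
        (λ (i , e) → from (proj₁ sp v) (lookup s i , e))
      es : ∀ u v → InEdges S u v ⇔ ImageEdge H (φ ∘ lookup s) u v
      es u v = mk⇔
        (λ h → let a , b , ea , eb , ab = to (proj₂ sp u v) h
                   i , j , ei , ej , ij = to (proj₂ ims a b) (from (proj₂ (image-spans H id) a b) (a , b , refl , refl , ab))
               in i , j , trans (cong φ ei) ea , trans (cong φ ej) eb , ij)
        (λ (i , j , ei , ej , ij) → from (proj₂ sp u v) (lookup s i , lookup s j , ei , ej , hom i j ij))

copies-automorphisms : ∀ {m n} (H : Graph m) (G : Graph n) → 𝓝 H G * automorphisms H ≡ embCount H G
copies-automorphisms {m} {n} H G = begin
  𝓝 H G * automorphisms H
    ≡⟨ cong (_* automorphisms H) (∑L-filter (isCopy? H G) all) ⟩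
  ∑L (𝟙 ∘ isCopy? H G) all * automorphisms H
    ≡⟨ ∑L-*ʳ (𝟙 ∘ isCopy? H G) (automorphisms H) all ⟨
  ∑L (λ S → 𝟙 (isCopy? H G S) * automorphisms H) all
    ≡⟨ ∑L-cong fibre all ⟩
  ∑L (parametrisations H G) all
    ≡⟨ ∑V-∑L m (λ x S → 𝟙 (parametrises? H G S x)) all ⟨
  ∑V m (λ x → ∑L (λ S → 𝟙 (parametrises? H G S x)) all)
    ≡⟨ ∑V-cong m (λ x → trans (∑L-cong (λ S → both x S (isEmb? H G (lookup x)) (S ≟ˢ image H (lookup x))) all)
         (once-δ _≟ˢ_ all (once-subgraphs n) (image H (lookup x)) (λ _ → 𝟙 (isEmb? H G (lookup x))))) ⟩
  embCount H G ∎
  where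
  open ≡-Reasoning
  all = allSubgraphData n
  both : ∀ x S (d : Dec (IsEmb H G (lookup x))) (e : Dec (S ≡ image H (lookup x))) → 𝟙 (d ×-dec e) ≡ 𝟙 e * 𝟙 d
  both x S (yes _) (yes _) = refl
  both x S (yes _) (no _)  = refl
  both x S (no _)  (yes _) = refl
  both x S (no _)  (no _)  = refl
  fibre : ∀ S → 𝟙 (isCopy? H G S) * automorphisms H ≡ parametrisations H G S
  fibre S with isCopy? H G S
  ... | yes c = let φ , e , sp = copy⇒emb H G S c in trans (*-identityˡ _)
    (≤-antisym (parametrisations-≥ H G S φ e sp) (parametrisations-≤ H G S φ e sp))
  ... | no ¬c = sym (trans (∑V-cong m λ x → 𝟙-no (parametrises? H G S x)
      λ { (e , refl) → ¬c (emb⇒copy H G (lookup x) (image H (lookup x)) e (image-spans H (lookup x))) })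
    (trans (∑V-const m 0) (*-zeroʳ (n ^ m))))

automorphisms-pos : ∀ {m} (H : Graph m) → 0 < automorphisms H
automorphisms-pos {m} H = ≤-trans (≤-reflexive (sym (trans (∑V-δ m ids _) (𝟙-yes (parametrises? H H (image H id) ids) witness))))
  (∑V-mono m λ x → ≤-trans (*-monoˡ-≤ _ (𝟙≤1 (x ≟ᵛ ids))) (≤-reflexive (*-identityˡ _)))
  where
  ids : Vec (Fin m) m
  ids = tabulateᵛ id
  e : ∀ i → i ≡ lookup ids i
  e i = sym (lookup∘tabulate id i)
  witness : Parametrises H H (image H id) ids
  witness = emb-≗ H H e ((λ i j q → q) , λ i j a → a) ,
    spans-unique H (lookup ids) (image H id) _ (spans-≗ H (image H id) e (image-spans H id)) (image-spans H (lookup ids))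

𝓝-mono : ∀ {m n} (H : Graph m) (G G′ : Graph n) → embCount H G ≤ embCount H G′ → 𝓝 H G ≤ 𝓝 H G′
𝓝-mono H G G′ le = *-cancelʳ-≤ _ _ (automorphisms H) {{>-nonZero (automorphisms-pos H)}}
  (subst₂ _≤_ (sym (copies-automorphisms H G)) (sym (copies-automorphisms H G′)) le)

-- Linear forests

-- Recursive in the flags rather than expressed through `toℕ`, so that it matches `hom` clause by
-- clause.
Step : ∀ {m} → Vec Bool m → Fin (suc m) → Fin (suc m) → Set
Step []       _       _             = ⊥
Step (b ∷ bs) zero    zero          = ⊥
Step (b ∷ bs) zero    (suc zero)    = b ≡ true
Step (b ∷ bs) zero    (suc (suc _)) = ⊥
Step (b ∷ bs) (suc i) zero          = ⊥
Step (b ∷ bs) (suc i) (suc j)       = Step bs i j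

step? : ∀ {m} (bs : Vec Bool m) i j → Dec (Step bs i j)
step? []       _       _             = no λ ()
step? (b ∷ bs) zero    zero          = no λ ()
step? (b ∷ bs) zero    (suc zero)    = b Boolₚ.≟ true
step? (b ∷ bs) zero    (suc (suc _)) = no λ ()
step? (b ∷ bs) (suc i) zero          = no λ ()
step? (b ∷ bs) (suc i) (suc j)       = step? bs i j

step-irrefl : ∀ {m} (bs : Vec Bool m) i → ¬ Step bs i i
step-irrefl (b ∷ bs) (suc i) s = step-irrefl bs i s

forest : ∀ {m} → Vec Bool m → Graph (suc m)
forest bs = record
  { Adj    = λ i j → Step bs i j ⊎ Step bs j i
  ; adj?   = λ i j → step? bs i j ⊎-dec step? bs j i
  ; symm   = λ { (inj₁ s) → inj₂ s ; (inj₂ s) → inj₁ s }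
  ; irrefl = λ { (inj₁ s) → step-irrefl bs _ s ; (inj₂ s) → step-irrefl bs _ s }
  }

occ-zero⁺ : ∀ {n m} v (x : Vec (Fin n) m) → (∀ i → lookup x i ≢ v) → occ v x ≡ 0
occ-zero⁺ v []       h = refl
occ-zero⁺ v (x ∷ xs) h = cong₂ _+_ (𝟙-no (x ≟ v) (h zero)) (occ-zero⁺ v xs (h ∘ suc))

occ-pos : ∀ {n m} (x : Vec (Fin n) m) i → 0 < occ (lookup x i) x
occ-pos (x ∷ xs) zero    = ≤-trans (≤-reflexive (sym (𝟙-yes (x ≟ x) refl))) (m≤m+n _ _)
occ-pos (x ∷ xs) (suc i) = ≤-trans (occ-pos xs i) (m≤n+m _ _)

distinct⁺ : ∀ {n m} (x : Vec (Fin n) m) → (∀ i j → lookup x i ≡ lookup x j → i ≡ j) → distinct x ≡ 1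
distinct⁺ []       inj = refl
distinct⁺ (x ∷ xs) inj
  rewrite occ-zero⁺ x xs (λ i e → 0≢1+n (sym (cong toℕ (inj (suc i) zero e)))) =
  trans (+-identityʳ _) (distinct⁺ xs λ i j e → suc-injective (inj (suc i) (suc j) e))

distinct⁻ : ∀ {n m} (x : Vec (Fin n) m) → 0 < distinct x → ∀ i j → lookup x i ≡ lookup x j → i ≡ j
distinct⁻ (x ∷ xs) pos i j e with occ x xs in eq
distinct⁻ (x ∷ xs) pos zero    zero    e | zero = refl
distinct⁻ (x ∷ xs) pos zero    (suc j) refl | zero = ⊥-elim (<-irrefl (sym eq) (occ-pos xs j))
distinct⁻ (x ∷ xs) pos (suc i) zero    refl | zero = ⊥-elim (<-irrefl (sym eq) (occ-pos xs i))
distinct⁻ (x ∷ xs) pos (suc i) (suc j) e | zero = cong suc (distinct⁻ xs (subst (0 <_) (+-identityʳ _) pos) i j e)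

hom⁺ : ∀ {n m} (G : Graph n) (bs : Vec Bool m) x → (∀ i j → Step bs i j → Adj G (lookup x i) (lookup x j)) → hom G bs x ≡ 1
hom⁺ G []           x            h = refl
hom⁺ G (true ∷ bs)  (x ∷ y ∷ xs) h = cong₂ _*_ (𝟙-yes (adj? G x y) (h zero (suc zero) refl)) (hom⁺ G bs (y ∷ xs) λ i j → h (suc i) (suc j))
hom⁺ G (false ∷ bs) (x ∷ y ∷ xs) h = trans (+-identityʳ _) (hom⁺ G bs (y ∷ xs) λ i j → h (suc i) (suc j))

hom⁻ : ∀ {n m} (G : Graph n) (bs : Vec Bool m) x → 0 < hom G bs x → ∀ i j → Step bs i j → Adj G (lookup x i) (lookup x j)
hom⁻ G (true ∷ bs) (x ∷ y ∷ xs) pos i j s with adj? G x y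
hom⁻ G (true ∷ bs) (x ∷ y ∷ xs) pos zero    (suc zero) refl | yes a = a
hom⁻ G (true ∷ bs) (x ∷ y ∷ xs) pos (suc i) (suc j)    s    | yes a = hom⁻ G bs (y ∷ xs) (subst (0 <_) (+-identityʳ _) pos) i j s
hom⁻ G (false ∷ bs) (x ∷ y ∷ xs) pos zero    zero          ()
hom⁻ G (false ∷ bs) (x ∷ y ∷ xs) pos zero    (suc zero)    ()
hom⁻ G (false ∷ bs) (x ∷ y ∷ xs) pos zero    (suc (suc j)) ()
hom⁻ G (false ∷ bs) (x ∷ y ∷ xs) pos (suc i) zero          ()
hom⁻ G (false ∷ bs) (x ∷ y ∷ xs) pos (suc i) (suc j)       s = hom⁻ G bs (y ∷ xs) (subst (0 <_) (+-identityʳ _) pos) i j s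

embCount-forest : ∀ {n m} (G : Graph n) (bs : Vec Bool m) → embCount (forest bs) G ≡ emb G bs
embCount-forest {m = m} G bs = ∑V-cong (suc m) same
  where
  same : ∀ x → 𝟙 (isEmb? (forest bs) G (lookup x)) ≡ distinct x * hom G bs x
  same x = by-cases (isEmb? (forest bs) G (lookup x))
    where
    by-cases : (d : Dec (IsEmb (forest bs) G (lookup x))) → 𝟙 d ≡ distinct x * hom G bs x
    by-cases (yes (inj , h)) = sym (cong₂ _*_ (distinct⁺ x inj) (hom⁺ G bs x λ i j s → h i j (inj₁ s)))
    by-cases (no ¬e) with distinct x in eq | hom G bs x in eq′
    ... | zero  | _     = refl
    ... | suc d | zero  = sym (*-zeroʳ (suc d))
    ... | suc d | suc _ = ⊥-elim (¬e (distinct⁻ x (subst (0 <_) (sym eq) (s≤s z≤n)) ,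
      λ { i j (inj₁ s) → hom⁻ G bs x (subst (0 <_) (sym eq′) (s≤s z≤n)) i j s
        ; i j (inj₂ s) → symm G (hom⁻ G bs x (subst (0 <_) (sym eq′) (s≤s z≤n)) j i s) }))

-- Listing the vertices of a linear forest, one component after another

record Listing {h} (H : Graph h) : Set where
  field
    {len}  : ℕ
    flags  : Vec Bool len
    verts  : Vec (Fin h) (suc len)
    unique : ∀ i j → lookup verts i ≡ lookup verts j → i ≡ j
    adj⇔   : ∀ i j → Adj H (lookup verts i) (lookup verts j) ⇔ Adj (forest flags) i j

open Listing

-- m flags encode m + 1 vertices, so a listing is never empty; `Maybe` supplies the empty start for
-- `cover`.
Listed : ∀ {h} {H : Graph h} → Maybe (Listing H) → Fin h → Set
Listed nothing  v = ⊥
Listed (just L) v = ∃[ i ] lookup (verts L) i ≡ v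

listed? : ∀ {h} {H : Graph h} (L : Maybe (Listing H)) v → Dec (Listed L v)
listed? nothing  v = no λ ()
listed? (just L) v = any? λ i → lookup (verts L) i ≟ v

module _ {h} {H : Graph h} where

  open Equivalence

  single : Fin h → Listing H
  single v = record
    { flags  = []
    ; verts  = v ∷ []
    ; unique = λ { zero zero _ → refl }
    ; adj⇔   = λ { zero zero → mk⇔ (λ a → ⊥-elim (irrefl H a)) (λ { (inj₁ ()) ; (inj₂ ()) }) }
    }

  cons : (v : Fin h) (b : Bool) (L : Listing H) → ¬ Listed (just L) v →
    (∀ j → Adj H v (lookup (verts L) j) ⇔ (j ≡ zero × b ≡ true)) → Listing H
  cons v b L v∉ near = record { flags = b ∷ flags L ; verts = v ∷ verts L ; unique = uniq ; adj⇔ = adj }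
    where
    uniq : ∀ i j → lookup (v ∷ verts L) i ≡ lookup (v ∷ verts L) j → i ≡ j
    uniq zero    zero    _ = refl
    uniq zero    (suc j) e = ⊥-elim (v∉ (j , sym e))
    uniq (suc i) zero    e = ⊥-elim (v∉ (i , e))
    uniq (suc i) (suc j) e = cong suc (unique L i j e)
    first : ∀ j → Adj H v (lookup (verts L) j) → Step (b ∷ flags L) zero (suc j)
    first j a with to (near j) a
    ... | refl , refl = refl
    first⁻ : ∀ j → Step (b ∷ flags L) zero (suc j) → Adj H v (lookup (verts L) j)
    first⁻ zero e = from (near zero) (refl , e)
    adj : ∀ i j → Adj H (lookup (v ∷ verts L) i) (lookup (v ∷ verts L) j) ⇔ Adj (forest (b ∷ flags L)) i j
    adj zero    zero    = mk⇔ (λ a → ⊥-elim (irrefl H a)) (λ { (inj₁ ()) ; (inj₂ ()) })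
    adj zero    (suc j) = mk⇔ (inj₁ ∘ first j) (λ { (inj₁ s) → first⁻ j s ; (inj₂ ()) })
    adj (suc i) zero    = mk⇔ (inj₂ ∘ first i ∘ symm H) (λ { (inj₁ ()) ; (inj₂ s) → symm H (first⁻ i s) })
    adj (suc i) (suc j) = adj⇔ L i j

  -- The listed vertices form a union of components, so no edge leads to a vertex still to be listed
  -- and the flag between two components can be `false`.
  Closed : Maybe (Listing H) → Set
  Closed L = ∀ {v w} → Listed L v → Adj H v w → Listed L w

  module AddComponent (L : Maybe (Listing H)) (closed : Closed L) (v : Fin h) (v∉L : ¬ Listed L v)
    (ℓ : ℕ) (φ : Fin (suc ℓ) → Fin h) (φ-inj : ∀ {i j} → φ i ≡ φ j → i ≡ j)
    (onto : ∀ w → Star (Adj H) v w ⇔ (∃[ i ] φ i ≡ w)) (edges : ∀ i j → Adj (path (suc ℓ)) i j ⇔ Adj H (φ i) (φ j)) where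

    reach-back : ∀ {u w} → Star (Adj H) u w → Listed L w → Listed L u
    reach-back ε        w∈ = w∈
    reach-back (a ◅ as) w∈ = closed (reach-back as w∈) (symm H a)

    φ∉L : ∀ i → ¬ Listed L (φ i)
    φ∉L i φ∈ = v∉L (reach-back (from (onto (φ i)) (i , refl)) φ∈)

    -- Listings grow at the head, so the path is put in front of `L` from its last vertex back to
    -- its first; at stage `i` the vertices from φ i onwards are in place.
    record From (i : Fin (suc ℓ)) : Set where
      field
        list    : Listing H
        head≡   : lookup (verts list) zero ≡ φ i
        members : ∀ w → Listed (just list) w → (∃[ j ] (toℕ i ≤ toℕ j × φ j ≡ w)) ⊎ Listed L w
        new     : ∀ j → toℕ i ≤ toℕ j → Listed (just list) (φ j)
        old     : ∀ w → Listed L w → Listed (just list) w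

    open From

    last : From (fromℕ ℓ)
    last = start L refl
      where
      start : ∀ L′ → L′ ≡ L → From (fromℕ ℓ)
      start nothing refl = record
        { list = single (φ (fromℕ ℓ)) ; head≡ = refl
        ; members = λ { w (zero , e) → inj₁ (fromℕ ℓ , ≤-refl , e) }
        ; new = λ j le → zero , cong φ (toℕ-injective (≤-antisym le (≤-trans (toℕ≤pred[n] j) (≤-reflexive (sym (toℕ-fromℕ ℓ))))))
        ; old = λ _ () }
      start (just L₁) refl = record
        { list = cons (φ (fromℕ ℓ)) false L₁ (φ∉L (fromℕ ℓ))
            (λ j → mk⇔ (λ a → ⊥-elim (φ∉L (fromℕ ℓ) (closed (j , refl) (symm H a)))) (λ ()))
        ; head≡ = refl
        ; members = λ { w (zero , e) → inj₁ (fromℕ ℓ , ≤-refl , e) ; w (suc i , e) → inj₂ (i , e) }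
        ; new = λ j le → zero , cong φ (toℕ-injective (≤-antisym le (≤-trans (toℕ≤pred[n] j) (≤-reflexive (sym (toℕ-fromℕ ℓ))))))
        ; old = λ { w (i , e) → suc i , e } }

    step : ∀ i → From (suc i) → From (inject₁ i)
    step i P = record
      { list = cons x true (list P) x∉ near
      ; head≡ = refl
      ; members = λ { w (zero , e) → inj₁ (inject₁ i , ≤-refl , e) ; w (suc j , e) → weaken (members P w (j , e)) }
      ; new = new′
      ; old = λ w w∈ → let j , e = old P w w∈ in suc j , e }
      where
      x = φ (inject₁ i)
      weaken : ∀ {w} → (∃[ j ] (suc (toℕ i) ≤ toℕ j × φ j ≡ w)) ⊎ Listed L w → (∃[ j ] (toℕ (inject₁ i) ≤ toℕ j × φ j ≡ w)) ⊎ Listed L w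
      weaken (inj₁ (j , le , e)) = inj₁ (j , ≤-trans (≤-reflexive (toℕ-inject₁ i)) (<⇒≤ le) , e)
      weaken (inj₂ w∈) = inj₂ w∈
      x∉ : ¬ Listed (just (list P)) x
      x∉ x∈ with members P x x∈
      ... | inj₂ x∈L = φ∉L (inject₁ i) x∈L
      ... | inj₁ (j , le , e) = <-irrefl (trans (sym (toℕ-inject₁ i)) (cong toℕ (sym (φ-inj e)))) le
      near : ∀ j → Adj H x (lookup (verts (list P)) j) ⇔ (j ≡ zero × true ≡ true)
      near j = mk⇔ forth back
        where
        forth : Adj H x (lookup (verts (list P)) j) → j ≡ zero × true ≡ true
        forth a with members P _ (j , refl)
        ... | inj₂ y∈L = ⊥-elim (φ∉L (inject₁ i) (closed y∈L (symm H a)))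
        ... | inj₁ (j′ , le , e) with from (edges (inject₁ i) j′) (subst (Adj H x) (sym e) a)
        ...   | inj₁ q = unique (list P) j zero (trans (sym e) (trans (cong φ (toℕ-injective (trans q (cong suc (toℕ-inject₁ i))))) (sym (head≡ P)))) , refl
        ...   | inj₂ q = ⊥-elim (<-asym le (≤-reflexive (trans (sym q) (toℕ-inject₁ i))))
        back : j ≡ zero × true ≡ true → Adj H x (lookup (verts (list P)) j)
        back (refl , _) = subst (Adj H x) (sym (head≡ P)) (to (edges (inject₁ i) (suc i)) (inj₁ (cong suc (sym (toℕ-inject₁ i)))))
      new′ : ∀ j → toℕ (inject₁ i) ≤ toℕ j → Listed (just (cons x true (list P) x∉ near)) (φ j)
      new′ j le with j ≟ inject₁ i
      ... | yes refl = zero , refl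
      ... | no ne = let j′ , e = new P j (≤∧≢⇒< (≤-trans (≤-reflexive (sym (toℕ-inject₁ i))) le) (λ q → ne (toℕ-injective (trans (sym q) (sym (toℕ-inject₁ i)))))) in suc j′ , e

    all : From zero
    all = >-weakInduction From last step zero

    all-closed : Closed (just (list all))
    all-closed {w} {w′} w∈ a with members all w w∈
    ... | inj₂ w∈L = old all w′ (closed w∈L a)
    ... | inj₁ (j , _ , refl) with to (onto w′) (from (onto (φ j)) (j , refl) ◅◅ (a ◅ ε))
    ...   | j′ , refl = new all j′ z≤n

    all-v : Listed (just (list all)) v
    all-v with to (onto v) ε
    ... | j , refl = new all j z≤n

  cover : LinearForest H → (vs : List (Fin h)) →
    Σ[ L ∈ Maybe (Listing H) ] (Closed L × (∀ {v} → v ∈ᴸ vs → Listed L v))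
  cover lf [] = nothing , (λ ()) , λ ()
  cover lf (v ∷ vs) with cover lf vs
  ... | L , closed , covers with listed? L v
  ...   | yes v∈ = L , closed , λ { (here refl) → v∈ ; (there w∈) → covers w∈ }
  ...   | no v∉ with lf v
  -- The component of `v` contains `v`, so its path is not empty.
  ...     | zero , mkIso φ inj onto edges with to (onto v) ε
  ...       | () , _
  cover lf (v ∷ vs) | L , closed , covers | no v∉ | suc ℓ , mkIso φ inj onto edges =
    just (From.list all) , all-closed , λ { (here refl) → all-v ; (there w∈) → From.old all _ (covers w∈) }
    where open AddComponent L closed v v∉ ℓ φ inj onto edges

𝓝-listing : ∀ {h n} (H : Graph h) (L : Listing H) → (∀ v → Listed (just L) v) → (G : Graph n) → 𝓝 H G ≡ 𝓝 (forest (flags L)) G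
𝓝-listing {n = n} H L covers G = trans (∑L-filter (isCopy? H G) (allSubgraphData n))
  (trans (∑L-cong (λ S → 𝟙-cong (isCopy? H G S) (isCopy? T G S) (forth S) (back S)) (allSubgraphData n))
    (sym (∑L-filter (isCopy? T G) (allSubgraphData n))))
  where
  open Equivalence
  T = forest (flags L)
  π = lookup (verts L)
  π⁻ : Fin _ → Fin _
  π⁻ v = proj₁ (covers v)
  ππ⁻ : ∀ v → π (π⁻ v) ≡ v
  ππ⁻ v = proj₂ (covers v)
  forth : ∀ S → IsCopy H G S → IsCopy T G S
  forth S c with copy⇒emb H G S c
  ... | φ , (inj , hm) , vs , es = emb⇒copy T G (φ ∘ π) S
    ((λ i j e → unique L i j (inj _ _ e)) , λ i j a → hm _ _ (from (adj⇔ L i j) a))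
    ((λ v → mk⇔ (λ h → let i , e = to (vs v) h in π⁻ i , trans (cong φ (ππ⁻ i)) e) (λ (i , e) → from (vs v) (π i , e))) ,
     (λ u v → mk⇔
       (λ h → let i , j , p , q , a = to (es u v) h in π⁻ i , π⁻ j , trans (cong φ (ππ⁻ i)) p , trans (cong φ (ππ⁻ j)) q ,
                to (adj⇔ L _ _) (subst₂ (Adj H) (sym (ππ⁻ i)) (sym (ππ⁻ j)) a))
       (λ (i , j , p , q , a) → from (es u v) (π i , π j , p , q , from (adj⇔ L i j) a))))
  back : ∀ S → IsCopy T G S → IsCopy H G S
  back S c with copy⇒emb T G S c
  ... | φ , (inj , hm) , vs , es = emb⇒copy H G (φ ∘ π⁻) S
    ((λ i j e → trans (sym (ππ⁻ i)) (trans (cong π (inj _ _ e)) (ππ⁻ j))) ,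
     λ i j a → hm _ _ (to (adj⇔ L _ _) (subst₂ (Adj H) (sym (ππ⁻ i)) (sym (ππ⁻ j)) a)))
    ((λ v → mk⇔ (λ h → let i , e = to (vs v) h in π i , trans (cong φ (π⁻π i)) e) (λ (i , e) → from (vs v) (π⁻ i , e))) ,
     (λ u v → mk⇔
       (λ h → let i , j , p , q , a = to (es u v) h in π i , π j , trans (cong φ (π⁻π i)) p , trans (cong φ (π⁻π j)) q , from (adj⇔ L i j) a)
       (λ (i , j , p , q , a) → from (es u v) (π⁻ i , π⁻ j , p , q , to (adj⇔ L _ _) (subst₂ (Adj H) (sym (ππ⁻ i)) (sym (ππ⁻ j)) a)))))
    where
    π⁻π : ∀ i → π⁻ (π i) ≡ i
    π⁻π i = unique L _ _ (ππ⁻ (π i))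

-- A linear forest without vertices has no flags, hence the first alternative.
𝓝-linearForest : ∀ {h} (H : Graph h) → LinearForest H →
  (∀ {n} (G G′ : Graph n) → 𝓝 H G ≤ 𝓝 H G′) ⊎
  (∃[ m ] Σ[ bs ∈ Vec Bool m ] (∀ {n} (G G′ : Graph n) → emb G bs ≤ emb G′ bs → 𝓝 H G ≤ 𝓝 H G′))
𝓝-linearForest {zero} H lf = inj₁ λ G G′ → 𝓝-mono H G G′ (𝟙-mono (isEmb? H G (lookup [])) (isEmb? H G′ (lookup [])) (λ _ → (λ ()) , λ ()))
𝓝-linearForest {suc h} H lf with cover lf (allFin (suc h))
... | nothing , _ , covers = ⊥-elim (covers (∈-allFin zero))
... | just L , _ , covers = inj₂ (len L , flags L , λ G G′ le →
  subst₂ _≤_ (sym (𝓝-listing H L all-listed G)) (sym (𝓝-listing H L all-listed G′))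
    (𝓝-mono (forest (flags L)) G G′ (subst₂ _≤_ (sym (embCount-forest G (flags L))) (sym (embCount-forest G′ (flags L))) le)))
  where
  all-listed : ∀ v → Listed (just L) v
  all-listed v = covers (∈-allFin v)

-- Colour-critical edges and the weighted Turán bound

-- The form in which the critical edge is used: a colouring with one colour fewer than χ(F) that
-- fails at this edge only.
record Critical {f} (F : Graph f) (k : ℕ) : Set where
  field
    e₁ e₂  : Fin f
    edge   : Adj F e₁ e₂
    col    : Fin f → Fin k
    same   : col e₁ ≡ col e₂
    proper : ∀ i j → Adj F i j → ¬ ((i ≡ e₁ × j ≡ e₂) ⊎ (i ≡ e₂ × j ≡ e₁)) → col i ≢ col j

-- Deleting the edge brings the chromatic number down to at most k. If its ends then had different
-- colours, F itself would be k-colourable.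
critical : ∀ {f} (F : Graph f) k → HasColorCriticalEdge F → χ[ F ]≡ suc k → Critical F k
critical F k (u , v , uv , c , d , (_ , c-min) , ((col , proper) , _) , d<c) (colF , k-min) = record
  { e₁ = u ; e₂ = v ; edge = uv ; col = col′ ; same = same ; proper = λ i j a ne → proper′ i j (a , ne) }
  where
  d≤k : d ≤ k
  d≤k = ≤-pred (≤-trans d<c (c-min (suc k) colF))
  col′ : Fin _ → Fin k
  col′ i = inject≤ (col i) d≤k
  proper′ : ∀ i j → Adj (deleteEdge F u v) i j → col′ i ≢ col′ j
  proper′ i j a e = proper i j a (inject≤-injective d≤k d≤k (col i) (col j) e)
  same : col′ u ≡ col′ v
  same with col′ u ≟ col′ v
  ... | yes e = e
  ... | no ne = ⊥-elim (<⇒≱ (n<1+n k) (k-min k (col′ , good)))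
    where
    good : ∀ i j → Adj F i j → col′ i ≢ col′ j
    good i j a with ((i ≟ u) ×-dec (j ≟ v)) ⊎-dec ((i ≟ v) ×-dec (j ≟ u))
    ... | yes (inj₁ (refl , refl)) = ne
    ... | yes (inj₂ (refl , refl)) = ne ∘ sym
    ... | no other = proper′ i j (a , other)

module Embedding {f k} {F : Graph f} (C : Critical F k) where

  open Critical C

  -- F is placed by colours, with the colour of the critical edge moved to part i and the ends of
  -- that edge sent to x and y. Other vertices of this colour are adjacent to neither end, so x and
  -- y need only see the other parts. Parts have f vertices, so vertex w takes slot w and no two
  -- clash.
  edge-embeds : ∀ {n} {G : Graph n} {S} (i : Fin k) (B : Blowup G S k f) (x y : Fin n) → Adj G x y →
    (∀ j → j ≢ i → ∀ w → Adj G x (part B j w)) → (∀ j → j ≢ i → ∀ w → Adj G y (part B j w)) →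
    (∀ w → part B i w ≢ x) → (∀ w → part B i w ≢ y) → ∃[ φ ] IsEmb F G φ
  edge-embeds {n} {G} i B x y xy xB yB x∉ y∉ = φ , inj , hm
    where
    swap : Fin k → Fin k
    swap j with j ≟ col e₁ | j ≟ i
    ... | yes _ | _     = i
    ... | no _  | yes _ = col e₁
    ... | no _  | no _  = j
    swap-i : ∀ {j} → j ≡ col e₁ → swap j ≡ i
    swap-i {j} e with j ≟ col e₁
    ... | yes _ = refl
    ... | no ne = ⊥-elim (ne e)
    swap-≢i : ∀ {j} → j ≢ col e₁ → swap j ≢ i
    swap-≢i {j} ne with j ≟ col e₁ | j ≟ i
    ... | yes e | _     = ⊥-elim (ne e)
    ... | no _  | yes refl = ne ∘ sym
    ... | no _  | no q  = q
    swap-inj : ∀ {j j′} → swap j ≡ swap j′ → j ≡ j′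
    swap-inj {j} {j′} e with j ≟ col e₁ | j ≟ i | j′ ≟ col e₁ | j′ ≟ i
    ... | yes p | _     | yes q | _     = trans p (sym q)
    ... | yes p | _     | no q  | yes r = ⊥-elim (q (trans r e))
    ... | yes p | _     | no q  | no r  = ⊥-elim (r (sym e))
    ... | no p  | yes r | yes q | _     = ⊥-elim (p (trans r (sym e)))
    ... | no p  | yes r | no q  | yes s = trans r (sym s)
    ... | no p  | yes r | no q  | no s  = ⊥-elim (q (sym e))
    ... | no p  | no r  | yes q | _     = ⊥-elim (r e)
    ... | no p  | no r  | no q  | yes s = ⊥-elim (p e)
    ... | no p  | no r  | no q  | no s  = e
    b : Fin f → Fin n
    b w = part B (swap (col w)) w
    φ : Fin f → Fin n
    φ w with w ≟ e₁ | w ≟ e₂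
    ... | yes _ | _     = x
    ... | no _  | yes _ = y
    ... | no _  | no _  = b w
    View : Fin f → Set
    View w = (w ≡ e₁ × φ w ≡ x) ⊎ (w ≡ e₂ × φ w ≡ y) ⊎ (w ≢ e₁ × w ≢ e₂ × φ w ≡ b w)
    view : ∀ w → View w
    view w with w ≟ e₁ | w ≟ e₂
    ... | yes p | _     = inj₁ (p , refl)
    ... | no _  | yes p = inj₂ (inj₁ (p , refl))
    ... | no p  | no q  = inj₂ (inj₂ (p , q , refl))
    b≢ : ∀ {z} → (∀ j → j ≢ i → ∀ w → Adj G z (part B j w)) → (∀ w → part B i w ≢ z) → ∀ w → b w ≢ z
    b≢ {z} zB z∉ w e = cases (col w ≟ col e₁)
      where
      cases : Dec (col w ≡ col e₁) → ⊥
      cases (yes p) = z∉ w (subst (λ j → part B j w ≡ z) (swap-i p) e)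
      cases (no p)  = irrefl G (subst (Adj G z) e (zB (swap (col w)) (swap-≢i p) w))
    inj : ∀ w w′ → φ w ≡ φ w′ → w ≡ w′
    inj w w′ e = cases (view w) (view w′)
      where
      cases : View w → View w′ → w ≡ w′
      cases (inj₁ (p , _)) (inj₁ (q , _)) = trans p (sym q)
      cases (inj₁ (_ , p)) (inj₂ (inj₁ (_ , q))) = ⊥-elim (irrefl G (subst (Adj G x) (trans (sym q) (trans (sym e) p)) xy))
      cases (inj₁ (_ , p)) (inj₂ (inj₂ (_ , _ , q))) = ⊥-elim (b≢ xB x∉ w′ (trans (sym q) (trans (sym e) p)))
      cases (inj₂ (inj₁ (_ , p))) (inj₁ (_ , q)) = ⊥-elim (irrefl G (subst (Adj G x) (trans (sym p) (trans e q)) xy))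
      cases (inj₂ (inj₁ (p , _))) (inj₂ (inj₁ (q , _))) = trans p (sym q)
      cases (inj₂ (inj₁ (_ , p))) (inj₂ (inj₂ (_ , _ , q))) = ⊥-elim (b≢ yB y∉ w′ (trans (sym q) (trans (sym e) p)))
      cases (inj₂ (inj₂ (_ , _ , p))) (inj₁ (_ , q)) = ⊥-elim (b≢ xB x∉ w (trans (sym p) (trans e q)))
      cases (inj₂ (inj₂ (_ , _ , p))) (inj₂ (inj₁ (_ , q))) = ⊥-elim (b≢ yB y∉ w (trans (sym p) (trans e q)))
      cases (inj₂ (inj₂ (_ , _ , p))) (inj₂ (inj₂ (_ , _ , q))) with col w ≟ col w′
      ... | yes r = injective B (swap (col w′)) (trans (cong (λ c → part B (swap c) w) (sym r)) (trans (sym p) (trans e q)))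
      ... | no r  = ⊥-elim (irrefl G (subst (Adj G (b w)) (trans (sym q) (trans (sym e) p)) (joined B (r ∘ swap-inj) w w′)))
    to-x : ∀ {w} → Adj F e₁ w → w ≢ e₂ → Adj G x (b w)
    to-x {w} a w≢ = xB _ (swap-≢i (proper e₁ w a (λ { (inj₁ (_ , q)) → w≢ q ; (inj₂ (p , q)) → irrefl F (subst (Adj F e₁) q a) }) ∘ sym)) w
    to-y : ∀ {w} → Adj F e₂ w → w ≢ e₁ → Adj G y (b w)
    to-y {w} a w≢ = yB _ (swap-≢i (λ e → proper e₂ w a (λ { (inj₁ (p , q)) → irrefl F (subst (Adj F e₂) q a) ; (inj₂ (_ , q)) → w≢ q }) (trans (sym same) (sym e)))) w
    hm : ∀ w w′ → Adj F w w′ → Adj G (φ w) (φ w′)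
    hm w w′ a = cases (view w) (view w′)
      where
      conclude : ∀ {p q} → φ w ≡ p → φ w′ ≡ q → Adj G p q → Adj G (φ w) (φ w′)
      conclude p q = subst₂ (Adj G) (sym p) (sym q)
      cases : View w → View w′ → Adj G (φ w) (φ w′)
      cases (inj₁ (refl , _)) (inj₁ (refl , _)) = ⊥-elim (irrefl F a)
      cases (inj₁ (_ , p)) (inj₂ (inj₁ (_ , q))) = conclude p q xy
      cases (inj₁ (refl , p)) (inj₂ (inj₂ (_ , ne , q))) = conclude p q (to-x a ne)
      cases (inj₂ (inj₁ (_ , p))) (inj₁ (_ , q)) = conclude p q (symm G xy)
      cases (inj₂ (inj₁ (refl , _))) (inj₂ (inj₁ (refl , _))) = ⊥-elim (irrefl F a)
      cases (inj₂ (inj₁ (refl , p))) (inj₂ (inj₂ (ne , _ , q))) = conclude p q (to-y a ne)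
      cases (inj₂ (inj₂ (_ , ne , p))) (inj₁ (refl , q)) = conclude p q (symm G (to-x (symm F a) ne))
      cases (inj₂ (inj₂ (ne , _ , p))) (inj₂ (inj₁ (refl , q))) = conclude p q (symm G (to-y (symm F a) ne))
      cases (inj₂ (inj₂ (ne₁ , ne₂ , p))) (inj₂ (inj₂ (_ , _ , q))) = conclude p q
        (joined B (proper w w′ a (λ { (inj₁ (r , _)) → ne₁ r ; (inj₂ (r , _)) → ne₂ r }) ∘ swap-inj) w w′)

  -- Slot 0 of the part with the critical colour serves as the second end of the critical edge,
  -- whence parts of f + 1 vertices.
  apex-embeds : ∀ {n} {G : Graph n} {S} (B : Blowup G S k (suc f)) x → (∀ j w → Adj G x (part B j w)) → ∃[ φ ] IsEmb F G φ
  apex-embeds {G = G} {S} B x xB = edge-embeds (col e₁) B′ x (part B (col e₁) zero) (xB (col e₁) zero)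
    (λ j _ w → xB j (suc w)) (λ j ne w → joined B (ne ∘ sym) zero (suc w))
    (λ w e → irrefl G (subst (Adj G x) e (xB (col e₁) (suc w))))
    (λ w e → 0≢1+n (sym (cong toℕ (injective B (col e₁) e))))
    where
    B′ : Blowup G S k f
    B′ = record { part = λ j w → part B j (suc w) ; injective = λ j e → suc-injective (injective B j e)
                ; joined = λ ne x y → joined B ne (suc x) (suc y) ; inside = λ j w → inside B j (suc w) }

  clique-embeds : ∀ {n} {G : Graph n} {S} → Blowup G S (suc k) (suc f) → ∃[ φ ] IsEmb F G φ
  clique-embeds {G = G} {S} B = apex-embeds B′ (part B zero zero) (λ j w → joined B (λ ()) zero w)
    where
    B′ : Blowup G S k (suc f)
    B′ = record { part = part B ∘ suc ; injective = λ j → injective B (suc j)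
                ; joined = λ ne → joined B (ne ∘ suc-injective) ; inside = λ j → inside B (suc j) }

-- The weighted Turán bound, by removing vertices of small weighted degree

energy : ∀ {n} → Graph n → (Fin n → ℕ) → ℕ
energy G x = ∑ λ u → x u * wdeg G x u

module Peel {n} (G : Graph n) (N K M : ℕ) (1≤N : 1 ≤ N) (large : 2 * (N * K) ≤ n) where

  L = 4 * N

  -- `s` bounds the removals still possible. Each may cost n M², and the reserve `s * (n * (M * M))`
  -- pays for all of them in advance.
  Excess : ℕ → (Fin n → ℕ) → Set
  Excess s x = N * (K * (∑ x * ∑ x)) + s * (n * (M * M)) < N * (K * energy G x + ∑ x * ∑ x)

  -- Removing a vertex of weight y lowers the energy by 2yd. The violated degree condition,
  -- multiplied by 2yN, bounds this loss; beyond the main terms it leaves R, at most `L * τ`, which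
  -- one unit of the reserve covers.
  removal-arith : ∀ X y d E s → y ≤ M → L * (K * d + (X + y)) < L * (K * (X + y)) + n * M →
    N * (K * ((X + y) * (X + y))) + suc s * (n * (M * M)) < N * (K * (E + (y * d + y * d)) + (X + y) * (X + y)) →
    N * (K * (X * X)) + s * (n * (M * M)) < N * (K * E + X * X)
  removal-arith X y d E s y≤M viol exc = *-cancelˡ-< L _ _ (+-cancelʳ-< (R + C) _ _ (begin-strict
    L * (N * (K * (X * X)) + s * τ) + (R + C)                              ≤⟨ +-monoʳ-≤ (L * (N * (K * (X * X)) + s * τ)) (+-monoˡ-≤ C R≤) ⟩
    L * (N * (K * (X * X)) + s * τ) + (L * τ + C)                          ≤⟨ +-monoʳ-≤ (L * (N * (K * (X * X)) + s * τ)) (+-monoˡ-≤ C (m≤m+n (L * τ) (L * N * (y * y)))) ⟩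
    L * (N * (K * (X * X)) + s * τ) + (L * τ + L * N * (y * y) + C)        ≡⟨ lhs L N K X y s τ ⟩
    L * (N * (K * ((X + y) * (X + y))) + suc s * τ) + 2 * (y * N) * (L * (X + y))   <⟨ +-monoˡ-< _ (*-monoʳ-< L {{>-nonZero 1≤L}} exc) ⟩
    L * (N * (K * (E + (y * d + y * d)) + (X + y) * (X + y))) + 2 * (y * N) * (L * (X + y))   ≡⟨ mid L N K X y d E ⟩
    L * (N * (K * E + (X + y) * (X + y))) + 2 * (y * N) * (L * (K * d + (X + y)))   ≤⟨ +-monoʳ-≤ _ (*-monoʳ-≤ (2 * (y * N)) (<⇒≤ viol)) ⟩
    L * (N * (K * E + (X + y) * (X + y))) + 2 * (y * N) * (L * (K * (X + y)) + n * M)   ≡⟨ rhs L N K X y E (n * M) ⟩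
    L * (N * (K * E + X * X)) + (R + C)                                    ∎))
    where
    open ≤-Reasoning
    τ = n * (M * M)
    R = L * N * K * (y * y) + 2 * (y * N) * (n * M)
    C = L * N * K * (2 * (X * y) + y * y) + L * N * (2 * (X * y)) + L * N * (y * y)
    1≤L : 1 ≤ L
    1≤L = *-mono-≤ (s≤s (z≤n {3})) 1≤N
    lhs : ∀ L N K X y s τ → L * (N * (K * (X * X)) + s * τ) + (L * τ + L * N * (y * y) + (L * N * K * (2 * (X * y) + y * y) + L * N * (2 * (X * y)) + L * N * (y * y)))
      ≡ L * (N * (K * ((X + y) * (X + y))) + suc s * τ) + 2 * (y * N) * (L * (X + y))
    lhs = solve-∀
    mid : ∀ L N K X y d E → L * (N * (K * (E + (y * d + y * d)) + (X + y) * (X + y))) + 2 * (y * N) * (L * (X + y))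
      ≡ L * (N * (K * E + (X + y) * (X + y))) + 2 * (y * N) * (L * (K * d + (X + y)))
    mid = solve-∀
    rhs : ∀ L N K X y E z → L * (N * (K * E + (X + y) * (X + y))) + 2 * (y * N) * (L * (K * (X + y)) + z)
      ≡ L * (N * (K * E + X * X)) + (L * N * K * (y * y) + 2 * (y * N) * z + (L * N * K * (2 * (X * y) + y * y) + L * N * (2 * (X * y)) + L * N * (y * y)))
    rhs = solve-∀
    split₁ : ∀ N K M n → 4 * N * N * K * (M * M) + 2 * (M * N) * (n * M) ≡ 2 * N * (2 * (N * K)) * (M * M) + 2 * N * n * (M * M)
    split₁ = solve-∀
    split₂ : ∀ N M n → 2 * N * n * (M * M) + 2 * N * n * (M * M) ≡ 4 * N * (n * (M * M))
    split₂ = solve-∀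
    -- L = 4N comes from here: each of the two summands is at most 2NnM², the first one because 2NK
    -- ≤ n.
    R≤ : R ≤ L * τ
    R≤ = begin
      R                                                       ≤⟨ +-mono-≤ (*-monoʳ-≤ (L * N * K) (*-mono-≤ y≤M y≤M)) (*-monoˡ-≤ (n * M) (*-monoʳ-≤ 2 (*-monoˡ-≤ N y≤M))) ⟩
      L * N * K * (M * M) + 2 * (M * N) * (n * M)             ≡⟨ split₁ N K M n ⟩
      2 * N * (2 * (N * K)) * (M * M) + 2 * N * n * (M * M)   ≤⟨ +-monoˡ-≤ _ (*-monoˡ-≤ (M * M) (*-monoʳ-≤ (2 * N) large)) ⟩
      2 * N * n * (M * M) + 2 * N * n * (M * M)               ≡⟨ split₂ N M n ⟩
      L * τ                                                   ∎

  remove : (Fin n → ℕ) → Fin n → Fin n → ℕ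
  remove x v u = (1 ∸ 𝟙 (u ≟ v)) * x u

  module _ (x : Fin n → ℕ) (v : Fin n) where

    x′ = remove x v
    y = x v

    remove-+ : ∀ u → x u ≡ x′ u + 𝟙 (u ≟ v) * y
    remove-+ u with u ≟ v
    ... | yes refl = sym (*-identityˡ _)
    ... | no _     = sym (trans (+-identityʳ _) (*-identityˡ _))

    remove-∑ : ∑ x ≡ ∑ x′ + y
    remove-∑ = trans (sum-cong-≗ remove-+) (trans (∑-distrib-+ x′ _) (cong (∑ x′ +_) (∑-δ v λ _ → y)))

    remove-wdeg : ∀ u → wdeg G x u ≡ wdeg G x′ u + A G u v * y
    remove-wdeg u = trans (sum-cong-≗ λ w → trans (cong (A G u w *_) (remove-+ w)) (distr (A G u w) (x′ w) (𝟙 (w ≟ v)) y))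
      (trans (∑-distrib-+ (λ w → A G u w * x′ w) _) (cong (wdeg G x′ u +_) (∑-δ v λ w → A G u w * y)))
      where
      distr : ∀ a p q y → a * (p + q * y) ≡ a * p + q * (a * y)
      distr = solve-∀

    remove-wdeg-v : wdeg G x v ≡ wdeg G x′ v
    remove-wdeg-v = trans (remove-wdeg v) (trans (cong (λ a → wdeg G x′ v + a * y) (𝟙-no (adj? G v v) (irrefl G))) (+-identityʳ _))

    remove-energy : energy G x ≡ energy G x′ + (y * wdeg G x v + y * wdeg G x v)
    remove-energy = begin
      ∑ (λ u → x u * wdeg G x u)
        ≡⟨ sum-cong-≗ (λ u → trans (cong (_* wdeg G x u) (remove-+ u)) (trans (*-distribʳ-+ (wdeg G x u) (x′ u) (𝟙 (u ≟ v) * y)) (cong₂ _+_ (cong (x′ u *_) (remove-wdeg u)) (*-assoc (𝟙 (u ≟ v)) y _)))) ⟩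
      ∑ (λ u → x′ u * (wdeg G x′ u + A G u v * y) + 𝟙 (u ≟ v) * (y * wdeg G x u))
        ≡⟨ trans (∑-distrib-+ (λ u → x′ u * (wdeg G x′ u + A G u v * y)) _) (cong₂ _+_ (trans (sum-cong-≗ λ u → distr (x′ u) (wdeg G x′ u) (A G u v) y) (∑-distrib-+ (λ u → x′ u * wdeg G x′ u) _)) (∑-δ v λ u → y * wdeg G x u)) ⟩
      energy G x′ + ∑ (λ u → y * (A G u v * x′ u)) + y * wdeg G x v
        ≡⟨ cong (λ t → energy G x′ + t + y * wdeg G x v) (trans (sym (*-distribˡ-sum y λ u → A G u v * x′ u)) (cong (y *_) (trans (sum-cong-≗ λ u → cong (_* x′ u) (A-sym G u v)) (sym remove-wdeg-v)))) ⟩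
      energy G x′ + y * wdeg G x v + y * wdeg G x v
        ≡⟨ +-assoc (energy G x′) _ _ ⟩
      energy G x′ + (y * wdeg G x v + y * wdeg G x v) ∎
      where
      open ≡-Reasoning
      distr : ∀ p w a y → p * (w + a * y) ≡ p * w + y * (a * p)
      distr = solve-∀

    remove≤ : ∀ u → x′ u ≤ x u
    remove≤ u = ≤-trans (m≤m+n (x′ u) _) (≤-reflexive (sym (remove-+ u)))

  support : (Fin n → ℕ) → ℕ
  support x = ∑ λ u → 𝟙 (0 <? x u)

  remove-support : ∀ x v → 0 < x v → suc (support (remove x v)) ≤ support x
  remove-support x v pos = begin
    suc (support (remove x v))                                          ≡⟨ +-comm 1 _ ⟩
    support (remove x v) + 1                                            ≡⟨ cong (support (remove x v) +_) (∑-δ v λ _ → 1) ⟨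
    support (remove x v) + ∑ (λ u → 𝟙 (u ≟ v) * 1)                      ≡⟨ ∑-distrib-+ (λ u → 𝟙 (0 <? remove x v u)) _ ⟨
    ∑ (λ u → 𝟙 (0 <? remove x v u) + 𝟙 (u ≟ v) * 1)                     ≤⟨ ∑-mono one ⟩
    support x                                                           ∎
    where
    open ≤-Reasoning
    one : ∀ u → 𝟙 (0 <? remove x v u) + 𝟙 (u ≟ v) * 1 ≤ 𝟙 (0 <? x u)
    one u with u ≟ v
    ... | yes refl = ≤-reflexive (sym (𝟙-yes (0 <? x u) pos))
    ... | no _     = ≤-reflexive (trans (+-identityʳ _) (𝟙-cong (0 <? 1 * x u) (0 <? x u) (subst (0 <_) (*-identityˡ _)) (subst (0 <_) (sym (*-identityˡ _)))))

  excess-pos : ∀ s x → Excess s x → 0 < ∑ x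
  excess-pos s x exc with 0 <? ∑ x
  ... | yes p = p
  ... | no np = ⊥-elim (<⇒≱ exc (≤-trans (≤-reflexive zero′) z≤n))
    where
    X0 : ∑ x ≡ 0
    X0 = n≤0⇒n≡0 (≮⇒≥ np)
    x0 : ∀ u → x u ≡ 0
    x0 u = n≤0⇒n≡0 (≤-trans (term≤∑ x u) (≤-reflexive X0))
    zero′ : N * (K * energy G x + ∑ x * ∑ x) ≡ 0
    zero′ = trans (cong₂ (λ e t → N * (K * e + t * t)) (∑-≡0 λ u → cong (_* wdeg G x u) (x0 u)) X0)
      (trans (cong (N *_) (trans (+-identityʳ _) (*-zeroʳ K))) (*-zeroʳ N))

  peel : ∀ s x → (∀ v → x v ≤ M) → support x ≤ s → Excess s x → Σ[ x′ ∈ (Fin n → ℕ) ] Dense G x′ K L M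
  peel s x le supp exc with any? (λ v → (0 <? x v) ×-dec (L * (K * wdeg G x v + ∑ x) <? L * (K * ∑ x) + n * M))
  ... | no none = x , record { bounded = le ; positive = excess-pos s x exc ; degrees = λ v pos → ≮⇒≥ λ lt → none (v , pos , lt) }
  peel zero x le supp exc | yes (v , pos , viol) = ⊥-elim (<⇒≱ (≤-trans (s≤s z≤n) (remove-support x v pos)) supp)
  peel (suc s) x le supp exc | yes (v , pos , viol) = peel s (remove x v) (λ u → ≤-trans (remove≤ x v u) (le u))
    (≤-pred (≤-trans (remove-support x v pos) supp))
    (removal-arith (∑ (remove x v)) (x v) (wdeg G x v) (energy G (remove x v)) s (le v)
      (subst (λ X → L * (K * wdeg G x v + X) < L * (K * X) + n * M) (remove-∑ x v) viol)
      (subst₂ (λ X E → N * (K * (X * X)) + suc s * (n * (M * M)) < N * (K * E + X * X)) (remove-∑ x v) (remove-energy x v) exc))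

-- A Motzkin-Straus form of the Erdős-Stone theorem: for weights at most M the energy is at most (1
-- - 1/k)(∑x)² + o(n²M²). A larger energy survives the peeling and leaves a dense weighting, hence a
-- blow-up with k + 1 parts, which contains F.
weighted-turán : ∀ {f k} {F : Graph f} → Critical F k → ∀ N → ∃[ n₀ ] (∀ {n} (G : Graph n) → n₀ ≤ n → G IsFree F →
  ∀ M x → (∀ v → x v ≤ M) → N * (k * energy G x + ∑ x * ∑ x) ≤ N * (k * (∑ x * ∑ x)) + n * (n * (M * M)))
weighted-turán C zero = 0 , λ G _ _ M x _ → z≤n
weighted-turán {f} {k} {F} C (suc N) = n₁ + 2 * (suc N * k) , bound
  where
  es = dense-blowup k (4 * suc N) (s≤s z≤n) k ≤-refl (suc f) (s≤s z≤n)
  n₁ = proj₁ es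
  bound : ∀ {n} (G : Graph n) → n₁ + 2 * (suc N * k) ≤ n → G IsFree F → ∀ M x → (∀ v → x v ≤ M) →
    suc N * (k * energy G x + ∑ x * ∑ x) ≤ suc N * (k * (∑ x * ∑ x)) + n * (n * (M * M))
  bound {n} G le free M x x≤M = ≮⇒≥ λ exc →
    let x′ , D = peel n x x≤M (≤-trans (∑-bound 1 λ u → 𝟙≤1 (0 <? x u)) (≤-reflexive (*-identityʳ n))) exc
        φ , e = clique-embeds (proj₂ es G x′ M (≤-trans (m≤m+n n₁ _) le) D)
    in free⇒no-emb {F = F} {G} free φ e
    where
    open Peel G (suc N) k M (s≤s z≤n) (≤-trans (m≤n+m _ n₁) le)
    open Embedding C

-- Large minimum degree

nb : ∀ {n} → Graph n → Fin n → Fin n → Bool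
nb G u v = does (adj? G u v)

bit-does : {P : Set} (d : Dec P) → bit (does d) ≡ 𝟙 d
bit-does (yes _) = refl
bit-does (no _)  = refl

nb-adj : ∀ {n} (G : Graph n) {u v} → nb G u v ≡ true → Adj G u v
nb-adj G {u} {v} = does-true (adj? G u v)

¬nb : ∀ {n} (G : Graph n) {u v} → ¬ Adj G u v → not (nb G u v) ≡ true
¬nb G {u} {v} na with adj? G u v
... | yes a = ⊥-elim (na a)
... | no _  = refl

nb-sym : ∀ {n} (G : Graph n) u v → nb G u v ≡ nb G v u
nb-sym G u v with adj? G u v | adj? G v u
... | yes _ | yes _ = refl
... | no _  | no _  = refl
... | yes a | no na = ⊥-elim (na (symm G a))
... | no na | yes a = ⊥-elim (na (symm G a))

∧-trueˡ : ∀ a b → a ∧ b ≡ true → a ≡ true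
∧-trueˡ true _ _ = refl

∧-trueʳ : ∀ a b → a ∧ b ≡ true → b ≡ true
∧-trueʳ true _ e = e

∧-true : ∀ {a b} → a ≡ true → b ≡ true → a ∧ b ≡ true
∧-true refl refl = refl

card-mono : ∀ {n} {U V : Fin n → Bool} → (∀ v → U v ≡ true → V v ≡ true) → card U ≤ card V
card-mono {U = U} {V} h = ∑-mono λ v → one (U v) (V v) (h v)
  where
  one : ∀ a b → (a ≡ true → b ≡ true) → bit a ≤ bit b
  one false _ _ = z≤n
  one true  _ g rewrite g refl = ≤-refl

card-split : ∀ {n} (U P : Fin n → Bool) → card U ≡ card (λ v → U v ∧ P v) + card (λ v → U v ∧ not (P v))
card-split U P = trans (sum-cong-≗ λ v → bits (U v) (P v)) (∑-distrib-+ (λ v → bit (U v ∧ P v)) _)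
  where
  bits : ∀ a b → bit a ≡ bit (a ∧ b) + bit (a ∧ not b)
  bits true  true  = refl
  bits true  false = refl
  bits false _     = refl

card-disjoint : ∀ {n} (U V W : Fin n → Bool) → (∀ v → U v ≡ true → V v ≡ false) →
  (∀ v → U v ≡ true → W v ≡ true) → (∀ v → V v ≡ true → W v ≡ true) → card U + card V ≤ card W
card-disjoint U V W dis U⊆ V⊆ = ≤-trans (≤-reflexive (sym (∑-distrib-+ (bit ∘ U) (bit ∘ V)))) (∑-mono λ v → one (U v) (V v) (W v) (dis v) (U⊆ v) (V⊆ v))
  where
  one : ∀ a b c → (a ≡ true → b ≡ false) → (a ≡ true → c ≡ true) → (b ≡ true → c ≡ true) → bit a + bit b ≤ bit c
  one true  b     c h g _ rewrite h refl | g refl = ≤-refl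
  one false true  c _ _ g rewrite g refl = ≤-refl
  one false false c _ _ _ = z≤n

card-complement : ∀ {n} (P : Fin n → Bool) → card P + card (not ∘ P) ≡ n
card-complement {n} P = trans (sym (card-split (λ _ → true) P)) (trans (∑-const n 1) (*-identityʳ n))

card-avoid : ∀ {n t} (a : Fin t → Fin n) → (∀ {x y} → a x ≡ a y → x ≡ y) → (U : Fin t → Bool) → ∀ u →
  card U ≤ card (λ y → U y ∧ not (does (a y ≟ u))) + 1
card-avoid a inj U u = ≤-trans (≤-reflexive (trans (card-split U (λ y → does (a y ≟ u))) (+-comm (card λ y → U y ∧ does (a y ≟ u)) _)))
  (+-monoʳ-≤ (card λ y → U y ∧ not (does (a y ≟ u))) (≤-trans (card-mono {V = λ y → does (a y ≟ u)} (λ y → ∧-trueʳ (U y) _)) (few a inj)))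
  where
  few : ∀ {t} (a : Fin t → Fin _) → (∀ {x y} → a x ≡ a y → x ≡ y) → card (λ y → does (a y ≟ u)) ≤ 1
  few {zero}  a inj = z≤n
  few {suc t} a inj with a zero ≟ u
  ... | no _  = few (a ∘ suc) (suc-injective ∘ inj)
  ... | yes e = ≤-reflexive (cong suc (∑-≡0 λ y → trans (bit-does (a (suc y) ≟ u)) (𝟙-no (a (suc y) ≟ u) λ e′ → 0≢1+n (cong toℕ (inj (trans e (sym e′)))))))

two-terms : ∀ {k} (g : Fin k → ℕ) {i j} → i ≢ j → g i + g j ≤ ∑ g
two-terms g {zero}  {zero}  ne = ⊥-elim (ne refl)
two-terms g {zero}  {suc j} ne = +-monoʳ-≤ (g zero) (term≤∑ (g ∘ suc) j)
two-terms g {suc i} {zero}  ne = ≤-trans (≤-reflexive (+-comm (g (suc i)) (g zero))) (+-monoʳ-≤ (g zero) (term≤∑ (g ∘ suc) i))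
two-terms g {suc i} {suc j} ne = ≤-trans (two-terms (g ∘ suc) (ne ∘ cong suc)) (m≤n+m _ (g zero))

subBlowup : ∀ {n} {G : Graph n} {S j t} (B : Blowup G S j t) s (U : Fin j → Fin t → Bool) → (∀ i → s ≤ card (U i)) →
  Σ[ B′ ∈ Blowup G S j s ] (∀ i y → ∃[ y′ ] (part B′ i y ≡ part B i y′ × U i y′ ≡ true))
subBlowup B s U big = record
  { part = λ i y → part B i (proj₁ (sel i) y) ; injective = λ i e → proj₁ (proj₂ (sel i)) (injective B i e)
  ; joined = λ ne x y → joined B ne _ _ ; inside = λ i y → inside B i _ } ,
  λ i y → proj₁ (sel i) y , refl , proj₂ (proj₂ (sel i)) y
  where
  sel = λ i → pick s (U i) (big i)

-- If vertices of distinct sets W i have few non-neighbours in each other's sets, the parts of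
-- a complete multipartite subgraph can be chosen one after the other.
greedy : ∀ {n} (G : Graph n) N q p j (W : Fin j → Fin n → Bool) →
  (∀ {i i′} → i ≢ i′ → ∀ w → W i w ≡ true → N * card (λ u → W i′ u ∧ not (nb G w u)) ≤ q) →
  (∀ i → q * (j * p) + N * p ≤ N * card (W i)) → 1 ≤ N →
  Σ[ B ∈ Blowup G (λ _ → ⊤) j p ] (∀ i y → W i (part B i y) ≡ true)
greedy G N q p zero W few big 1≤N = record { part = λ () ; injective = λ () ; joined = λ { {()} } ; inside = λ () } , λ ()
greedy {n} G N q p (suc j) W few big 1≤N = record
  { part = new ; injective = new-inj ; joined = new-joined ; inside = λ _ _ → tt } , new∈
  where
  open ≤-Reasoning
  first = pick p (W zero) (*-cancelˡ-≤ N {{>-nonZero 1≤N}} (≤-trans (m≤n+m _ _) (big zero)))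
  a = proj₁ first
  a-inj : ∀ {x y} → a x ≡ a y → x ≡ y
  a-inj = proj₁ (proj₂ first)
  a∈ = proj₂ (proj₂ first)
  cut : ∀ {r} → (Fin r → Fin n) → (Fin n → Bool) → Fin n → Bool
  cut {zero}  b U = U
  cut {suc r} b U = cut (b ∘ suc) (λ u → U u ∧ nb G (b zero) u)
  cut⊆ : ∀ {r} (b : Fin r → Fin n) U u → cut b U u ≡ true → U u ≡ true
  cut⊆ {zero}  b U u e = e
  cut⊆ {suc r} b U u e = ∧-trueˡ (U u) _ (cut⊆ (b ∘ suc) _ u e)
  cut-adj : ∀ {r} (b : Fin r → Fin n) U u → cut b U u ≡ true → ∀ x → Adj G (b x) u
  cut-adj {suc r} b U u e zero    = nb-adj G (∧-trueʳ (U u) _ (cut⊆ (b ∘ suc) _ u e))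
  cut-adj {suc r} b U u e (suc x) = cut-adj (b ∘ suc) _ u e x
  cut-card : ∀ {r} (b : Fin r → Fin n) U → (∀ x → N * card (λ u → U u ∧ not (nb G (b x) u)) ≤ q) → N * card U ≤ N * card (cut b U) + r * q
  cut-card {zero}  b U h = ≤-reflexive (sym (+-identityʳ _))
  cut-card {suc r} b U h = begin
    N * card U                                               ≡⟨ cong (N *_) (card-split U (nb G (b zero))) ⟩
    N * (card U₁ + card (λ u → U u ∧ not (nb G (b zero) u)))   ≡⟨ *-distribˡ-+ N (card U₁) _ ⟩
    N * card U₁ + N * card (λ u → U u ∧ not (nb G (b zero) u)) ≤⟨ +-mono-≤ (cut-card (b ∘ suc) U₁ λ x → ≤-trans (*-monoʳ-≤ N (card-mono λ u e → ∧-true (∧-trueˡ (U u) _ (∧-trueˡ _ _ e)) (∧-trueʳ (U₁ u) _ e))) (h (suc x))) (h zero) ⟩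
    N * card (cut (b ∘ suc) U₁) + r * q + q                    ≡⟨ trans (+-assoc _ (r * q) q) (cong (N * card (cut (b ∘ suc) U₁) +_) (+-comm (r * q) q)) ⟩
    N * card (cut b U) + suc r * q                             ∎
    where
    U₁ = λ u → U u ∧ nb G (b zero) u
  W′ : Fin j → Fin n → Bool
  W′ i = cut a (W (suc i))
  big′ : ∀ i → q * (j * p) + N * p ≤ N * card (W′ i)
  big′ i = +-cancelʳ-≤ (p * q) _ _ (begin
    q * (j * p) + N * p + p * q              ≡⟨ arrange q j p (N * p) ⟩
    q * (suc j * p) + N * p                  ≤⟨ big (suc i) ⟩
    N * card (W (suc i))                     ≤⟨ cut-card a (W (suc i)) (λ x → few (λ ()) (a x) (a∈ x)) ⟩
    N * card (W′ i) + p * q                  ∎)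
    where
    arrange : ∀ q j p z → q * (j * p) + z + p * q ≡ q * (suc j * p) + z
    arrange = solve-∀
  few′ : ∀ {i i′} → i ≢ i′ → ∀ w → W′ i w ≡ true → N * card (λ u → W′ i′ u ∧ not (nb G w u)) ≤ q
  few′ {i} {i′} ne w w∈ = ≤-trans (*-monoʳ-≤ N (card-mono λ u e → ∧-true (cut⊆ a (W (suc i′)) u (∧-trueˡ _ _ e)) (∧-trueʳ (W′ i′ u) _ e)))
    (few (ne ∘ suc-injective) w (cut⊆ a (W (suc i)) w w∈))
  rec = greedy G N q p j W′ few′ big′ 1≤N
  B = proj₁ rec
  new : Fin (suc j) → Fin p → Fin n
  new zero    = a
  new (suc i) = part B i
  new-inj : ∀ i {x y} → new i x ≡ new i y → x ≡ y
  new-inj zero    e = a-inj e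
  new-inj (suc i) e = injective B i e
  new-joined : ∀ {i i′} → i ≢ i′ → ∀ x y → Adj G (new i x) (new i′ y)
  new-joined {zero}  {zero}   ne x y = ⊥-elim (ne refl)
  new-joined {zero}  {suc i}  ne x y = cut-adj a (W (suc i)) _ (proj₂ rec i y) x
  new-joined {suc i} {zero}   ne x y = symm G (cut-adj a (W (suc i)) _ (proj₂ rec i x) y)
  new-joined {suc i} {suc i′} ne x y = joined B (ne ∘ cong suc) x y
  new∈ : ∀ i y → W i (new i y) ≡ true
  new∈ zero    y = a∈ y
  new∈ (suc i) y = cut⊆ a (W (suc i)) _ (proj₂ rec i y)

module MinDegree {f κ} {F : Graph f} (C : Critical F (suc κ)) where

  open Embedding C

  k p : ℕ
  k = suc κ
  p = suc f

  1≤kkp : 1 ≤ k * k * p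
  1≤kkp = *-mono-≤ (*-mono-≤ (s≤s (z≤n {κ})) (s≤s (z≤n {κ}))) (s≤s (z≤n {f}))

  -- The degree condition allows every vertex (1 + 1/N) n/k non-neighbours, and t = Np makes p
  -- vertices a 1/N fraction of a part.
  module Structure (N t : ℕ) (N≡ : N ≡ 62 * (k * k * p)) (t≡ : t ≡ N * p) {n} (G : Graph n) (free : G IsFree F) (Np≤n : N * p ≤ n)
    (minDeg : ∀ v → N * (k * n) ≤ N * (k * deg G v + n) + n) {S : Fin n → Set} (𝔸 : Blowup G S k t) where

    open ≤-Reasoning

    62≤N : 62 ≤ N
    62≤N = ≤-trans (*-monoʳ-≤ 62 1≤kkp) (≤-reflexive (sym N≡))

    1≤N : 1 ≤ N
    1≤N = ≤-trans (s≤s z≤n) 62≤N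

    instance
      N≢0 : NonZero N
      N≢0 = >-nonZero 1≤N

    6p≤t : 6 * p ≤ t
    6p≤t = ≤-trans (*-monoˡ-≤ p (≤-trans (m≤m+n 6 56) 62≤N)) (≤-reflexive (sym t≡))

    1≤t : 1 ≤ t
    1≤t = ≤-trans (s≤s z≤n) 6p≤t

    a = part 𝔸

    nd : Fin n → ℕ
    nd v = card (not ∘ nb G v)

    deg-nd : ∀ v → deg G v + nd v ≡ n
    deg-nd v = trans (cong (_+ nd v) (sum-cong-≗ λ u → sym (bit-does (adj? G v u)))) (card-complement (nb G v))

    nd≤ : ∀ v → N * (k * nd v) ≤ N * n + n
    nd≤ v = +-cancelˡ-≤ (N * (k * deg G v)) _ _ (begin
      N * (k * deg G v) + N * (k * nd v)     ≡⟨ factor N k (deg G v) (nd v) ⟩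
      N * (k * (deg G v + nd v))             ≡⟨ cong (λ z → N * (k * z)) (deg-nd v) ⟩
      N * (k * n)                            ≤⟨ minDeg v ⟩
      N * (k * deg G v + n) + n              ≡⟨ expand N (k * deg G v) n ⟩
      N * (k * deg G v) + (N * n + n)        ∎)
      where
      factor : ∀ N k d e → N * (k * d) + N * (k * e) ≡ N * (k * (d + e))
      factor = solve-∀
      expand : ∀ N z n → N * (z + n) + n ≡ N * z + (N * n + n)
      expand = solve-∀

    c m : Fin k → Fin n → ℕ
    c i v = card λ y → nb G v (a i y)
    m i v = card λ y → not (nb G v (a i y))

    c+m : ∀ i v → c i v + m i v ≡ t
    c+m i v = card-complement λ y → nb G v (a i y)

    M : Fin n → ℕ
    M v = ∑ λ i → m i v

    ∑M : N * ∑ M ≤ t * (N * n + n)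
    ∑M = *-cancelˡ-≤ k (begin
      k * (N * ∑ M)                                      ≡⟨ cong (λ z → k * (N * z)) swapped ⟩
      k * (N * ∑ (λ i → ∑ λ y → nd (a i y)))             ≡⟨ trans (x∙yz≈y∙xz k N _) (trans (cong (N *_) (trans (*-distribˡ-sum k λ i → ∑ λ y → nd (a i y)) (sum-cong-≗ λ i → *-distribˡ-sum k λ y → nd (a i y)))) (trans (*-distribˡ-sum N λ i → ∑ λ y → k * nd (a i y)) (sum-cong-≗ λ i → *-distribˡ-sum N λ y → k * nd (a i y)))) ⟩
      ∑ (λ i → ∑ λ y → N * (k * nd (a i y)))             ≤⟨ ∑-mono (λ i → ∑-mono λ y → nd≤ (a i y)) ⟩
      ∑ {k} (λ i → ∑ {t} λ y → N * n + n)                ≡⟨ trans (sum-cong-≗ {k} λ i → ∑-const t (N * n + n)) (∑-const k _) ⟩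
      k * (t * (N * n + n))                              ∎)
      where
      swapped : ∑ M ≡ ∑ λ i → ∑ λ y → nd (a i y)
      swapped = trans (∑-comm λ v i → m i v) (sum-cong-≗ λ i → trans (∑-comm λ v y → bit (not (nb G v (a i y))))
        (sum-cong-≗ λ y → sum-cong-≗ λ v → cong (bit ∘ not) (nb-sym G v (a i y))))

    free′ : ¬ (∃[ φ ] IsEmb F G φ)
    free′ (φ , e) = free⇒no-emb {F = F} {G} free φ e

    -- A vertex with p neighbours in every part would yield F by `apex-embeds`.
    class₀ : ∀ v → ∃[ i ] c i v < p
    class₀ v with any? (λ i → c i v <? p)
    ... | yes h = h
    ... | no none =
      let B , sel = subBlowup 𝔸 p (λ i y → nb G v (a i y)) (λ i → ≮⇒≥ λ lt → none (i , lt))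
      in ⊥-elim (free′ (apex-embeds B v λ i y → let y′ , e , h = sel i y in subst (Adj G v) (sym e) (nb-adj G h)))

    t≤m+p : ∀ v → t ≤ m (proj₁ (class₀ v)) v + p
    t≤m+p v = let i , lt = class₀ v in begin
      t                  ≡⟨ c+m i v ⟨
      c i v + m i v      ≤⟨ +-monoˡ-≤ (m i v) (<⇒≤ lt) ⟩
      p + m i v          ≡⟨ +-comm p (m i v) ⟩
      m i v + p          ∎

    -- Every vertex misses at least t - p vertices of the blow-up by `class₀`, while `M` is at most
    -- (1 + 1/N)t on average. Typical vertices stay within t/4 above t.
    typical? : ∀ v → Dec (4 * M v ≤ 5 * t)
    typical? v = 4 * M v ≤? 5 * t

    β : ℕ
    β = card λ v → not (does (typical? v))

    -- Each vertex satisfies 4t ≤ 4M + 4p, an atypical one even 5t ≤ 4M. Summed over all vertices,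
    -- this leaves tβ ≤ 4tn/N + 4pn, and the last two terms agree because t = Np.
    Nβ≤ : N * β ≤ 8 * n
    Nβ≤ = *-cancelˡ-≤ t {{>-nonZero 1≤t}} (+-cancelˡ-≤ (N * (4 * (n * t))) _ _ (begin
      N * (4 * (n * t)) + t * (N * β)                      ≡⟨ a₁ N n t β ⟩
      N * (n * (4 * t) + t * β)                            ≤⟨ *-monoʳ-≤ N summed ⟩
      N * (4 * ∑ M + n * (4 * p))                          ≡⟨ a₂ N (∑ M) n p ⟩
      4 * (N * ∑ M) + 4 * (n * (N * p))                    ≤⟨ +-mono-≤ (*-monoʳ-≤ 4 ∑M) (≤-reflexive (cong (λ z → 4 * (n * z)) (sym t≡))) ⟩
      4 * (t * (N * n + n)) + 4 * (n * t)                  ≡⟨ a₃ N n t ⟩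
      N * (4 * (n * t)) + t * (8 * n)                      ∎))
      where
      a₁ : ∀ N n t β → N * (4 * (n * t)) + t * (N * β) ≡ N * (n * (4 * t) + t * β)
      a₁ = solve-∀
      a₂ : ∀ N m n p → N * (4 * m + n * (4 * p)) ≡ 4 * (N * m) + 4 * (n * (N * p))
      a₂ = solve-∀
      a₃ : ∀ N n t → 4 * (t * (N * n + n)) + 4 * (n * t) ≡ N * (4 * (n * t)) + t * (8 * n)
      a₃ = solve-∀
      pointwise : ∀ v → 4 * t + t * bit (not (does (typical? v))) ≤ 4 * M v + 4 * p
      pointwise v = cases (typical? v)
       where
       cases : (d : Dec (4 * M v ≤ 5 * t)) → 4 * t + t * bit (not (does d)) ≤ 4 * M v + 4 * p
       cases (yes _) = begin
        4 * t + t * 0                        ≡⟨ trans (cong (4 * t +_) (*-zeroʳ t)) (+-identityʳ _) ⟩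
        4 * t                                ≤⟨ *-monoʳ-≤ 4 (≤-trans (t≤m+p v) (+-monoˡ-≤ p (term≤∑ (λ i → m i v) _))) ⟩
        4 * (M v + p)                        ≡⟨ *-distribˡ-+ 4 (M v) p ⟩
        4 * M v + 4 * p                      ∎
       cases (no big) = begin
        4 * t + t * 1                        ≡⟨ five t ⟩
        5 * t                                ≤⟨ <⇒≤ (≰⇒> big) ⟩
        4 * M v                              ≤⟨ m≤m+n _ _ ⟩
        4 * M v + 4 * p                      ∎
        where
        five : ∀ t → 4 * t + t * 1 ≡ 5 * t
        five = solve-∀
      summed : n * (4 * t) + t * β ≤ 4 * ∑ M + n * (4 * p)
      summed = begin
        n * (4 * t) + t * β                                                 ≡⟨ cong₂ _+_ (sym (∑-const n (4 * t))) (*-distribˡ-sum t λ v → bit (not (does (typical? v)))) ⟩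
        ∑ {n} (λ _ → 4 * t) + ∑ (λ v → t * bit (not (does (typical? v))))   ≡⟨ ∑-distrib-+ {n} (λ _ → 4 * t) _ ⟨
        ∑ (λ v → 4 * t + t * bit (not (does (typical? v))))                 ≤⟨ ∑-mono pointwise ⟩
        ∑ (λ v → 4 * M v + 4 * p)                                           ≡⟨ trans (∑-distrib-+ (λ v → 4 * M v) _) (cong₂ _+_ (sym (*-distribˡ-sum 4 M)) (∑-const n (4 * p))) ⟩
        4 * ∑ M + n * (4 * p)                                               ∎

    V : Fin k → Fin n → Bool
    V i v = does (typical? v) ∧ does (proj₁ (class₀ v) ≟ i)

    V-typical : ∀ {i v} → V i v ≡ true → 4 * M v ≤ 5 * t
    V-typical {i} {v} e = does-true (typical? v) (∧-trueˡ _ _ e)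

    V-class : ∀ {i v} → V i v ≡ true → proj₁ (class₀ v) ≡ i
    V-class {i} {v} e = does-true (proj₁ (class₀ v) ≟ i) (∧-trueʳ (does (typical? v)) _ e)

    V-disjoint : ∀ {i j} → i ≢ j → ∀ v → V i v ≡ true → V j v ≡ false
    V-disjoint {i} {j} ne v e with V j v in eq
    ... | false = refl
    ... | true  = ⊥-elim (ne (trans (sym (V-class {i} e)) (V-class {j} eq)))

    -- At least t - p of the at most 5t/4 missed vertices lie in part i, which leaves at most t/4 +
    -- p for any other part.
    few-missing : ∀ {i j v} → i ≢ j → V i v ≡ true → 4 * m j v ≤ t + 4 * p
    few-missing {i} {j} {v} ne e = +-cancelʳ-≤ (4 * t) _ _ (begin
      4 * m j v + 4 * t                     ≤⟨ +-monoʳ-≤ (4 * m j v) (*-monoʳ-≤ 4 (subst (λ i → t ≤ m i v + p) (V-class {i} e) (t≤m+p v))) ⟩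
      4 * m j v + 4 * (m i v + p)           ≡⟨ a₁ (m j v) (m i v) p ⟩
      4 * (m i v + m j v) + 4 * p           ≤⟨ +-monoˡ-≤ (4 * p) (≤-trans (*-monoʳ-≤ 4 (two-terms (λ i → m i v) ne)) (V-typical {i} e)) ⟩
      5 * t + 4 * p                         ≡⟨ a₂ t p ⟩
      t + 4 * p + 4 * t                     ∎)
      where
      a₁ : ∀ x y p → 4 * x + 4 * (y + p) ≡ 4 * (y + x) + 4 * p
      a₁ = solve-∀
      a₂ : ∀ t p → 5 * t + 4 * p ≡ t + 4 * p + 4 * t
      a₂ = solve-∀

    Sel : Fin k → Fin n → Fin n → Fin k → Fin n → Bool
    Sel i u v j w with j ≟ i
    ... | yes _ = not (does (w ≟ u)) ∧ not (does (w ≟ v))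
    ... | no _  = nb G u w ∧ nb G v w

    Sel-adj : ∀ {i u v j w} → j ≢ i → Sel i u v j w ≡ true → Adj G u w × Adj G v w
    Sel-adj {i} {u} {v} {j} {w} ne e with j ≟ i
    ... | yes q = ⊥-elim (ne q)
    ... | no _  = nb-adj G (∧-trueˡ _ _ e) , nb-adj G (∧-trueʳ (nb G u w) _ e)

    Sel-avoid : ∀ {i u v w} → Sel i u v i w ≡ true → w ≢ u × w ≢ v
    Sel-avoid {i} {u} {v} {w} e with i ≟ i
    ... | no ne = ⊥-elim (ne refl)
    ... | yes _ = avoid (∧-trueˡ _ _ e) , avoid (∧-trueʳ (not (does (w ≟ u))) _ e)
      where
      avoid : ∀ {z} → not (does (w ≟ z)) ≡ true → w ≢ z
      avoid {z} h with w ≟ z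
      ... | no ne = ne

    no-edge : ∀ {S i u v} (B : Blowup G S k f) → (∀ j y → Sel i u v j (part B j y) ≡ true) → ¬ Adj G u v
    no-edge {S} {i} {u} {v} B sel uv = free′ (edge-embeds i B u v uv
      (λ j ne w → proj₁ (Sel-adj ne (sel j w))) (λ j ne w → proj₂ (Sel-adj ne (sel j w)))
      (λ w → proj₁ (Sel-avoid {i} {u} {v} (sel i w))) (λ w → proj₂ (Sel-avoid {i} {u} {v} (sel i w))))

    -- Two members share at least t - 2(t/4 + p) ≥ p neighbours in every other part, since 6p ≤ t,
    -- and an edge between them would complete F.
    V-independent : ∀ {i u v} → V i u ≡ true → V i v ≡ true → ¬ Adj G u v
    V-independent {i} {u} {v} u∈ v∈ = let B , sel = subBlowup 𝔸 f U big in
      no-edge {i = i} B (λ j y → let y′ , e , h = sel j y in subst (λ w → Sel i u v j w ≡ true) (sym e) h)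
      where
      U : Fin k → Fin t → Bool
      U j y = Sel i u v j (a j y)
      big : ∀ j → f ≤ card (U j)
      big j with j ≟ i
      ... | no ne = ≤-trans (n≤1+n f) (*-cancelˡ-≤ 4 (+-cancelʳ-≤ (8 * p + 2 * t) _ _ (begin
        4 * p + (8 * p + 2 * t)                                 ≡⟨ a₁ p t ⟩
        2 * (6 * p) + 2 * t                                     ≤⟨ +-monoˡ-≤ (2 * t) (*-monoʳ-≤ 2 6p≤t) ⟩
        2 * t + 2 * t                                           ≡⟨ a₂ t ⟩
        4 * t                                                   ≤⟨ *-monoʳ-≤ 4 t≤ ⟩
        4 * (card (λ y → nb G u (a j y) ∧ nb G v (a j y)) + m j v + m j u)   ≡⟨ a₃ (card (λ y → nb G u (a j y) ∧ nb G v (a j y))) (m j v) (m j u) ⟩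
        4 * card (λ y → nb G u (a j y) ∧ nb G v (a j y)) + (4 * m j v + 4 * m j u)   ≤⟨ +-monoʳ-≤ (4 * card (λ y → nb G u (a j y) ∧ nb G v (a j y))) (+-mono-≤ (few-missing {i} (ne ∘ sym) v∈) (few-missing {i} (ne ∘ sym) u∈)) ⟩
        4 * card (λ y → nb G u (a j y) ∧ nb G v (a j y)) + ((t + 4 * p) + (t + 4 * p))   ≡⟨ cong (4 * card (λ y → nb G u (a j y) ∧ nb G v (a j y)) +_) (a₄ t p) ⟩
        4 * card (λ y → nb G u (a j y) ∧ nb G v (a j y)) + (8 * p + 2 * t)   ∎)))
        where
        a₁ : ∀ p t → 4 * p + (8 * p + 2 * t) ≡ 2 * (6 * p) + 2 * t
        a₁ = solve-∀
        a₂ : ∀ t → 2 * t + 2 * t ≡ 4 * t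
        a₂ = solve-∀
        a₃ : ∀ x y z → 4 * (x + y + z) ≡ 4 * x + (4 * y + 4 * z)
        a₃ = solve-∀
        a₄ : ∀ t p → (t + 4 * p) + (t + 4 * p) ≡ 8 * p + 2 * t
        a₄ = solve-∀
        t≤ : t ≤ card (λ y → nb G u (a j y) ∧ nb G v (a j y)) + m j v + m j u
        t≤ = begin
          t                                  ≡⟨ c+m j u ⟨
          c j u + m j u                      ≡⟨ cong (_+ m j u) (card-split (λ y → nb G u (a j y)) (λ y → nb G v (a j y))) ⟩
          card (λ y → nb G u (a j y) ∧ nb G v (a j y)) + card (λ y → nb G u (a j y) ∧ not (nb G v (a j y))) + m j u
            ≤⟨ +-monoˡ-≤ (m j u) (+-monoʳ-≤ _ (card-mono λ y → ∧-trueʳ (nb G u (a j y)) _)) ⟩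
          card (λ y → nb G u (a j y) ∧ nb G v (a j y)) + m j v + m j u   ∎
      ... | yes refl = +-cancelʳ-≤ 2 _ _ (begin
        f + 2                                                   ≤⟨ small f ⟩
        6 * p                                                   ≤⟨ 6p≤t ⟩
        t                                                       ≡⟨ trans (∑-const t 1) (*-identityʳ t) ⟨
        card {t} (λ _ → true)                                   ≤⟨ card-avoid (a i) (injective 𝔸 i) (λ _ → true) u ⟩
        card (λ y → not (does (a i y ≟ u))) + 1                 ≤⟨ +-monoˡ-≤ 1 (card-avoid (a i) (injective 𝔸 i) (λ y → not (does (a i y ≟ u))) v) ⟩
        card (λ y → not (does (a i y ≟ u)) ∧ not (does (a i y ≟ v))) + 1 + 1   ≡⟨ +-assoc _ 1 1 ⟩
        card (λ y → not (does (a i y ≟ u)) ∧ not (does (a i y ≟ v))) + 2       ∎)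
        where
        small : ∀ f → f + 2 ≤ 6 * suc f
        small f = ≤-trans (m≤m+n (f + 2) (5 * f + 4)) (≤-reflexive (eq f))
          where
          eq : ∀ f → f + 2 + (5 * f + 4) ≡ 6 * suc f
          eq = solve-∀

    s : Fin k → ℕ
    s i = card (V i)

    V⊆nonadj : ∀ {i u} → V i u ≡ true → ∀ v → V i v ≡ true → not (nb G u v) ≡ true
    V⊆nonadj {i} u∈ v v∈ = ¬nb G (V-independent {i} u∈ v∈)

    s≤ : ∀ i → N * (k * s i) ≤ N * n + n
    s≤ i with any? (λ v → V i v Boolₚ.≟ true)
    ... | yes (v , v∈) = ≤-trans (*-monoʳ-≤ N (*-monoʳ-≤ k (card-mono (V⊆nonadj {i} v∈)))) (nd≤ v)
    ... | no none = ≤-trans (≤-reflexive (trans (cong (λ z → N * (k * z)) (∑-≡0 λ v → isFalse (V i v) (λ e → none (v , e)))) (trans (cong (N *_) (*-zeroʳ k)) (*-zeroʳ N)))) z≤n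
      where
      isFalse : ∀ b → b ≢ true → bit b ≡ 0
      isFalse true  ne = ⊥-elim (ne refl)
      isFalse false _  = refl

    ∑s+β : ∑ s + β ≡ n
    ∑s+β = trans (cong (_+ β) (∑-comm λ i v → bit (V i v))) (trans (sym (∑-distrib-+ (λ v → ∑ λ i → bit (V i v)) _)) (trans (sum-cong-≗ one) (trans (∑-const n 1) (*-identityʳ n))))
      where
      one : ∀ v → ∑ (λ i → bit (V i v)) + bit (not (does (typical? v))) ≡ 1
      one v = cases (typical? v)
       where
       cases : (d : Dec (4 * M v ≤ 5 * t)) → ∑ (λ i → bit (does d ∧ does (proj₁ (class₀ v) ≟ i))) + bit (not (does d)) ≡ 1
       cases (no _)  = cong (_+ 1) (∑-≡0 {k} λ _ → refl)
       cases (yes _) = trans (+-identityʳ _) (trans (sum-cong-≗ λ i → trans (bit-does (proj₁ (class₀ v) ≟ i)) (trans (𝟙-cong (proj₁ (class₀ v) ≟ i) (i ≟ proj₁ (class₀ v)) sym sym) (sym (*-identityʳ _)))) (∑-δ (proj₁ (class₀ v)) λ _ → 1))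

    -- An independent class lies among the non-neighbours of any member, so no class exceeds (1 +
    -- 1/N) n/k. With at most 8n/N atypical vertices, each class must then come within 9n/N of n/k.
    s≥ : ∀ i → N * n ≤ N * (k * s i) + 9 * (k * n)
    s≥ i = +-cancelʳ-≤ (κ * (N * n)) _ _ (begin
      N * n + κ * (N * n)                                                ≡⟨ a₁ N n κ ⟩
      N * (k * n)                                                        ≡⟨ cong (λ z → N * (k * z)) ∑s+β ⟨
      N * (k * (∑ s + β))                                                ≡⟨ cong (λ z → N * (k * (z + β))) (sum-remove {i = i} s) ⟩
      N * (k * (s i + others + β))                                       ≡⟨ a₂ N k (s i) others β ⟩
      N * (k * s i) + N * (k * others) + k * (N * β)                     ≤⟨ +-mono-≤ (+-monoʳ-≤ (N * (k * s i)) others≤) (*-monoʳ-≤ k Nβ≤) ⟩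
      N * (k * s i) + κ * (N * n + n) + k * (8 * n)                      ≤⟨ m≤m+n _ n ⟩
      N * (k * s i) + κ * (N * n + n) + k * (8 * n) + n                  ≡⟨ a₃ (N * (k * s i)) κ (N * n) n ⟩
      N * (k * s i) + 9 * (k * n) + κ * (N * n)                          ∎)
      where
      others = ∑ λ j → s (punchIn i j)
      a₁ : ∀ N n κ → N * n + κ * (N * n) ≡ N * (suc κ * n)
      a₁ = solve-∀
      a₂ : ∀ N k x o b → N * (k * (x + o + b)) ≡ N * (k * x) + N * (k * o) + k * (N * b)
      a₂ = solve-∀
      a₃ : ∀ x κ y n → x + κ * (y + n) + suc κ * (8 * n) + n ≡ x + 9 * (suc κ * n) + κ * y
      a₃ = solve-∀
      others≤ : N * (k * others) ≤ κ * (N * n + n)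
      others≤ = begin
        N * (k * others)                              ≡⟨ trans (cong (N *_) (*-distribˡ-sum k λ j → s (punchIn i j))) (*-distribˡ-sum N λ j → k * s (punchIn i j)) ⟩
        ∑ {κ} (λ j → N * (k * s (punchIn i j)))       ≤⟨ ∑-bound {κ} (N * n + n) (λ j → s≤ (punchIn i j)) ⟩
        κ * (N * n + n)                               ∎

    -- Nearly all of class i is among the at most (1 + 1/N) n/k non-neighbours of u, so few of these
    -- are left for class j. Of the 10, nine come from `s≥` and one from the excess in `nd≤`.
    missing : ∀ u {i j} q → i ≢ j → N * card (λ w → V i w ∧ nb G u w) ≤ q * n →
      N * card (λ w → V j w ∧ not (nb G u w)) ≤ (10 + q) * n
    missing u {i} {j} q ne h = *-cancelˡ-≤ k (+-cancelˡ-≤ (N * (k * s i)) _ _ (begin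
      N * (k * s i) + k * (N * r)                                  ≡⟨ cong (λ z → N * (k * z) + k * (N * r)) (card-split (V i) (nb G u)) ⟩
      N * (k * (x + y)) + k * (N * r)                              ≡⟨ a₁ N k x y r ⟩
      k * (N * x) + N * (k * (y + r))                              ≤⟨ +-mono-≤ (*-monoʳ-≤ k h) (≤-trans (*-monoʳ-≤ N (*-monoʳ-≤ k (card-disjoint _ _ (not ∘ nb G u) dis (λ w → ∧-trueʳ (V i w) _) (λ w → ∧-trueʳ (V j w) _)))) (nd≤ u)) ⟩
      k * (q * n) + (N * n + n)                                    ≤⟨ +-monoʳ-≤ (k * (q * n)) (+-mono-≤ (s≥ i) (m≤m+n n (κ * n))) ⟩
      k * (q * n) + (N * (k * s i) + 9 * (k * n) + k * n)          ≡⟨ a₂ k q n (N * (k * s i)) ⟩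
      N * (k * s i) + k * ((10 + q) * n)                           ∎))
      where
      r = card (λ w → V j w ∧ not (nb G u w))
      x = card (λ w → V i w ∧ nb G u w)
      y = card (λ w → V i w ∧ not (nb G u w))
      dis : ∀ w → V i w ∧ not (nb G u w) ≡ true → V j w ∧ not (nb G u w) ≡ false
      dis w e = cong (_∧ not (nb G u w)) (V-disjoint ne w (∧-trueˡ (V i w) _ e))
      a₁ : ∀ N k x y r → N * (k * (x + y)) + k * (N * r) ≡ k * (N * x) + N * (k * (y + r))
      a₁ = solve-∀
      a₂ : ∀ k q n z → k * (q * n) + (z + 9 * (k * n) + k * n) ≡ z + k * ((10 + q) * n)
      a₂ = solve-∀

    V-missing : ∀ {i j} → i ≢ j → ∀ w → V i w ≡ true → N * card (λ u → V j u ∧ not (nb G w u)) ≤ 10 * n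
    V-missing {i} {j} ne w w∈ = missing w {i} {j} 0 ne (≤-reflexive (trans (cong (N *_) (∑-≡0 λ u → none u)) (*-zeroʳ N)))
      where
      none : ∀ u → bit (V i u ∧ nb G w u) ≡ 0
      none u with V i u in eq
      ... | false = refl
      ... | true with adj? G w u
      ...   | yes e = ⊥-elim (V-independent {i} w∈ eq e)
      ...   | no _  = refl

    -- Chosen for `greedy` in `class`: 10nkp pays for the missing neighbours, and a further nkp
    -- covers Np ≤ n.
    Q : ℕ
    Q = 11 * (k * p)

    -- Atypical vertices get a class as well: a vertex with many neighbours in every class would, by
    -- `greedy`, be joined to a whole blow-up, and `apex-embeds` would give F.
    class : ∀ u → ∃[ i ] N * card (λ w → V i w ∧ nb G u w) ≤ Q * n
    class u with any? (λ i → N * card (λ w → V i w ∧ nb G u w) ≤? Q * n)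
    ... | yes h = h
    ... | no none = ⊥-elim (free′ (apex-embeds (proj₁ g) u λ i y → nb-adj G (∧-trueʳ (V i (part (proj₁ g) i y)) _ (proj₂ g i y))))
      where
      Z : Fin k → Fin n → Bool
      Z i w = V i w ∧ nb G u w
      big : ∀ i → 10 * n * (k * p) + N * p ≤ N * card (Z i)
      big i = begin
        10 * n * (k * p) + N * p        ≤⟨ +-monoʳ-≤ (10 * n * (k * p)) Np≤n ⟩
        10 * n * (k * p) + n            ≤⟨ +-monoʳ-≤ (10 * n * (k * p)) (≤-trans (≤-reflexive (sym (*-identityʳ n))) (*-monoʳ-≤ n (*-mono-≤ (s≤s (z≤n {κ})) (s≤s (z≤n {f}))))) ⟩
        10 * n * (k * p) + n * (k * p)  ≡⟨ eq n (k * p) ⟩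
        Q * n                           ≤⟨ <⇒≤ (≰⇒> λ le → none (i , le)) ⟩
        N * card (Z i)                  ∎
        where
        eq : ∀ n z → 10 * n * z + n * z ≡ 11 * z * n
        eq = solve-∀
      g = greedy G N (10 * n) p k Z
        (λ {i} {i′} ne w w∈ → ≤-trans (*-monoʳ-≤ N (card-mono λ x e → ∧-true (∧-trueˡ (V i′ x) _ (∧-trueˡ (Z i′ x) _ e)) (∧-trueʳ (Z i′ x) _ e))) (V-missing ne w (∧-trueˡ (V i w) _ w∈)))
        big 1≤N

    -- By `missing`, both vertices miss few vertices of every other class, so `greedy` finds a
    -- blow-up whose other parts lie in their common neighbourhood; in class i it only has to avoid
    -- u and v. The edge would complete F.
    class-independent : ∀ i u v → N * card (λ w → V i w ∧ nb G u w) ≤ Q * n → N * card (λ w → V i w ∧ nb G v w) ≤ Q * n → ¬ Adj G u v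
    class-independent i u v hu hv = no-edge {i = i} B′ (λ j y → ∧-trueʳ (V j _) _ (proj₂ g j (inject₁ y)))
      where
      Z : Fin k → Fin n → Bool
      Z j w = V j w ∧ Sel i u v j w
      loss : ∀ j → N * s j ≤ N * card (Z j) + 2 * ((10 + Q) * n)
      loss j with j ≟ i
      ... | no ne = begin
        N * s j                                                                     ≡⟨ cong (N *_) (trans (card-split (V j) (nb G u)) (cong (_+ rᵤ) (card-split (λ w → V j w ∧ nb G u w) (nb G v)))) ⟩
        N * (card (λ w → (V j w ∧ nb G u w) ∧ nb G v w) + card (λ w → (V j w ∧ nb G u w) ∧ not (nb G v w)) + rᵤ)
          ≤⟨ *-monoʳ-≤ N (+-monoˡ-≤ rᵤ (+-mono-≤ (≤-reflexive (sum-cong-≗ λ w → cong bit (Boolₚ.∧-assoc (V j w) (nb G u w) (nb G v w))))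
               (card-mono λ w e → ∧-true (∧-trueˡ (V j w) _ (∧-trueˡ (V j w ∧ nb G u w) _ e)) (∧-trueʳ (V j w ∧ nb G u w) _ e)))) ⟩
        N * (card (λ w → V j w ∧ (nb G u w ∧ nb G v w)) + rᵥ + rᵤ)                 ≡⟨ distr N _ rᵥ rᵤ ⟩
        N * card (λ w → V j w ∧ (nb G u w ∧ nb G v w)) + (N * rᵥ + N * rᵤ)         ≤⟨ +-monoʳ-≤ (N * card (λ w → V j w ∧ (nb G u w ∧ nb G v w))) (+-mono-≤ (missing v Q (ne ∘ sym) hv) (missing u Q (ne ∘ sym) hu)) ⟩
        N * card (λ w → V j w ∧ (nb G u w ∧ nb G v w)) + ((10 + Q) * n + (10 + Q) * n)   ≡⟨ cong (N * card (λ w → V j w ∧ (nb G u w ∧ nb G v w)) +_) (cong ((10 + Q) * n +_) (sym (+-identityʳ _))) ⟩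
        N * card (λ w → V j w ∧ (nb G u w ∧ nb G v w)) + 2 * ((10 + Q) * n)        ∎
        where
        rᵤ = card (λ w → V j w ∧ not (nb G u w))
        rᵥ = card (λ w → V j w ∧ not (nb G v w))
        distr : ∀ N x y z → N * (x + y + z) ≡ N * x + (N * y + N * z)
        distr = solve-∀
      ... | yes refl = begin
        N * s i                                       ≤⟨ *-monoʳ-≤ N (≤-trans (card-avoid id id (V i) u) (+-monoˡ-≤ 1 (card-avoid id id (λ w → V i w ∧ not (does (w ≟ u))) v))) ⟩
        N * (card (λ w → (V i w ∧ not (does (w ≟ u))) ∧ not (does (w ≟ v))) + 1 + 1)   ≡⟨ cong (λ z → N * (z + 1 + 1)) (sum-cong-≗ λ w → cong bit (Boolₚ.∧-assoc (V i w) (not (does (w ≟ u))) (not (does (w ≟ v))))) ⟩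
        N * (card (λ w → V i w ∧ (not (does (w ≟ u)) ∧ not (does (w ≟ v)))) + 1 + 1)   ≡⟨ distr N _ ⟩
        N * card (λ w → V i w ∧ (not (does (w ≟ u)) ∧ not (does (w ≟ v)))) + 2 * N     ≤⟨ +-monoʳ-≤ (N * card (λ w → V i w ∧ (not (does (w ≟ u)) ∧ not (does (w ≟ v))))) (*-monoʳ-≤ 2 (≤-trans N≤n (m≤m+n n ((9 + Q) * n)))) ⟩
        N * card (λ w → V i w ∧ (not (does (w ≟ u)) ∧ not (does (w ≟ v)))) + 2 * ((10 + Q) * n)   ∎
        where
        distr : ∀ N x → N * (x + 1 + 1) ≡ N * x + 2 * N
        distr = solve-∀
        N≤n : N ≤ n
        N≤n = ≤-trans (≤-trans (≤-reflexive (sym (*-identityʳ N))) (*-monoʳ-≤ N (s≤s (z≤n {f})))) Np≤n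
      big : ∀ j → 10 * n * (k * p) + N * p ≤ N * card (Z j)
      big j = *-cancelˡ-≤ k (+-cancelʳ-≤ (k * (2 * ((10 + Q) * n)) + 9 * (k * n)) _ _ (begin
        k * (10 * n * (k * p) + N * p) + (k * (2 * ((10 + Q) * n)) + 9 * (k * n))   ≤⟨ +-monoˡ-≤ _ (*-monoʳ-≤ k (+-monoʳ-≤ (10 * n * (k * p)) Np≤n)) ⟩
        k * (10 * n * (k * p) + n) + (k * (2 * ((10 + Q) * n)) + 9 * (k * n))       ≡⟨ a₁ k p n ⟩
        -- 32 + 30 is the origin of the 62 in `N`.
        (32 * (k * k * p) + 30 * k) * n                                             ≤⟨ *-monoˡ-≤ n (+-monoʳ-≤ (32 * (k * k * p)) (*-monoʳ-≤ 30 k≤)) ⟩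
        (32 * (k * k * p) + 30 * (k * k * p)) * n                                   ≡⟨ cong (_* n) (trans (sym (*-distribʳ-+ (k * k * p) 32 30)) (sym N≡)) ⟩
        N * n                                                                       ≤⟨ s≥ j ⟩
        N * (k * s j) + 9 * (k * n)                                                 ≡⟨ cong (_+ 9 * (k * n)) (x∙yz≈y∙xz N k (s j)) ⟩
        k * (N * s j) + 9 * (k * n)                                                 ≤⟨ +-monoˡ-≤ (9 * (k * n)) (*-monoʳ-≤ k (loss j)) ⟩
        k * (N * card (Z j) + 2 * ((10 + Q) * n)) + 9 * (k * n)                     ≡⟨ a₂ k (N * card (Z j)) (2 * ((10 + Q) * n)) (9 * (k * n)) ⟩
        k * (N * card (Z j)) + (k * (2 * ((10 + Q) * n)) + 9 * (k * n))             ∎))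
        where
        a₁ : ∀ k p n → k * (10 * n * (k * p) + n) + (k * (2 * ((10 + 11 * (k * p)) * n)) + 9 * (k * n)) ≡ (32 * (k * k * p) + 30 * k) * n
        a₁ = solve-∀
        a₂ : ∀ k x y z → k * (x + y) + z ≡ k * x + (k * y + z)
        a₂ = solve-∀
        k≤ : k ≤ k * k * p
        k≤ = ≤-trans (≤-reflexive (sym (*-identityʳ k))) (≤-trans (*-monoʳ-≤ k (*-mono-≤ (s≤s (z≤n {κ})) (s≤s (z≤n {f})))) (≤-reflexive (sym (*-assoc k k p))))
      g = greedy G N (10 * n) p k Z
        (λ {i} {i′} ne w w∈ → ≤-trans (*-monoʳ-≤ N (card-mono λ x e → ∧-true (∧-trueˡ (V i′ x) _ (∧-trueˡ (Z i′ x) _ e)) (∧-trueʳ (Z i′ x) _ e))) (V-missing ne w (∧-trueˡ (V i w) _ w∈)))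
        big 1≤N
      B′ : Blowup G (λ _ → ⊤) k f
      B′ = record { part = λ j y → part (proj₁ g) j (inject₁ y) ; injective = λ j e → inject₁-injective (injective (proj₁ g) j e)
                  ; joined = λ ne x y → joined (proj₁ g) ne (inject₁ x) (inject₁ y) ; inside = λ _ _ → tt }

    colouring : Colorable G k
    colouring = (λ v → proj₁ (class v)) , λ u v uv e → class-independent (proj₁ (class v)) u v
      (subst (λ i → N * card (λ w → V i w ∧ nb G u w) ≤ Q * n) e (proj₂ (class u))) (proj₂ (class v)) uv

  -- For κ ≥ 1 there is a gap of 1/(κk) between κ/k and (κ-1)/κ. L = 2k takes half of it as margin
  -- and leaves the other half for the error in the degrees.
  dense : ∀ N → N ≡ 62 * (k * k * p) → ∀ {n} (G : Graph n) → 1 ≤ n → (∀ v → N * (k * n) ≤ N * (k * deg G v + n) + n) → Dense G (λ _ → 1) κ (2 * k) 1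
  dense N N≡ {n} G 1≤n minDeg = record
    { bounded = λ _ → ≤-refl
    ; positive = subst (0 <_) (sym ∑1) 1≤n
    ; degrees = λ v _ → subst₂ (λ X d → 2 * k * (κ * X) + n * 1 ≤ 2 * k * (κ * d + X)) (sym ∑1) (sum-cong-≗ λ u → sym (*-identityʳ (A G v u))) (bound v) }
    where
    open ≤-Reasoning
    ∑1 : ∑ {n} (λ _ → 1) ≡ n
    ∑1 = trans (∑-const n 1) (*-identityʳ n)
    1≤N : 1 ≤ N
    1≤N = ≤-trans (*-mono-≤ (s≤s (z≤n {61})) 1≤kkp) (≤-reflexive (sym N≡))
    2κ≤N : 2 * κ ≤ N
    2κ≤N = ≤-trans (*-mono-≤ (m≤m+n 2 60) (≤-trans (n≤1+n κ) (≤-trans (≤-reflexive (sym (*-identityʳ k))) (≤-trans (*-monoʳ-≤ k (*-mono-≤ (s≤s (z≤n {κ})) (s≤s (z≤n {f})))) (≤-reflexive (sym (*-assoc k k p))))))) (≤-reflexive (sym N≡))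
    bound : ∀ v → 2 * k * (κ * n) + n * 1 ≤ 2 * k * (κ * deg G v + n)
    bound v = begin
      2 * k * (κ * n) + n * 1                          ≡⟨ a₁ κ n ⟩
      2 * κ * (k * n) + n                              ≤⟨ +-monoˡ-≤ n (*-cancelˡ-≤ N {{>-nonZero 1≤N}} scaled) ⟩
      2 * κ * (k * deg G v + n) + n + n                ≡⟨ a₂ κ (deg G v) n ⟩
      2 * k * (κ * deg G v + n)                        ∎
      where
      a₁ : ∀ κ n → 2 * suc κ * (κ * n) + n * 1 ≡ 2 * κ * (suc κ * n) + n
      a₁ = solve-∀
      a₂ : ∀ κ d n → 2 * κ * (suc κ * d + n) + n + n ≡ 2 * suc κ * (κ * d + n)
      a₂ = solve-∀
      scaled : N * (2 * κ * (k * n)) ≤ N * (2 * κ * (k * deg G v + n) + n)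
      scaled = begin
        N * (2 * κ * (k * n))                                    ≡⟨ x∙yz≈y∙xz N (2 * κ) (k * n) ⟩
        2 * κ * (N * (k * n))                                    ≤⟨ *-monoʳ-≤ (2 * κ) (minDeg v) ⟩
        2 * κ * (N * (k * deg G v + n) + n)                      ≡⟨ a₃ (2 * κ) N (k * deg G v + n) n ⟩
        N * (2 * κ * (k * deg G v + n)) + 2 * κ * n              ≤⟨ +-monoʳ-≤ (N * (2 * κ * (k * deg G v + n))) (*-monoˡ-≤ n 2κ≤N) ⟩
        N * (2 * κ * (k * deg G v + n)) + N * n                  ≡⟨ *-distribˡ-+ N _ n ⟨
        N * (2 * κ * (k * deg G v + n) + n)                      ∎
        where
        a₃ : ∀ c N z n → c * (N * z + n) ≡ N * (c * z) + c * n
        a₃ = solve-∀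

  colourable : ∃[ N ] ∃[ n₀ ] (∀ {n} (G : Graph n) → n₀ ≤ n → G IsFree F →
    (∀ v → N * (k * n) ≤ N * (k * deg G v + n) + n) → Colorable G k)
  colourable = choose (62 * (k * k * p)) refl
    where
    choose : ∀ N → N ≡ 62 * (k * k * p) → ∃[ N ] ∃[ n₀ ] (∀ {n} (G : Graph n) → n₀ ≤ n → G IsFree F →
      (∀ v → N * (k * n) ≤ N * (k * deg G v + n) + n) → Colorable G k)
    choose N N≡ = N , proj₁ blowup + (N * p + 1) , λ {n} G le free minDeg →
      let le′ = ≤-trans (m≤n+m (N * p + 1) (proj₁ blowup)) le in
      Structure.colouring N (N * p) N≡ refl G free (≤-trans (m≤m+n _ 1) le′) minDeg
        (proj₂ blowup G (λ _ → 1) 1 (≤-trans (m≤m+n (proj₁ blowup) _) le) (dense N N≡ G (≤-trans (m≤n+m 1 (N * p)) le′) minDeg))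
      where
      blowup = dense-blowup κ (2 * k) (s≤s z≤n) κ ≤-refl (N * p)
        (*-mono-≤ (≤-trans (*-mono-≤ (s≤s (z≤n {61})) 1≤kkp) (≤-reflexive (sym N≡))) (s≤s z≤n))

-- Asymptotic inequalities

m<2^m : ∀ m → m < 2 ^ m
m<2^m zero    = s≤s z≤n
m<2^m (suc m) = ≤-trans (+-mono-≤ (m^n>0 2 m) (m<2^m m)) (≤-reflexive (cong (2 ^ m +_) (sym (+-identityʳ (2 ^ m)))))

^-distribʳ-* : ∀ m a b → (a * b) ^ m ≡ a ^ m * b ^ m
^-distribʳ-* zero    a b = refl
^-distribʳ-* (suc m) a b = trans (cong (a * b *_) (^-distribʳ-* m a b)) (interchange a b (a ^ m) (b ^ m))

-- Bernoulli's inequality (1 + 1/q)ᵐ ≥ 1 + m/q, cleared of denominators.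
bernoulli : ∀ q m → q ^ m * (q + m) ≤ suc q ^ m * q
bernoulli q zero    = ≤-reflexive (cong (1 *_) (+-identityʳ q))
bernoulli q (suc m) = begin
  q * q ^ m * (q + suc m)            ≡⟨ a₁ q (q ^ m) m ⟩
  q ^ m * (q * (q + suc m))          ≤⟨ *-monoʳ-≤ (q ^ m) (≤-trans (m≤m+n _ m) (≤-reflexive (a₂ q m))) ⟩
  q ^ m * (suc q * (q + m))          ≡⟨ x∙yz≈y∙xz (q ^ m) (suc q) (q + m) ⟩
  suc q * (q ^ m * (q + m))          ≤⟨ *-monoʳ-≤ (suc q) (bernoulli q m) ⟩
  suc q * (suc q ^ m * q)            ≡⟨ *-assoc (suc q) (suc q ^ m) q ⟨
  suc q * suc q ^ m * q              ∎
  where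
  open ≤-Reasoning
  a₁ : ∀ q p m → q * p * (q + suc m) ≡ p * (q * (q + suc m))
  a₁ = solve-∀
  a₂ : ∀ q m → q * (q + suc m) + m ≡ suc q * (q + m)
  a₂ = solve-∀

-- A gap between x and y of relative size 1/q becomes a factor L after raising to a power m ≥ L q.
power-gap : ∀ {q x y L} m → 1 ≤ q → L * q ≤ m → suc q * y ≤ q * x → L * y ^ m ≤ x ^ m
power-gap {q} {x} {y} {L} m 1≤q Lq≤m gap = *-cancelˡ-≤ (q * q ^ m) {{>-nonZero (*-mono-≤ 1≤q (≤-trans (≤-reflexive (sym (^-zeroˡ m))) (^-monoˡ-≤ m 1≤q)))}} (begin
  q * q ^ m * (L * y ^ m)            ≡⟨ a₁ q (q ^ m) L (y ^ m) ⟩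
  q ^ m * (L * q) * y ^ m            ≤⟨ *-monoˡ-≤ (y ^ m) (*-monoʳ-≤ (q ^ m) (≤-trans Lq≤m (m≤n+m m q))) ⟩
  q ^ m * (q + m) * y ^ m            ≤⟨ *-monoˡ-≤ (y ^ m) (bernoulli q m) ⟩
  suc q ^ m * q * y ^ m              ≡⟨ a₂ (suc q ^ m) q (y ^ m) ⟩
  q * (suc q ^ m * y ^ m)            ≡⟨ cong (q *_) (^-distribʳ-* m (suc q) y) ⟨
  q * (suc q * y) ^ m                ≤⟨ *-monoʳ-≤ q (^-monoˡ-≤ m gap) ⟩
  q * (q * x) ^ m                    ≡⟨ cong (q *_) (^-distribʳ-* m q x) ⟩
  q * (q ^ m * x ^ m)                ≡⟨ *-assoc q (q ^ m) (x ^ m) ⟨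
  q * q ^ m * x ^ m                  ∎)
  where
  open ≤-Reasoning
  a₁ : ∀ q p L y → q * p * (L * y) ≡ p * (L * q) * y
  a₁ = solve-∀
  a₂ : ∀ s q y → s * q * y ≡ q * (s * y)
  a₂ = solve-∀

-- X ≲[ d ] Y means X ≤ Y + o(nᵈ), uniformly over the index set I with size n = sz i.
module Asymptotics (I : Set₁) (sz : I → ℕ) (sz-pos : ∀ i → 1 ≤ sz i) where

  infix 4 _≲[_]_
  infixr 4 _,ᵇ_

  record _≲[_]_ (X : I → ℕ) (d : ℕ) (Y : I → ℕ) : Set₁ where
    constructor asymptotically
    field within : ∀ N → ∃[ n₀ ] (∀ i → n₀ ≤ sz i → N * X i ≤ N * Y i + sz i ^ d)

  open _≲[_]_ public

  ≤⇒≲ : ∀ {X Y d} → (∀ i → X i ≤ Y i) → X ≲[ d ] Y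
  ≤⇒≲ h = asymptotically λ N → 0 , λ i _ → ≤-trans (*-monoʳ-≤ N (h i)) (m≤m+n _ _)

  ≲-cong : ∀ {X X′ Y Y′ d} → (∀ i → X i ≡ X′ i) → (∀ i → Y i ≡ Y′ i) → X ≲[ d ] Y → X′ ≲[ d ] Y′
  ≲-cong {d = d} eX eY h = asymptotically λ N → let n₀ , b = within h N in n₀ , λ i le → subst₂ (λ x y → N * x ≤ N * y + sz i ^ d) (eX i) (eY i) (b i le)

  ≲-order : ∀ {X Y d d′} → d ≡ d′ → X ≲[ d ] Y → X ≲[ d′ ] Y
  ≲-order refl h = h

  ≲-+ : ∀ {X X′ Y Y′ d} → X ≲[ d ] Y → X′ ≲[ d ] Y′ → (λ i → X i + X′ i) ≲[ d ] (λ i → Y i + Y′ i)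
  ≲-+ {X} {X′} {Y} {Y′} {d} h h′ = asymptotically λ N →
    let n₁ , b₁ = within h (2 * N) ; n₂ , b₂ = within h′ (2 * N) in
    n₁ + n₂ , λ i le → *-cancelˡ-≤ 2 (begin
      2 * (N * (X i + X′ i))                                         ≡⟨ a₁ N (X i) (X′ i) ⟩
      2 * N * X i + 2 * N * X′ i                                     ≤⟨ +-mono-≤ (b₁ i (≤-trans (m≤m+n n₁ n₂) le)) (b₂ i (≤-trans (m≤n+m n₂ n₁) le)) ⟩
      (2 * N * Y i + sz i ^ d) + (2 * N * Y′ i + sz i ^ d)           ≡⟨ a₂ N (Y i) (Y′ i) (sz i ^ d) ⟩
      2 * (N * (Y i + Y′ i) + sz i ^ d)                              ∎)
    where
    open ≤-Reasoning
    a₁ : ∀ N x x′ → 2 * (N * (x + x′)) ≡ 2 * N * x + 2 * N * x′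
    a₁ = solve-∀
    a₂ : ∀ N y y′ p → (2 * N * y + p) + (2 * N * y′ + p) ≡ 2 * (N * (y + y′) + p)
    a₂ = solve-∀

  ≲-cancel-+ : ∀ {X Y d} (Z : I → ℕ) → (λ i → X i + Z i) ≲[ d ] (λ i → Y i + Z i) → X ≲[ d ] Y
  ≲-cancel-+ {X} {Y} {d} Z h = asymptotically λ N → let n₀ , b = within h N in n₀ , λ i le → +-cancelʳ-≤ (N * Z i) _ _ (begin
      N * X i + N * Z i                     ≡⟨ *-distribˡ-+ N (X i) (Z i) ⟨
      N * (X i + Z i)                       ≤⟨ b i le ⟩
      N * (Y i + Z i) + sz i ^ d            ≡⟨ a₁ N (Y i) (Z i) (sz i ^ d) ⟩
      N * Y i + sz i ^ d + N * Z i          ∎)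
    where
    open ≤-Reasoning
    a₁ : ∀ N y z p → N * (y + z) + p ≡ N * y + p + N * z
    a₁ = solve-∀

  ≲-trans : ∀ {X Y Z d} → X ≲[ d ] Y → Y ≲[ d ] Z → X ≲[ d ] Z
  ≲-trans {X} {Y} {Z} h h′ = ≲-cancel-+ Y (≲-cong (λ _ → refl) (λ i → +-comm (Y i) (Z i)) (≲-+ h h′))

  -- The constant is `suc factor`, hence positive, so that it can be cancelled in `≲-*`.
  record Bounded (e : ℕ) (Z : I → ℕ) : Set₁ where
    constructor _,ᵇ_
    field
      factor : ℕ
      bound  : ∀ i → Z i ≤ suc factor * sz i ^ e

  ≲-* : ∀ {X Y d e} Z → Bounded e Z → X ≲[ d ] Y → (λ i → X i * Z i) ≲[ d + e ] (λ i → Y i * Z i)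
  ≲-* {X} {Y} {d} {e} Z (C ,ᵇ bZ) h = asymptotically λ N → let n₀ , b = within h (suc C * N) in n₀ , λ i le → *-cancelˡ-≤ (suc C) (begin
      suc C * (N * (X i * Z i))                          ≡⟨ a₁ (suc C) N (X i) (Z i) ⟩
      suc C * N * X i * Z i                              ≤⟨ *-monoˡ-≤ (Z i) (b i le) ⟩
      (suc C * N * Y i + sz i ^ d) * Z i                 ≡⟨ *-distribʳ-+ (Z i) (suc C * N * Y i) _ ⟩
      suc C * N * Y i * Z i + sz i ^ d * Z i             ≤⟨ +-monoʳ-≤ (suc C * N * Y i * Z i) (*-monoʳ-≤ (sz i ^ d) (bZ i)) ⟩
      suc C * N * Y i * Z i + sz i ^ d * (suc C * sz i ^ e)   ≡⟨ a₂ (suc C) N (Y i) (Z i) (sz i ^ d) (sz i ^ e) ⟩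
      suc C * (N * (Y i * Z i) + sz i ^ d * sz i ^ e)    ≡⟨ cong (λ p → suc C * (N * (Y i * Z i) + p)) (^-distribˡ-+-* (sz i) d e) ⟨
      suc C * (N * (Y i * Z i) + sz i ^ (d + e))         ∎)
    where
    open ≤-Reasoning
    a₁ : ∀ c N x z → c * (N * (x * z)) ≡ c * N * x * z
    a₁ = solve-∀
    a₂ : ∀ c N y z p q → c * N * y * z + p * (c * q) ≡ c * (N * (y * z) + p * q)
    a₂ = solve-∀

  ≲-*c : ∀ {X Y d} c → X ≲[ d ] Y → (λ i → c * X i) ≲[ d ] (λ i → c * Y i)
  ≲-*c {X} {Y} {d} c h = ≲-order (+-identityʳ d) (≲-cong (λ i → *-comm (X i) c) (λ i → *-comm (Y i) c)
    (≲-* (λ _ → c) (c ,ᵇ λ i → ≤-trans (n≤1+n c) (≤-reflexive (sym (*-identityʳ (suc c))))) h))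

  ≲-*n : ∀ {X Y d} e → X ≲[ d ] Y → (λ i → sz i ^ e * X i) ≲[ d + e ] (λ i → sz i ^ e * Y i)
  ≲-*n {X} {Y} e h = ≲-cong (λ i → *-comm (X i) _) (λ i → *-comm (Y i) _) (≲-* (λ i → sz i ^ e) (0 ,ᵇ λ i → ≤-reflexive (sym (*-identityˡ _))) h)

  ≲-** : ∀ {X X′ Y Y′ d d′} → Bounded d′ X′ → Bounded d Y → X ≲[ d ] Y → X′ ≲[ d′ ] Y′ →
    (λ i → X i * X′ i) ≲[ d + d′ ] (λ i → Y i * Y′ i)
  ≲-** {X} {X′} {Y} {Y′} {d} {d′} bX′ bY h h′ = ≲-trans (≲-* X′ bX′ h)
    (≲-order (+-comm d′ d) (≲-cong (λ i → *-comm (X′ i) (Y i)) (λ i → *-comm (Y′ i) (Y i)) (≲-* Y bY h′)))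

  ≲-cancel-c : ∀ {X Y d} c → 1 ≤ c → (λ i → c * X i) ≲[ d ] (λ i → c * Y i) → X ≲[ d ] Y
  ≲-cancel-c {X} {Y} {d} c 1≤c h = asymptotically λ N → let n₀ , b = within h N in n₀ , λ i le → *-cancelˡ-≤ c {{>-nonZero 1≤c}} (begin
      c * (N * X i)                    ≡⟨ x∙yz≈y∙xz c N (X i) ⟩
      N * (c * X i)                    ≤⟨ b i le ⟩
      N * (c * Y i) + sz i ^ d         ≤⟨ +-monoʳ-≤ (N * (c * Y i)) (≤-trans (≤-reflexive (sym (*-identityˡ _))) (*-monoˡ-≤ (sz i ^ d) 1≤c)) ⟩
      N * (c * Y i) + c * sz i ^ d     ≡⟨ a₂ c N (Y i) (sz i ^ d) ⟩
      c * (N * Y i + sz i ^ d)         ∎)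
    where
    open ≤-Reasoning
    a₂ : ∀ c N y p → N * (c * y) + c * p ≡ c * (N * y + p)
    a₂ = solve-∀

  n^>0 : ∀ i e → NonZero (sz i ^ e)
  n^>0 i e = >-nonZero (≤-trans (≤-reflexive (sym (^-zeroˡ e))) (^-monoˡ-≤ e (sz-pos i)))

  ≲-cancel-n : ∀ {X Y d} e → (λ i → sz i ^ e * X i) ≲[ d + e ] (λ i → sz i ^ e * Y i) → X ≲[ d ] Y
  ≲-cancel-n {X} {Y} {d} e h = asymptotically λ N → let n₀ , b = within h N in n₀ , λ i le → *-cancelˡ-≤ (sz i ^ e) {{n^>0 i e}} (begin
      sz i ^ e * (N * X i)                              ≡⟨ x∙yz≈y∙xz (sz i ^ e) N (X i) ⟩
      N * (sz i ^ e * X i)                              ≤⟨ b i le ⟩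
      N * (sz i ^ e * Y i) + sz i ^ (d + e)             ≡⟨ cong (N * (sz i ^ e * Y i) +_) (^-distribˡ-+-* (sz i) d e) ⟩
      N * (sz i ^ e * Y i) + sz i ^ d * sz i ^ e        ≡⟨ a₂ (sz i ^ e) N (Y i) (sz i ^ d) ⟩
      sz i ^ e * (N * Y i + sz i ^ d)                   ∎)
    where
    open ≤-Reasoning
    a₂ : ∀ c N y p → N * (c * y) + p * c ≡ c * (N * y + p)
    a₂ = solve-∀

  ≲-lower-order : ∀ {X d} → Bounded d X → X ≲[ suc d ] (λ _ → 0)
  ≲-lower-order {X} {d} (C ,ᵇ bX) = asymptotically λ N → N * suc C , λ i le → begin
      N * X i                           ≤⟨ *-monoʳ-≤ N (bX i) ⟩
      N * (suc C * sz i ^ d)            ≡⟨ *-assoc N (suc C) _ ⟨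
      N * suc C * sz i ^ d              ≤⟨ *-monoˡ-≤ (sz i ^ d) le ⟩
      sz i * sz i ^ d                   ≤⟨ m≤n+m _ (N * 0) ⟩
      N * 0 + sz i * sz i ^ d           ∎
    where open ≤-Reasoning

  ≲-sqrt : ∀ {X d} → (λ i → X i * X i) ≲[ d + d ] (λ _ → 0) → X ≲[ d ] (λ _ → 0)
  ≲-sqrt {X} {d} h = asymptotically λ N → let n₀ , b = within h (N * N) in n₀ , λ i le → ≮⇒≥ λ big → <⇒≱ (squared N i big) (begin
      N * X i * (N * X i)                       ≡⟨ a₁ N (X i) ⟩
      N * N * (X i * X i)                       ≤⟨ b i le ⟩
      N * N * 0 + sz i ^ (d + d)                ≡⟨ cong₂ _+_ (*-zeroʳ (N * N)) (^-distribˡ-+-* (sz i) d d) ⟩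
      sz i ^ d * sz i ^ d                       ∎)
    where
    open ≤-Reasoning
    a₁ : ∀ N x → N * x * (N * x) ≡ N * N * (x * x)
    a₁ = solve-∀
    squared : ∀ N i → N * 0 + sz i ^ d < N * X i → sz i ^ d * sz i ^ d < N * X i * (N * X i)
    squared N i big = *-mono-< lt lt
      where lt = ≤-trans (≤-reflexive (cong suc (sym (cong (_+ sz i ^ d) (*-zeroʳ N))))) big

  -- If NX exceeded NY + nᵈ, then Y ≤ (C+1)nᵈ would make the gap at least 1/q in proportion, and a
  -- high power m would turn it into a factor 2K. Of two copies of (NX)ᵐ, one then beats the term
  -- with K and the other the error, against the hypothesis with accuracy 2Nᵐ.
  ≲-amplify : ∀ {X Y d κ K} → 1 ≤ κ → 1 ≤ K → Bounded d Y →
    (∀ i → (λ s → κ * X s ^ (2 ^ i)) ≲[ d * 2 ^ i ] (λ s → K * Y s ^ (2 ^ i))) → X ≲[ d ] Y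
  ≲-amplify {X} {Y} {d} {κ} {K} 1≤κ 1≤K (C ,ᵇ bY) h = asymptotically λ { zero → 0 , (λ i _ → z≤n) ; (suc N′) → amplified N′ }
   where
   amplified : ∀ N′ → ∃[ n₀ ] (∀ i → n₀ ≤ sz i → suc N′ * X i ≤ suc N′ * Y i + sz i ^ d)
   amplified N′ = let n₀ , b = within (h j) (2 * N ^ m) in n₀ , λ i le → ≮⇒≥ λ gap → <⇒≱ (contradiction′ i gap) (b i le)
    where
    N = suc N′
    open ≤-Reasoning
    q = suc C * N
    -- Only exponents 2ʲ are available; 2ʲ > j makes this one large enough for `power-gap`.
    j = 2 * K * q
    m = 2 ^ j
    1≤q : 1 ≤ q
    1≤q = s≤s z≤n
    contradiction′ : ∀ i → N * Y i + sz i ^ d < N * X i → 2 * N ^ m * (K * Y i ^ m) + sz i ^ (d * m) < 2 * N ^ m * (κ * X i ^ m)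
    contradiction′ i gap = begin-strict
      2 * N ^ m * (K * Y i ^ m) + sz i ^ (d * m)        ≡⟨ cong₂ _+_ (a₁ (N ^ m) K (Y i ^ m)) (sym (^-*-assoc (sz i) d m)) ⟩
      N ^ m * (2 * K * Y i ^ m) + (sz i ^ d) ^ m        <⟨ +-mono-≤-< (*-monoʳ-≤ (N ^ m) powers) sizes ⟩
      N ^ m * X i ^ m + N ^ m * X i ^ m                 ≡⟨ a₂ (N ^ m * X i ^ m) ⟩
      2 * (N ^ m * X i ^ m)                             ≤⟨ *-monoˡ-≤ _ (≤-trans (≤-reflexive (sym (*-identityʳ 2))) (*-monoʳ-≤ 2 1≤κ)) ⟩
      2 * κ * (N ^ m * X i ^ m)                         ≡⟨ a₃ κ (N ^ m) (X i ^ m) ⟩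
      2 * N ^ m * (κ * X i ^ m)                         ∎
      where
      a₁ : ∀ p K y → 2 * p * (K * y) ≡ p * (2 * K * y)
      a₁ = solve-∀
      a₂ : ∀ x → x + x ≡ 2 * x
      a₂ = solve-∀
      a₃ : ∀ κ p x → 2 * κ * (p * x) ≡ 2 * p * (κ * x)
      a₃ = solve-∀
      a₄ : ∀ c N y p → c * (N * y + p) ≡ c * N * y + c * p
      a₄ = solve-∀
      powers : 2 * K * Y i ^ m ≤ X i ^ m
      powers = power-gap {q} {X i} {Y i} {2 * K} m 1≤q (<⇒≤ (m<2^m j)) (begin
        Y i + q * Y i                          ≡⟨ +-comm (Y i) _ ⟩
        q * Y i + Y i                          ≤⟨ +-monoʳ-≤ (q * Y i) (bY i) ⟩
        q * Y i + suc C * sz i ^ d             ≡⟨ a₄ (suc C) N (Y i) (sz i ^ d) ⟨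
        suc C * (N * Y i + sz i ^ d)           ≤⟨ *-monoʳ-≤ (suc C) (<⇒≤ gap) ⟩
        suc C * (N * X i)                      ≡⟨ *-assoc (suc C) N (X i) ⟨
        q * X i                                ∎)
      sizes : (sz i ^ d) ^ m < N ^ m * X i ^ m
      sizes = subst ((sz i ^ d) ^ m <_) (^-distribʳ-* m N (X i))
        (^-monoˡ-< m {{>-nonZero (m^n>0 2 j)}} (≤-trans (s≤s (m≤n+m (sz i ^ d) (N * Y i))) gap))

-- Walks

walk : ∀ {n} → Graph n → ℕ → Fin n → ℕ
walk G zero    _ = 1
walk G (suc a)   = op G true (walk G a)

walks : ∀ {n} → Graph n → ℕ → ℕ
walks G a = ∑ (walk G a)

op-adjoint : ∀ {n} (G : Graph n) b x y → ∑ (λ v → x v * op G b y v) ≡ ∑ (λ v → op G b x v * y v)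
op-adjoint G b x y = begin
  ∑ (λ v → x v * op G b y v)                    ≡⟨ sum-cong-≗ (λ v → *-distribˡ-sum (x v) λ u → link G b v u * y u) ⟩
  ∑ (λ v → ∑ λ u → x v * (link G b v u * y u))  ≡⟨ ∑-comm (λ v u → x v * (link G b v u * y u)) ⟩
  ∑ (λ u → ∑ λ v → x v * (link G b v u * y u))  ≡⟨ sum-cong-≗ (λ u → trans (sum-cong-≗ λ v → trans (x∙yz≈yx∙z (x v) (link G b v u) (y u)) (cong (λ l → l * x v * y u) (link-sym G b v u))) (sym (*-distribʳ-sum (y u) λ v → link G b u v * x v))) ⟩
  ∑ (λ u → op G b x u * y u)                    ∎
  where
  open ≡-Reasoning

-- A walk with a + b edges is cut at an inner vertex; by symmetry of adjacency edges can move from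
-- one factor to the other.
walk-inner : ∀ {n} (G : Graph n) a b → ∑ (λ v → walk G a v * walk G b v) ≡ walks G (a + b)
walk-inner G zero    b = sum-cong-≗ λ v → *-identityˡ (walk G b v)
walk-inner G (suc a) b = trans (sym (op-adjoint G true (walk G a) (walk G b)))
  (trans (walk-inner G a (suc b)) (cong (walks G) (+-suc a b)))

op-bound : ∀ {n} (G : Graph n) b y c → (∀ v → y v ≤ c) → ∀ v → op G b y v ≤ n * c
op-bound G b y c le v = ∑-bound c λ u → ≤-trans (*-mono-≤ (link≤1 G b v u) (le u)) (≤-reflexive (*-identityˡ c))

walk≤ : ∀ {n} (G : Graph n) a v → walk G a v ≤ n ^ a
walk≤ G zero    v = ≤-refl
walk≤ G (suc a) v = op-bound G true (walk G a) _ (walk≤ G a) v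

walks≤ : ∀ {n} (G : Graph n) a → walks G a ≤ n ^ suc a
walks≤ G a = ∑-bound _ (walk≤ G a)

W≤ : ∀ {n m} (G : Graph n) (bs : Vec Bool m) v → W G bs v ≤ n ^ m
W≤ G []       v = ≤-refl
W≤ G (b ∷ bs) v = op-bound G b (W G bs) _ (W≤ G bs) v

op≤∑ : ∀ {n} (G : Graph n) b y v → op G b y v ≤ ∑ y
op≤∑ G b y v = ∑-mono λ u → ≤-trans (*-monoˡ-≤ (y u) (link≤1 G b v u)) (≤-reflexive (*-identityˡ _))

walks-suc : ∀ {n} (G : Graph n) a → walks G (suc a) ≤ n * walks G a
walks-suc G a = ∑-bound _ (op≤∑ G true (walk G a))

cauchy-schwarz : ∀ {n} (x : Fin n → ℕ) → ∑ x * ∑ x ≤ n * ∑ (λ v → x v * x v)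
cauchy-schwarz {n} x = *-cancelˡ-≤ 2 (begin
  2 * (∑ x * ∑ x)                                       ≡⟨ cong (2 *_) (trans (*-distribʳ-sum (∑ x) x) (sum-cong-≗ λ u → *-distribˡ-sum (x u) x)) ⟩
  2 * ∑ (λ u → ∑ λ v → x u * x v)                       ≡⟨ trans (*-distribˡ-sum 2 λ u → ∑ λ v → x u * x v) (sum-cong-≗ λ u → *-distribˡ-sum 2 λ v → x u * x v) ⟩
  ∑ (λ u → ∑ λ v → 2 * (x u * x v))                     ≤⟨ ∑-mono (λ u → ∑-mono λ v → am-gm (x u) (x v)) ⟩
  ∑ (λ u → ∑ λ v → x u * x u + x v * x v)               ≡⟨ sum-cong-≗ (λ u → trans (∑-distrib-+ (λ _ → x u * x u) λ v → x v * x v) (cong (_+ q) (∑-const n (x u * x u)))) ⟩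
  ∑ (λ u → n * (x u * x u) + q)                         ≡⟨ trans (∑-distrib-+ (λ u → n * (x u * x u)) _) (cong₂ _+_ (sym (*-distribˡ-sum n λ u → x u * x u)) (∑-const n q)) ⟩
  n * q + n * q                                         ≡⟨ double (n * q) ⟩
  2 * (n * q)                                           ∎)
  where
  open ≤-Reasoning
  q = ∑ λ v → x v * x v
  double : ∀ x → x + x ≡ 2 * x
  double = solve-∀
  am-gm : ∀ x y → 2 * (x * y) ≤ x * x + y * y
  am-gm x y with ≤-total x y
  ... | inj₁ x≤y = subst (λ y → 2 * (x * y) ≤ x * x + y * y) (m+[n∸m]≡n x≤y) (≤-trans (m≤m+n _ ((y ∸ x) * (y ∸ x))) (≤-reflexive (square x (y ∸ x))))
    where
    square : ∀ x d → 2 * (x * (x + d)) + d * d ≡ x * x + (x + d) * (x + d)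
    square = solve-∀
  ... | inj₂ y≤x = subst (λ x → 2 * (x * y) ≤ x * x + y * y) (m+[n∸m]≡n y≤x) (≤-trans (m≤m+n _ ((x ∸ y) * (x ∸ y))) (≤-reflexive (square y (x ∸ y))))
    where
    square : ∀ y d → 2 * ((y + d) * y) + d * d ≡ (y + d) * (y + d) + y * y
    square = solve-∀

walks² : ∀ {n} (G : Graph n) a → walks G a * walks G a ≤ n * walks G (a + a)
walks² {n} G a = ≤-trans (cauchy-schwarz (walk G a)) (≤-reflexive (cong (n *_) (walk-inner G a a)))

-- Walks whose number of vertices is 2ⁱ (a + 1).
doubled : ℕ → ℕ → ℕ
doubled a zero    = a
doubled a (suc i) = doubled a i + suc (doubled a i)

suc-doubled : ∀ a i → suc (doubled a i) ≡ suc a * 2 ^ i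
suc-doubled a zero    = sym (*-identityʳ (suc a))
suc-doubled a (suc i) = trans (cong₂ _+_ (suc-doubled a i) (suc-doubled a i)) (arrange (suc a) (2 ^ i))
  where
  arrange : ∀ a p → a * p + a * p ≡ a * (2 * p)
  arrange = solve-∀

^-double : ∀ x i → x ^ (2 ^ suc i) ≡ x ^ (2 ^ i) * x ^ (2 ^ i)
^-double x i = trans (cong (λ e → x ^ (2 ^ i + e)) (+-identityʳ (2 ^ i))) (^-distribˡ-+-* x (2 ^ i) (2 ^ i))

-- Repeated squaring by `walks²` from a + 1 edges. Here the number of edges doubles, whereas the
-- Turán bound doubles the number of vertices.
walks-power : ∀ {n} (G : Graph (suc n)) a i →
  walks G (suc a) ^ (2 ^ i) * suc n ≤ suc n ^ (2 ^ i) * walks G (suc (doubled a i))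
walks-power {n} G a zero    = ≤-reflexive (arrange (walks G (suc a)) (suc n))
  where
  arrange : ∀ w s → w * 1 * s ≡ s * 1 * w
  arrange = solve-∀
walks-power {n} G a (suc i) = *-cancelʳ-≤ _ _ (suc n) (begin
  w ^ (2 ^ suc i) * s * s                        ≡⟨ cong (λ p → p * s * s) (^-double w i) ⟩
  w ^ (2 ^ i) * w ^ (2 ^ i) * s * s              ≡⟨ a₁ (w ^ (2 ^ i)) s ⟩
  w ^ (2 ^ i) * s * (w ^ (2 ^ i) * s)            ≤⟨ *-mono-≤ (walks-power G a i) (walks-power G a i) ⟩
  s ^ (2 ^ i) * w′ * (s ^ (2 ^ i) * w′)          ≡⟨ a₂ (s ^ (2 ^ i)) w′ ⟩
  s ^ (2 ^ i) * s ^ (2 ^ i) * (w′ * w′)          ≤⟨ *-monoʳ-≤ (s ^ (2 ^ i) * s ^ (2 ^ i)) (walks² G (suc (doubled a i))) ⟩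
  s ^ (2 ^ i) * s ^ (2 ^ i) * (s * w″)           ≡⟨ cong (_* (s * w″)) (^-double s i) ⟨
  s ^ (2 ^ suc i) * (s * w″)                     ≡⟨ x∙yz≈xz∙y (s ^ (2 ^ suc i)) s w″ ⟩
  s ^ (2 ^ suc i) * w″ * s                       ∎)
  where
  open ≤-Reasoning
  s = suc n
  w = walks G (suc a)
  w′ = walks G (suc (doubled a i))
  w″ = walks G (suc (doubled a (suc i)))
  a₁ : ∀ p s → p * p * s * s ≡ p * s * (p * s)
  a₁ = solve-∀
  a₂ : ∀ p w → p * w * (p * w) ≡ p * p * (w * w)
  a₂ = solve-∀

-- Dropping one edge at the cost of a factor n turns 2ⁱ(a+1) edges into 2ⁱ(a+1) vertices, the length
-- that `walks-doubled` controls.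
walks-power′ : ∀ {n} (G : Graph (suc n)) a i →
  walks G (suc a) ^ (2 ^ i) ≤ suc n ^ (2 ^ i) * walks G (doubled a i)
walks-power′ {n} G a i = *-cancelʳ-≤ _ _ (suc n) (≤-trans (walks-power G a i)
  (≤-trans (*-monoʳ-≤ (suc n ^ (2 ^ i)) (walks-suc G (doubled a i))) (≤-reflexive (x∙yz≈xz∙y (suc n ^ (2 ^ i)) (suc n) (walks G (doubled a i))))))

-- Graphs without light vertices

module Heaviness {f κ m : ℕ} {F : Graph f} (C : Critical F (suc κ)) (1≤κ : 1 ≤ κ) (bs : Vec Bool m) where

  K = suc κ

  -- The number of embeddings into the Turán graph through its last vertex, which is the
  -- increment of the extremal function.
  δ : ℕ → ℕ
  δ n = through (turán (suc n) K) bs (fromℕ n)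

  -- The index set of the asymptotics, containing both the graph and the vertex z, so that errors
  -- are uniform in both. Only a vertex of degree at most (κ/k)n needs attention; for the others
  -- `minDegree` is immediate.
  record Situation : Set₁ where
    field
      order : ℕ
      G     : Graph (suc order)
      free  : G IsFree F
      heavy : ∀ v → δ order ≤ through G bs v
      z     : Fin (suc order)
      low   : K * deg G z ≤ κ * suc order

  open Situation

  n : Situation → ℕ
  n i = suc (order i)

  open Asymptotics Situation n (λ _ → s≤s z≤n)

  w : ℕ → Situation → ℕ
  w a i = walks (G i) a

  ≲-*n₁ : ∀ {X Y d} → X ≲[ d ] Y → (λ i → n i * X i) ≲[ suc d ] (λ i → n i * Y i)
  ≲-*n₁ {X} {Y} {d} h = ≲-order (+-comm d 1) (≲-cong (λ i → cong (_* X i) (*-identityʳ (n i))) (λ i → cong (_* Y i) (*-identityʳ (n i))) (≲-*n 1 h))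

  bounded-c : ∀ {e Z} c → Bounded e Z → Bounded e (λ i → c * Z i)
  bounded-c {e} c (D ,ᵇ b) = c * suc D ,ᵇ λ i → ≤-trans (*-monoʳ-≤ c (b i)) (≤-trans (≤-reflexive (sym (*-assoc c (suc D) _))) (m≤n+m _ (n i ^ e)))

  bounded-n^ : ∀ e → Bounded e (λ i → n i ^ e)
  bounded-n^ e = 0 ,ᵇ λ i → ≤-reflexive (sym (*-identityˡ _))

  bounded-w : ∀ a → Bounded (suc a) (w a)
  bounded-w a = 0 ,ᵇ λ i → ≤-trans (walks≤ (G i) a) (≤-reflexive (sym (*-identityˡ _)))

  -- `weighted-turán` for the weights `walk a`: their energy is w(2a+1) and their maximum is at most
  -- nᵃ.
  walks-double : ∀ a → (λ i → K * w (a + suc a) i) ≲[ suc a + suc a ] (λ i → κ * (w a i * w a i))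
  walks-double a = asymptotically λ N → let n₀ , b = weighted-turán C N in n₀ , λ i le →
    +-cancelʳ-≤ (N * (w a i * w a i)) _ _ (begin
      N * (K * w (a + suc a) i) + N * (w a i * w a i)                         ≡⟨ *-distribˡ-+ N _ _ ⟨
      N * (K * w (a + suc a) i + w a i * w a i)                               ≡⟨ cong (λ e → N * (K * e + w a i * w a i)) (walk-inner (G i) a (suc a)) ⟨
      N * (K * energy (G i) (walk (G i) a) + w a i * w a i)                   ≤⟨ b (G i) le (free i) (n i ^ a) (walk (G i) a) (walk≤ (G i) a) ⟩
      N * (K * (w a i * w a i)) + n i * (n i * (n i ^ a * n i ^ a))           ≡⟨ cong₂ _+_ (a₁ N κ (w a i * w a i)) (trans (a₂ (n i) (n i ^ a)) (sym (^-distribˡ-+-* (n i) (suc a) (suc a)))) ⟩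
      N * (κ * (w a i * w a i)) + N * (w a i * w a i) + n i ^ (suc a + suc a) ≡⟨ a₃ (N * (κ * (w a i * w a i))) (N * (w a i * w a i)) (n i ^ (suc a + suc a)) ⟩
      N * (κ * (w a i * w a i)) + n i ^ (suc a + suc a) + N * (w a i * w a i) ∎)
    where
    open ≤-Reasoning
    a₁ : ∀ N κ x → N * (suc κ * x) ≡ N * (κ * x) + N * x
    a₁ = solve-∀
    a₂ : ∀ n p → n * (n * (p * p)) ≡ n * p * (n * p)
    a₂ = solve-∀
    a₃ : ∀ x y z → x + y + z ≡ x + z + y
    a₃ = solve-∀

  -- Iteration of `walks-double` yields (κ/k) to the power 2ⁱ - 1. The extra κ on the left and K on
  -- the right restore the exponent 2ⁱ; such constants do no harm in `≲-amplify`.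
  walks-doubled : ∀ a i → (λ s → κ * (K ^ (2 ^ i) * w (doubled a i) s)) ≲[ suc (doubled a i) ] (λ s → K * (κ ^ (2 ^ i) * w a s ^ (2 ^ i)))
  walks-doubled a zero = ≤⇒≲ λ s → ≤-reflexive (arrange κ (w a s))
    where
    arrange : ∀ κ x → κ * (suc κ * 1 * x) ≡ suc κ * (κ * 1 * (x * 1))
    arrange = solve-∀
  walks-doubled a (suc i) = ≲-cancel-c K (s≤s z≤n) (≲-trans
    (≲-cong
      (λ s → trans (a₁ κ (K ^ M * K ^ M) K (w (d + suc d) s)) (cong (λ p → K * (κ * (p * w (d + suc d) s))) (sym (^-double K i))))
      (λ s → a₂ κ (K ^ M) (w d s))
      (≲-*c (κ * (K ^ M * K ^ M)) (walks-double d)))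
    (≲-cong (λ _ → refl)
      (λ s → trans (a₃ K (κ ^ M) (w a s ^ M)) (cong₂ (λ p q → K * (K * (p * q))) (sym (^-double κ i)) (sym (^-double (w a s) i))))
      (≲-** (bounded-c κ (bounded-c (K ^ M) (bounded-w d))) (bounded-c K (bounded-c (κ ^ M) bounded-power)) (walks-doubled a i) (walks-doubled a i))))
    where
    M = 2 ^ i
    d = doubled a i
    a₁ : ∀ κ p K x → κ * p * (K * x) ≡ K * (κ * (p * x))
    a₁ = solve-∀
    a₂ : ∀ κ p x → κ * (p * p) * (κ * (x * x)) ≡ κ * (p * x) * (κ * (p * x))
    a₂ = solve-∀
    a₃ : ∀ K p x → K * (p * x) * (K * (p * x)) ≡ K * (K * (p * p * (x * x)))
    a₃ = solve-∀
    bounded-power : Bounded (suc d) (λ s → w a s ^ M)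
    bounded-power = 0 ,ᵇ λ s → ≤-trans (^-monoˡ-≤ M (walks≤ (G s) a))
      (≤-reflexive (trans (^-*-assoc (n s) (suc a) M) (trans (cong (n s ^_) (sym (suc-doubled a i))) (sym (*-identityˡ _)))))

  -- Chaining `walks-power′` with `walks-doubled` eliminates the long walks and leaves the 2ⁱ-th
  -- power of the claim up to the constants κ and K; `≲-amplify` takes the root.
  walks-ratio : ∀ a → (λ i → K * w (suc a) i) ≲[ suc (suc a) ] (λ i → κ * (n i * w a i))
  walks-ratio a = ≲-amplify {κ = κ} {K = K} 1≤κ (s≤s z≤n) (bounded-c κ (0 ,ᵇ λ i → ≤-trans (*-monoʳ-≤ (n i) (walks≤ (G i) a)) (≤-reflexive (sym (*-identityˡ _))))) amplified
    where
    amplified : ∀ i → (λ s → κ * (K * w (suc a) s) ^ (2 ^ i)) ≲[ suc (suc a) * 2 ^ i ] (λ s → K * (κ * (n s * w a s)) ^ (2 ^ i))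
    amplified i = ≲-trans (≤⇒≲ bound)
      (≲-order (trans (cong (_+ M) (suc-doubled a i)) (+-comm (suc a * M) M))
        (≲-cong (λ _ → refl) (λ s → trans (a₂ (n s ^ M) K (κ ^ M) (w a s ^ M))
            (cong (K *_) (trans (cong (κ ^ M *_) (sym (^-distribʳ-* M (n s) (w a s)))) (sym (^-distribʳ-* M κ (n s * w a s))))))
          (≲-*n M (walks-doubled a i))))
      where
      M = 2 ^ i
      a₁ : ∀ κ p q x → κ * (p * (q * x)) ≡ q * (κ * (p * x))
      a₁ = solve-∀
      a₂ : ∀ q K p x → q * (K * (p * x)) ≡ K * (p * (q * x))
      a₂ = solve-∀
      bound : ∀ s → κ * (K * w (suc a) s) ^ M ≤ n s ^ M * (κ * (K ^ M * w (doubled a i) s))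
      bound s = ≤-trans (*-monoʳ-≤ κ (≤-trans (≤-reflexive (^-distribʳ-* M K (w (suc a) s))) (*-monoʳ-≤ (K ^ M) (walks-power′ (G s) a i))))
        (≤-reflexive (a₁ κ (K ^ M) (n s ^ M) (w (doubled a i) s)))

  -- X is asymptotically at most (κ/K)ᵉ nᵈ.
  Up : ℕ → ℕ → (Situation → ℕ) → Set₁
  Up e d X = (λ i → K ^ e * X i) ≲[ d ] (λ i → κ ^ e * n i ^ d)

  -- X is asymptotically at most (κ/K)ᵉ⁻¹ nᵈ⁻² times the number of walks of length 1.
  Up₂ : ℕ → ℕ → (Situation → ℕ) → Set₁
  Up₂ e d X = (λ i → κ * (n i * (n i * (K ^ e * X i)))) ≲[ suc (suc d) ] (λ i → K * (κ ^ e * (n i ^ d * w 1 i)))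

  up-* : ∀ {e d e′ d′ X X′} → Bounded d′ X′ → Up e d X → Up e′ d′ X′ → Up (e + e′) (d + d′) (λ i → X i * X′ i)
  up-* {e} {d} {e′} {d′} {X} {X′} b h h′ = ≲-cong
    (λ i → trans (interchange (K ^ e) (X i) (K ^ e′) (X′ i)) (cong (_* (X i * X′ i)) (sym (^-distribˡ-+-* K e e′))))
    (λ i → trans (interchange (κ ^ e) (n i ^ d) (κ ^ e′) (n i ^ d′)) (cong₂ _*_ (sym (^-distribˡ-+-* κ e e′)) (sym (^-distribˡ-+-* (n i) d d′))))
    (≲-** (bounded-c (K ^ e′) b) (bounded-c (κ ^ e) (bounded-n^ d)) h h′)

  up₂-* : ∀ {e d e′ d′ X X′} → Bounded d′ X′ → Up₂ e d X → Up e′ d′ X′ → Up₂ (e + e′) (d + d′) (λ i → X i * X′ i)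
  up₂-* {e} {d} {e′} {d′} {X} {X′} b h h′ = ≲-cong
    (λ i → trans (a₁ κ (n i) (K ^ e) (X i) (K ^ e′) (X′ i)) (cong (λ p → κ * (n i * (n i * (p * (X i * X′ i))))) (sym (^-distribˡ-+-* K e e′))))
    (λ i → trans (a₂ K (κ ^ e) (n i ^ d) (w 1 i) (κ ^ e′) (n i ^ d′)) (cong₂ (λ p q → K * (p * (q * w 1 i))) (sym (^-distribˡ-+-* κ e e′)) (sym (^-distribˡ-+-* (n i) d d′))))
    (≲-** (bounded-c (K ^ e′) b) (bounded-c K (bounded-c (κ ^ e) (0 ,ᵇ λ i → ≤-trans (*-monoʳ-≤ (n i ^ d) (walks≤ (G i) 1)) (≤-reflexive (a₃ (n i) (n i ^ d)))))) h h′)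
    where
    a₁ : ∀ κ n p x q y → κ * (n * (n * (p * x))) * (q * y) ≡ κ * (n * (n * (p * q * (x * y))))
    a₁ = solve-∀
    a₂ : ∀ K p x w q y → K * (p * (x * w)) * (q * y) ≡ K * (p * q * (x * y * w))
    a₂ = solve-∀
    a₃ : ∀ n p → p * (n * (n * 1)) ≡ 1 * (n * (n * p))
    a₃ = solve-∀

  up-≡ : ∀ {e d e′ d′ X X′} → e ≡ e′ → d ≡ d′ → (∀ i → X i ≡ X′ i) → Up e d X → Up e′ d′ X′
  up-≡ {e} refl refl h = ≲-cong (λ i → cong (K ^ e *_) (h i)) (λ _ → refl)

  up₂-≡ : ∀ {e d e′ d′ X X′} → e ≡ e′ → d ≡ d′ → (∀ i → X i ≡ X′ i) → Up₂ e d X → Up₂ e′ d′ X′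
  up₂-≡ {e} refl refl h = ≲-cong (λ i → cong (λ x → κ * (n i * (n i * (K ^ e * x)))) (h i)) (λ _ → refl)

  walks-up : ∀ a → Up a (suc a) (w a)
  walks-up zero    = ≤⇒≲ λ i → *-monoʳ-≤ 1 (walks≤ (G i) 0)
  walks-up (suc a) = ≲-trans
    (≲-cong (λ i → x∙yz≈yx∙z (K ^ a) K (w (suc a) i)) (λ _ → refl) (≲-*c (K ^ a) (walks-ratio a)))
    (≲-cong (λ i → a₂ κ (n i) (K ^ a) (w a i)) (λ i → a₃ κ (n i) (κ ^ a) (n i ^ suc a)) (≲-*c κ (≲-*n₁ (walks-up a))))
    where
    a₂ : ∀ κ n p x → κ * (n * (p * x)) ≡ p * (κ * (n * x))
    a₂ = solve-∀
    a₃ : ∀ κ n p x → κ * (n * (p * x)) ≡ κ * p * (n * x)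
    a₃ = solve-∀

  -- The descent stops at length 1, so that a lower bound on long walks will force one on w(1).
  walks-up₂ : ∀ a → Up₂ (suc a) (suc (suc a)) (w (suc a))
  walks-up₂ zero    = ≤⇒≲ λ i → ≤-reflexive (arrange κ K (n i) (w 1 i))
    where
    arrange : ∀ κ K n x → κ * (n * (n * (K * 1 * x))) ≡ K * (κ * 1 * (n * (n * 1) * x))
    arrange = solve-∀
  walks-up₂ (suc a) = ≲-trans
    (≲-cong (λ i → a₁ κ (n i) (K ^ suc a) K (w (suc (suc a)) i)) (λ _ → refl) (≲-*c κ (≲-*n₁ (≲-*n₁ (≲-*c (K ^ suc a) (walks-ratio (suc a)))))))
    (≲-cong (λ i → a₂ κ (n i) (K ^ suc a) (w (suc a) i)) (λ i → a₃ κ (n i) K (κ ^ suc a) (n i ^ suc (suc a)) (w 1 i)) (≲-*c κ (≲-*n₁ (walks-up₂ a))))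
    where
    a₁ : ∀ κ n p K x → κ * (n * (n * (p * (K * x)))) ≡ κ * (n * (n * (K * p * x)))
    a₁ = solve-∀
    a₂ : ∀ κ n p x → κ * (n * (κ * (n * (n * (p * x))))) ≡ κ * (n * (n * (p * (κ * (n * x)))))
    a₂ = solve-∀
    a₃ : ∀ κ n K p q x → κ * (n * (K * (p * (q * x)))) ≡ K * (κ * p * (n * q * x))
    a₃ = solve-∀

  -- Homomorphisms of the forest `bs` with its first path prolonged backwards by `a` edges. Reading
  -- a flag either lengthens this path or splits it off as a factor.
  runs : ∀ {m} → ℕ → Vec Bool m → Situation → ℕ
  runs a bs i = ∑ λ v → walk (G i) a v * W (G i) bs v

  runs-[] : ∀ a i → w a i ≡ runs a [] i
  runs-[] a i = sum-cong-≗ λ v → sym (*-identityʳ (walk (G i) a v))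

  runs-true : ∀ {m} a (bs : Vec Bool m) i → runs (suc a) bs i ≡ runs a (true ∷ bs) i
  runs-true a bs i = sym (op-adjoint (G i) true (walk (G i) a) (W (G i) bs))

  runs-false : ∀ {m} a (bs : Vec Bool m) i → w a i * runs 0 bs i ≡ runs a (false ∷ bs) i
  runs-false a bs i = *-distribʳ-sum (runs 0 bs i) (walk (G i) a)

  bounded-runs : ∀ {m} (bs : Vec Bool m) → Bounded (suc m) (runs 0 bs)
  bounded-runs {m} bs = 0 ,ᵇ λ i → ≤-trans (∑-bound (n i ^ m) λ v → ≤-trans (≤-reflexive (*-identityˡ _)) (W≤ (G i) bs v)) (≤-reflexive (sym (*-identityˡ _)))

  runs-up : ∀ {m} a (bs : Vec Bool m) → Up (a + edgeCount bs) (a + suc m) (runs a bs)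
  runs-up a []           = up-≡ (sym (+-identityʳ a)) (+-comm 1 a) (runs-[] a) (walks-up a)
  runs-up {suc m} a (true ∷ bs)  = up-≡ (sym (+-suc a _)) (sym (+-suc a (suc m))) (runs-true a bs) (runs-up (suc a) bs)
  runs-up {suc m} a (false ∷ bs) = up-≡ {a + edgeCount bs} refl (sym (+-suc a (suc m))) (runs-false a bs) (up-* {a} {suc a} {edgeCount bs} {suc m} (bounded-runs bs) (walks-up a) (runs-up 0 bs))

  -- The first path with an edge keeps its factor w(1); all others are estimated completely, by
  -- `walks-up` or `runs-up`.
  runs-up₂ : ∀ {m} a (bs : Vec Bool m) → 1 ≤ a + edgeCount bs → Up₂ (a + edgeCount bs) (a + suc m) (runs a bs)
  runs-up₂ (suc a) []    _  = up₂-≡ (sym (+-identityʳ (suc a))) (+-comm 1 (suc a)) (runs-[] (suc a)) (walks-up₂ a)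
  runs-up₂ {suc m} a (true ∷ bs) _ = up₂-≡ (sym (+-suc a _)) (sym (+-suc a (suc m))) (runs-true a bs) (runs-up₂ (suc a) bs (s≤s z≤n))
  runs-up₂ {suc m} (suc a) (false ∷ bs) _ = up₂-≡ {suc a + edgeCount bs} refl (sym (+-suc (suc a) (suc m))) (runs-false (suc a) bs)
    (up₂-* {suc a} {suc (suc a)} {edgeCount bs} {suc m} (bounded-runs bs) (walks-up₂ a) (runs-up 0 bs))
  runs-up₂ {suc m} zero (false ∷ bs) 1≤e = up₂-≡ (+-identityʳ (edgeCount bs)) (+-comm (suc m) 1)
    (λ i → trans (*-comm (runs 0 bs i) (w 0 i)) (runs-false 0 bs i))
    (up₂-* {edgeCount bs} {suc m} {0} {1} (bounded-w 0) (runs-up₂ 0 bs 1≤e) (walks-up 0))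

  E = edgeCount bs

  power-gap-order : ∀ p → (λ i → n i ^ p) ≲[ p ] (λ i → order i ^ p)
  power-gap-order zero    = ≤⇒≲ λ _ → ≤-refl
  power-gap-order (suc p) = ≲-trans
    (≲-*n₁ (power-gap-order p))
    (≲-cong (λ i → +-comm (order i * order i ^ p) _) (λ i → +-identityʳ _)
      (≲-+ (≤⇒≲ λ i → ≤-refl {order i * order i ^ p}) (≲-lower-order {λ i → order i ^ p} {p} (0 ,ᵇ λ i → ≤-trans (^-monoˡ-≤ p (n≤1+n (order i))) (≤-reflexive (sym (*-identityˡ _)))))))

  -- Each of the m + 1 positions of the last vertex accounts for about (κ/k)ᴱ nᵐ homomorphisms into
  -- the Turán graph, and those that are not injective are bounded by `B`, of lower order.
  heavy-lower : (λ i → suc m * (κ ^ E * n i ^ m)) ≲[ m ] (λ i → K ^ E * δ (order i))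
  heavy-lower = ≲-trans (≲-*c (suc m) (≲-*c (κ ^ E) (power-gap-order m)))
    (≲-trans (≤⇒≲ bound) (≲-cong (λ i → sym (*-distribˡ-+ (K ^ E) (δ (order i)) (B i))) (λ i → +-identityʳ _)
      (≲-+ (≤⇒≲ λ i → ≤-refl {K ^ E * δ (order i)}) (≲-cong (λ _ → refl) (λ _ → *-zeroʳ (K ^ E)) (≲-*c (K ^ E) B-small)))))
    where
    B : Situation → ℕ
    B i = ∑V (suc m) λ x → collisions x * occ (fromℕ (order i)) x
    bound : ∀ i → suc m * (κ ^ E * order i ^ m) ≤ K ^ E * (δ (order i) + B i)
    bound i = ≤-trans (LowerBound.homThrough-lower (turán (n i) K) κ (turán-deg (order i) κ) bs (fromℕ (order i)))
      (*-monoʳ-≤ (K ^ E) (homThrough≤ (turán (n i) K) bs (fromℕ (order i))))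
    c = suc m * suc m * suc m
    B-small : B ≲[ m ] (λ _ → 0)
    B-small = asymptotically λ N → N * c , λ i le → *-cancelˡ-≤ (n i * n i) (begin
      n i * n i * (N * B i)                    ≡⟨ a₁ (n i) N (B i) ⟩
      N * (n i * (n i * B i))                  ≤⟨ *-monoʳ-≤ N (∑V-collisions-occ (suc m) (fromℕ (order i))) ⟩
      N * (c * n i ^ suc m)                    ≡⟨ *-assoc N c _ ⟨
      N * c * (n i * n i ^ m)                  ≤⟨ *-monoˡ-≤ (n i * n i ^ m) le ⟩
      n i * (n i * n i ^ m)                    ≡⟨ *-assoc (n i) (n i) _ ⟨
      n i * n i * n i ^ m                      ≤⟨ *-monoʳ-≤ (n i * n i) (m≤n+m _ (N * 0)) ⟩
      n i * n i * (N * 0 + n i ^ m)            ∎)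
      where
      open ≤-Reasoning
      a₁ : ∀ n N b → n * n * (N * b) ≡ N * (n * (n * b))
      a₁ = solve-∀

  hom-lower : (λ i → suc m * (κ ^ E * n i ^ m)) ≲[ m ] (λ i → K ^ E * split (G i) (z i) (λ _ → 1) bs)
  hom-lower = ≲-trans heavy-lower (≤⇒≲ λ i → *-monoʳ-≤ (K ^ E)
    (≤-trans (heavy i (z i)) (≤-trans (through≤homThrough (G i) bs (z i)) (≤-reflexive (homThrough-split (G i) bs (z i))))))

  -- Summed over all vertices, `homThrough` counts every homomorphism m + 1 times.
  total-lower : (λ i → κ ^ E * n i ^ suc m) ≲[ suc m ] (λ i → K ^ E * runs 0 bs i)
  total-lower = ≲-cancel-c (suc m) (s≤s z≤n) (≲-trans
    (≲-cong (λ i → a₁ (n i) (suc m) (κ ^ E) (n i ^ m)) (λ _ → refl) (≲-*n₁ heavy-lower))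
    (≤⇒≲ bound))
    where
    open ≤-Reasoning
    a₁ : ∀ n s p q → n * (s * (p * q)) ≡ s * (p * (n * q))
    a₁ = solve-∀
    bound : ∀ i → n i * (K ^ E * δ (order i)) ≤ suc m * (K ^ E * runs 0 bs i)
    bound i = begin
      n i * (K ^ E * δ (order i))                  ≡⟨ x∙yz≈y∙xz (n i) (K ^ E) (δ (order i)) ⟩
      K ^ E * (n i * δ (order i))                  ≡⟨ cong (K ^ E *_) (∑-const (n i) (δ (order i))) ⟨
      K ^ E * ∑ {n i} (λ _ → δ (order i))          ≤⟨ *-monoʳ-≤ (K ^ E) (∑-mono λ v → ≤-trans (heavy i v) (through≤homThrough (G i) bs v)) ⟩
      K ^ E * ∑ (homThrough (G i) bs)              ≡⟨ cong (K ^ E *_) (trans (∑-homThrough (G i) bs) (cong (suc m *_) (sum-cong-≗ λ v → sym (*-identityˡ (W (G i) bs v))))) ⟩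
      K ^ E * (suc m * runs 0 bs i)                ≡⟨ x∙yz≈y∙xz (K ^ E) (suc m) (runs 0 bs i) ⟩
      suc m * (K ^ E * runs 0 bs i)                ∎

  module _ (1≤E : 1 ≤ E) where

    κ^E>0 : 1 ≤ κ ^ E
    κ^E>0 = ≤-trans (≤-reflexive (sym (^-zeroˡ E))) (^-monoˡ-≤ E 1≤κ)

    -- `total-lower` meets the upper bound `runs-up₂`, in which one factor w(1) is still free.
    -- Cancelling the common powers bounds that factor from below.
    many-edges : (λ i → κ * (n i * n i)) ≲[ 2 ] (λ i → K * w 1 i)
    many-edges = ≲-cancel-n (suc m) (≲-cancel-c (κ ^ E) κ^E>0 (≲-trans
      (≲-cong (λ i → a₁ κ (n i) (κ ^ E) (n i ^ suc m)) (λ _ → refl) (≲-*c κ (≲-*n₁ (≲-*n₁ total-lower))))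
      (≲-cong (λ _ → refl) (λ i → a₂ K (κ ^ E) (n i ^ suc m) (w 1 i)) (runs-up₂ 0 bs 1≤E))))
      where
      a₁ : ∀ κ n p q → κ * (n * (n * (p * q))) ≡ p * (q * (κ * (n * n)))
      a₁ = solve-∀
      a₂ : ∀ K p q x → K * (p * (q * x)) ≡ p * (q * (K * x))
      a₂ = solve-∀

    -- Truncation keeps the degrees above (κ/k)n, the only ones that could compensate for a small
    -- degree elsewhere.
    exc : ∀ i → Fin (n i) → ℕ
    exc i v = K * deg (G i) v ∸ κ * n i

    D : Situation → ℕ
    D i = ∑ (exc i)

    -- Σ (K d(v) - κ n)² = K² w₂ - 2 κ K n w₁ + κ² n³, restricted to the positive parts.
    D-small : D ≲[ 2 ] (λ _ → 0)
    D-small = ≲-sqrt (≲-trans (≤⇒≲ λ i → cauchy-schwarz (exc i))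
      (≲-cong (λ _ → refl) (λ i → *-zeroʳ (n i)) (≲-*n₁ squares)))
      where
      cross : Situation → ℕ
      cross i = κ * (n i * (K * w 1 i))
      variance : ∀ i → ∑ (λ v → exc i v * exc i v) + (cross i + cross i) ≤ K * (K * w 2 i) + κ * (n i * (κ * (n i * n i)))
      variance i = begin
        ∑ (λ v → exc i v * exc i v) + (cross i + cross i)
          ≡⟨ cong (∑ (λ v → exc i v * exc i v) +_) (trans (a₁ κ (n i) K (w 1 i)) (trans (*-distribˡ-sum c (walk (G i) 1)) (sum-cong-≗ λ v → cong (c *_) (walk₁ v)))) ⟩
        ∑ (λ v → exc i v * exc i v) + ∑ (λ v → c * deg (G i) v)
          ≡⟨ ∑-distrib-+ (λ v → exc i v * exc i v) (λ v → c * deg (G i) v) ⟨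
        ∑ (λ v → exc i v * exc i v + c * deg (G i) v)
          ≤⟨ ∑-mono (λ v → ≤-trans (≤-reflexive (cong (exc i v * exc i v +_) (a₂ κ (n i) K (deg (G i) v)))) (gap² (K * deg (G i) v) (κ * n i))) ⟩
        ∑ (λ v → K * deg (G i) v * (K * deg (G i) v) + κ * n i * (κ * n i))
          ≡⟨ ∑-distrib-+ (λ v → K * deg (G i) v * (K * deg (G i) v)) (λ _ → κ * n i * (κ * n i)) ⟩
        ∑ (λ v → K * deg (G i) v * (K * deg (G i) v)) + ∑ {n i} (λ _ → κ * n i * (κ * n i))
          ≡⟨ cong₂ _+_ (trans (sum-cong-≗ λ v → trans (a₃ K (deg (G i) v)) (cong (K * K *_) (cong₂ _*_ (sym (walk₁ v)) (sym (walk₁ v))))) (trans (sym (*-distribˡ-sum (K * K) λ v → walk (G i) 1 v * walk (G i) 1 v)) (trans (cong (K * K *_) (walk-inner (G i) 1 1)) (*-assoc K K _))))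
               (trans (∑-const (n i) (κ * n i * (κ * n i))) (a₄ κ (n i))) ⟩
        K * (K * w 2 i) + κ * (n i * (κ * (n i * n i))) ∎
        where
        open ≤-Reasoning
        c = 2 * (κ * (n i * K))
        walk₁ : ∀ v → walk (G i) 1 v ≡ deg (G i) v
        walk₁ v = sum-cong-≗ λ u → *-identityʳ (A (G i) v u)
        a₁ : ∀ κ n K x → κ * (n * (K * x)) + κ * (n * (K * x)) ≡ 2 * (κ * (n * K)) * x
        a₁ = solve-∀
        a₂ : ∀ κ n K d → 2 * (κ * (n * K)) * d ≡ 2 * (K * d * (κ * n))
        a₂ = solve-∀
        a₃ : ∀ K d → K * d * (K * d) ≡ K * K * (d * d)
        a₃ = solve-∀
        a₄ : ∀ κ n → n * (κ * n * (κ * n)) ≡ κ * (n * (κ * (n * n)))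
        a₄ = solve-∀
        square : ∀ y d → d * d + 2 * ((y + d) * y) ≡ (y + d) * (y + d) + y * y
        square = solve-∀
        gap² : ∀ x y → (x ∸ y) * (x ∸ y) + 2 * (x * y) ≤ x * x + y * y
        gap² x y with ≤-total y x
        ... | inj₁ y≤x = ≤-reflexive (subst (λ t → (x ∸ y) * (x ∸ y) + 2 * (t * y) ≡ t * t + y * y) (m+[n∸m]≡n y≤x) (square y (x ∸ y)))
        ... | inj₂ x≤y rewrite m≤n⇒m∸n≡0 x≤y = ≤-trans (m≤n+m (2 * (x * y)) ((y ∸ x) * (y ∸ x)))
          (≤-reflexive (trans (subst (λ t → (y ∸ x) * (y ∸ x) + 2 * (x * t) ≡ t * t + x * x) (m+[n∸m]≡n x≤y) (trans (cong (λ p → (y ∸ x) * (y ∸ x) + 2 * p) (*-comm x (x + (y ∸ x)))) (square x (y ∸ x)))) (+-comm (y * y) (x * x))))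
      -- `walks-ratio 1` bounds K²w(2), and `many-edges` bounds κ²n³, each by κKn w(1); together
      -- they cancel the doubled mixed term.
      squares : (λ i → ∑ λ v → exc i v * exc i v) ≲[ 3 ] (λ _ → 0)
      squares = ≲-cancel-+ (λ i → cross i + cross i) (≲-trans (≤⇒≲ variance)
        (≲-+ (≲-cong (λ _ → refl) (λ i → a₁ K κ (n i) (w 1 i)) (≲-*c K (walks-ratio 1))) (≲-*c κ (≲-*n₁ many-edges))))
        where
        a₁ : ∀ K κ n x → K * (κ * (n * x)) ≡ κ * (n * (K * x))
        a₁ = solve-∀

    Vector : Set₁
    Vector = ∀ i → Fin (n i) → ℕ

    op′ : Bool → Vector → Vector
    op′ b y i = op (G i) b (y i)

    excess : ℕ → ℕ → Vector → Situation → ℕ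
    excess e d y i = ∑ λ v → K ^ e * y i v ∸ κ ^ e * n i ^ d

    -- `small` controls entries only on average: a total of o(nᵈ⁺¹) permits o(n) exceptional entries
    -- of order nᵈ, and z might be one of them. Hence the separate field `at-z`.
    record Typical (e d : ℕ) (y : Vector) : Set₁ where
      field
        small : excess e d y ≲[ suc d ] (λ _ → 0)
        at-z  : Up e d (λ i → y i (z i))
        size≤ : ∀ i v → y i v ≤ n i ^ d

    open Typical

    entry≤ : ∀ e d (y : Vector) i v → K ^ e * y i v ≤ κ ^ e * n i ^ d + (K ^ e * y i v ∸ κ ^ e * n i ^ d)
    entry≤ e d y i v = m≤n+m∸n (K ^ e * y i v) (κ ^ e * n i ^ d)

    -- Each entry is split into its typical bound and a surplus. The former sums to a multiple of
    -- the degree, the latter to at most the total `excess`, whatever the neighbourhood of v.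
    op-true≤ : ∀ e d (y : Vector) i v → K ^ e * op′ true y i v ≤ κ ^ e * n i ^ d * deg (G i) v + excess e d y i
    op-true≤ e d y i v = begin
      K ^ e * op′ true y i v                                             ≡⟨ *-distribˡ-sum (K ^ e) (λ u → A (G i) v u * y i u) ⟩
      ∑ (λ u → K ^ e * (A (G i) v u * y i u))                            ≤⟨ ∑-mono (λ u → one u) ⟩
      ∑ (λ u → κ ^ e * n i ^ d * A (G i) v u + (K ^ e * y i u ∸ κ ^ e * n i ^ d))   ≡⟨ ∑-distrib-+ (λ u → κ ^ e * n i ^ d * A (G i) v u) (λ u → K ^ e * y i u ∸ κ ^ e * n i ^ d) ⟩
      ∑ (λ u → κ ^ e * n i ^ d * A (G i) v u) + excess e d y i           ≡⟨ cong (_+ excess e d y i) (*-distribˡ-sum (κ ^ e * n i ^ d) (A (G i) v)) ⟨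
      κ ^ e * n i ^ d * deg (G i) v + excess e d y i                     ∎
      where
      open ≤-Reasoning
      one : ∀ u → K ^ e * (A (G i) v u * y i u) ≤ κ ^ e * n i ^ d * A (G i) v u + (K ^ e * y i u ∸ κ ^ e * n i ^ d)
      one u = begin
        K ^ e * (A (G i) v u * y i u)                      ≡⟨ x∙yz≈y∙xz (K ^ e) (A (G i) v u) (y i u) ⟩
        A (G i) v u * (K ^ e * y i u)                      ≤⟨ *-monoʳ-≤ (A (G i) v u) (entry≤ e d y i u) ⟩
        A (G i) v u * (κ ^ e * n i ^ d + (K ^ e * y i u ∸ κ ^ e * n i ^ d))   ≡⟨ *-distribˡ-+ (A (G i) v u) (κ ^ e * n i ^ d) (K ^ e * y i u ∸ κ ^ e * n i ^ d) ⟩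
        A (G i) v u * (κ ^ e * n i ^ d) + A (G i) v u * (K ^ e * y i u ∸ κ ^ e * n i ^ d)
          ≤⟨ +-mono-≤ (≤-reflexive (*-comm (A (G i) v u) (κ ^ e * n i ^ d))) (≤-trans (*-monoˡ-≤ (K ^ e * y i u ∸ κ ^ e * n i ^ d) (𝟙≤1 (adj? (G i) v u))) (≤-reflexive (*-identityˡ (K ^ e * y i u ∸ κ ^ e * n i ^ d)))) ⟩
        κ ^ e * n i ^ d * A (G i) v u + (K ^ e * y i u ∸ κ ^ e * n i ^ d)   ∎

    op-false≤ : ∀ e d (y : Vector) i v → K ^ e * op′ false y i v ≤ κ ^ e * n i ^ suc d + excess e d y i
    op-false≤ e d y i v = begin
      K ^ e * op′ false y i v                                    ≡⟨ trans (*-distribˡ-sum (K ^ e) (λ u → 1 * y i u)) (sum-cong-≗ λ u → cong (K ^ e *_) (*-identityˡ (y i u))) ⟩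
      ∑ (λ u → K ^ e * y i u)                                    ≤⟨ ∑-mono (entry≤ e d y i) ⟩
      ∑ (λ u → κ ^ e * n i ^ d + (K ^ e * y i u ∸ κ ^ e * n i ^ d))   ≡⟨ ∑-distrib-+ {n i} (λ _ → κ ^ e * n i ^ d) (λ u → K ^ e * y i u ∸ κ ^ e * n i ^ d) ⟩
      ∑ {n i} (λ _ → κ ^ e * n i ^ d) + excess e d y i           ≡⟨ cong (_+ excess e d y i) (trans (∑-const (n i) (κ ^ e * n i ^ d)) (x∙yz≈y∙xz (n i) (κ ^ e) (n i ^ d))) ⟩
      κ ^ e * n i ^ suc d + excess e d y i                       ∎
      where
      open ≤-Reasoning

    drop-excess : ∀ {X Y Z : Situation → ℕ} {d} → X ≲[ d ] (λ i → Y i + Z i) → Z ≲[ d ] (λ _ → 0) → X ≲[ d ] Y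
    drop-excess {Y = Y} h s = ≲-trans h (≲-cong (λ _ → refl) (λ i → +-identityʳ _) (≲-+ (≤⇒≲ λ i → ≤-refl {Y i}) s))

    op-true-z : ∀ {e d y} → Typical e d y → (λ i → K ^ e * op′ true y i (z i)) ≲[ suc d ] (λ i → κ ^ e * n i ^ d * deg (G i) (z i))
    op-true-z {e} {d} {y} T = drop-excess (≤⇒≲ λ i → op-true≤ e d y i (z i)) (small T)

    typical-one : Typical 0 0 (λ _ _ → 1)
    typical-one = record
      { small = ≤⇒≲ λ i → ≤-reflexive (∑-≡0 {n i} λ _ → refl)
      ; at-z = ≤⇒≲ λ _ → ≤-refl
      ; size≤ = λ _ _ → ≤-refl }

    -- Degrees of general vertices exceed (κ/k)n by little in total, by `D-small`; at z the bound is
    -- the field `low`.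
    typical-true : ∀ {e d y} → Typical e d y → Typical (suc e) (suc d) (op′ true y)
    typical-true {e} {d} {y} T = record
      { small = ≲-trans (≤⇒≲ bound) (≲-cong (λ _ → refl) (λ i → zeros (κ ^ e) (n i ^ d) K (n i))
          (≲-+ (≲-*c (κ ^ e) (≲-*n d D-small)) (≲-*c K (≲-*n₁ (small T)))))
      ; at-z = ≲-trans (≲-cong (λ i → sym (*-assoc K (K ^ e) _)) (λ _ → refl) (≲-*c K (op-true-z T)))
          (≤⇒≲ λ i → ≤-trans (≤-reflexive (a₁ K (κ ^ e) (n i ^ d) (deg (G i) (z i)))) (≤-trans (*-monoʳ-≤ (κ ^ e * n i ^ d) (low i)) (≤-reflexive (a₂ κ (κ ^ e) (n i ^ d) (n i)))))
      ; size≤ = λ i v → op-bound (G i) true (y i) _ (size≤ T i) v }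
      where
      zeros : ∀ p q K n → p * (q * 0) + K * (n * 0) ≡ 0
      zeros = solve-∀
      a₁ : ∀ K p q d → K * (p * q * d) ≡ p * q * (K * d)
      a₁ = solve-∀
      a₂ : ∀ κ p q n → p * q * (κ * n) ≡ κ * p * (n * q)
      a₂ = solve-∀
      bound : ∀ i → excess (suc e) (suc d) (op′ true y) i ≤ κ ^ e * (n i ^ d * D i) + K * (n i * excess e d y i)
      bound i = begin
        ∑ (λ v → K ^ suc e * op′ true y i v ∸ κ ^ suc e * n i ^ suc d)            ≤⟨ ∑-mono one ⟩
        ∑ (λ v → κ ^ e * n i ^ d * exc i v + K * excess e d y i)                  ≡⟨ trans (∑-distrib-+ (λ v → κ ^ e * n i ^ d * exc i v) (λ _ → K * excess e d y i)) (cong₂ _+_ (trans (sym (*-distribˡ-sum (κ ^ e * n i ^ d) (exc i))) (*-assoc (κ ^ e) (n i ^ d) (D i))) (trans (∑-const (n i) (K * excess e d y i)) (x∙yz≈y∙xz (n i) K (excess e d y i)))) ⟩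
        κ ^ e * (n i ^ d * D i) + K * (n i * excess e d y i)                      ∎
        where
        open ≤-Reasoning
        a₄ : ∀ K p q d x → K * (p * q * d + x) ≡ p * q * (K * d) + K * x
        a₄ = solve-∀
        one : ∀ v → K ^ suc e * op′ true y i v ∸ κ ^ suc e * n i ^ suc d ≤ κ ^ e * n i ^ d * exc i v + K * excess e d y i
        one v = m≤n+o⇒m∸n≤o (K ^ suc e * op′ true y i v) (κ ^ suc e * n i ^ suc d) (begin
          K * K ^ e * op′ true y i v                                                          ≡⟨ *-assoc K (K ^ e) _ ⟩
          K * (K ^ e * op′ true y i v)                                                        ≤⟨ *-monoʳ-≤ K (op-true≤ e d y i v) ⟩
          K * (κ ^ e * n i ^ d * deg (G i) v + excess e d y i)                                ≡⟨ a₄ K (κ ^ e) (n i ^ d) (deg (G i) v) (excess e d y i) ⟩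
          κ ^ e * n i ^ d * (K * deg (G i) v) + K * excess e d y i                            ≤⟨ +-monoˡ-≤ _ (*-monoʳ-≤ (κ ^ e * n i ^ d) (m≤n+m∸n (K * deg (G i) v) (κ * n i))) ⟩
          κ ^ e * n i ^ d * (κ * n i + exc i v) + K * excess e d y i                          ≡⟨ a₅ κ (κ ^ e) (n i) (n i ^ d) (exc i v) (K * excess e d y i) ⟩
          κ * κ ^ e * (n i * n i ^ d) + (κ ^ e * n i ^ d * exc i v + K * excess e d y i)      ∎)
          where
          a₅ : ∀ κ p n q x t → p * q * (κ * n + x) + t ≡ κ * p * (n * q) + (p * q * x + t)
          a₅ = solve-∀

    typical-false : ∀ {e d y} → Typical e d y → Typical e (suc d) (op′ false y)
    typical-false {e} {d} {y} T = record
      { small = ≲-trans (≤⇒≲ λ i → ∑-bound (excess e d y i) λ v → m≤n+o⇒m∸n≤o (K ^ e * op′ false y i v) (κ ^ e * n i ^ suc d) (op-false≤ e d y i v))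
          (≲-cong (λ _ → refl) (λ i → *-zeroʳ (n i)) (≲-*n₁ (small T)))
      ; at-z = drop-excess (≤⇒≲ λ i → op-false≤ e d y i (z i)) (small T)
      ; size≤ = λ i v → op-bound (G i) false (y i) _ (size≤ T i) v }

    typical-W : ∀ {m} (bs : Vec Bool m) → Typical (edgeCount bs) m (λ i → W (G i) bs)
    typical-W []           = typical-one
    typical-W (true ∷ bs)  = typical-true (typical-W bs)
    typical-W (false ∷ bs) = typical-false (typical-W bs)

    bounded-typical : ∀ {e d y} → Typical e d y → Bounded d (λ i → y i (z i))
    bounded-typical T = 0 ,ᵇ λ i → ≤-trans (size≤ T i (z i)) (≤-reflexive (sym (*-identityˡ _)))

    -- X is asymptotically at most c terms (κ/K)ᵉ nᵈ plus one term (κ/K)ᵉ⁻¹ nᵈ⁻¹ d(z).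
    Strong : ℕ → ℕ → ℕ → (Situation → ℕ) → Set₁
    Strong c e d X = (λ i → κ * (n i * (K ^ e * X i))) ≲[ suc d ] (λ i → κ ^ e * (n i ^ d * (c * (κ * n i) + K * deg (G i) (z i))))

    Weak : ℕ → ℕ → ℕ → (Situation → ℕ) → Set₁
    Weak c e d X = (λ i → K ^ e * X i) ≲[ d ] (λ i → c * (κ ^ e * n i ^ d))

    splits : ∀ {m} → Vector → Vec Bool m → Situation → ℕ
    splits y bs i = split (G i) (z i) (y i) bs

    term : ∀ {e d y m} → Typical e d y → (bs : Vec Bool m) → Up (e + edgeCount bs) (d + m) (λ i → y i (z i) * W (G i) bs (z i))
    term {e} {d} T bs = up-* {e} {d} (bounded-typical (typical-W bs)) (at-z T) (at-z (typical-W bs))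

    weak-+ : ∀ {c e d X X′} → Up e d X → Weak c e d X′ → Weak (suc c) e d (λ i → X i + X′ i)
    weak-+ {c} {e} {d} {X} {X′} h h′ = ≲-cong (λ i → sym (*-distribˡ-+ (K ^ e) (X i) (X′ i))) (λ _ → refl) (≲-+ h h′)

    -- Every position of z contributes a product of two typical values at z.
    weak-split : ∀ {m e d y} → Typical e d y → (bs : Vec Bool m) → Weak (suc m) (e + edgeCount bs) (d + m) (splits y bs)
    weak-split {e = e} {d} T [] = ≲-order (sym (+-identityʳ d)) (≲-cong (λ i → cong (λ p → K ^ p * _) (sym (+-identityʳ e)))
      (λ i → trans (cong₂ (λ p q → κ ^ p * n i ^ q) (sym (+-identityʳ e)) (sym (+-identityʳ d))) (sym (+-identityʳ _))) (at-z T))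
    weak-split {suc m} {e} {d} {y} T (true ∷ bs) = weak-+ {suc m} {e + suc (edgeCount bs)} {d + suc m} (term {e} {d} T (true ∷ bs))
      (subst₂ (λ p q → Weak (suc m) p q (splits (op′ true y) bs)) (sym (+-suc e (edgeCount bs))) (sym (+-suc d m)) (weak-split (typical-true T) bs))
    weak-split {suc m} {e} {d} {y} T (false ∷ bs) = weak-+ {suc m} {e + edgeCount bs} {d + suc m} (term {e} {d} T (false ∷ bs))
      (subst (λ q → Weak (suc m) (e + edgeCount bs) q (splits (op′ false y) bs)) (sym (+-suc d m)) (weak-split (typical-false T) bs))

    -- When z is the left end of the first edge of the forest, its degree enters as a factor and is
    -- kept by `op-true-z`; the other positions are estimated by typical values.
    strong-split : ∀ {m e d y} → Typical e d y → (bs : Vec Bool m) → 1 ≤ edgeCount bs → Strong m (e + edgeCount bs) (d + m) (splits y bs)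
    strong-split {suc m} {e} {d} {y} T (true ∷ bs) _ = ≲-trans
      (≲-cong (λ i → a₁ κ (n i) (K ^ (e + suc E′)) (head i) (tail i)) (λ _ → refl) (≲-+ first (≲-*c κ (≲-*n₁ rest′))))
      (≤⇒≲ λ i → ≤-reflexive (a₂ (κ ^ (e + suc E′)) (n i ^ (d + suc m)) (K * deg (G i) (z i)) (suc m) κ (n i)))
      where
      E′ = edgeCount bs
      head tail : Situation → ℕ
      head i = y i (z i) * W (G i) (true ∷ bs) (z i)
      tail = splits (op′ true y) bs
      a₁ : ∀ κ n p x x′ → κ * (n * (p * x)) + κ * (n * (p * x′)) ≡ κ * (n * (p * (x + x′)))
      a₁ = solve-∀
      a₂ : ∀ p q t c κ n → p * (q * t) + κ * (n * (c * (p * q))) ≡ p * (q * (c * (κ * n) + t))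
      a₂ = solve-∀
      rest′ : Weak (suc m) (e + suc E′) (d + suc m) tail
      rest′ = subst₂ (λ p q → Weak (suc m) p q tail) (sym (+-suc e E′)) (sym (+-suc d m)) (weak-split (typical-true T) bs)
      first : (λ i → κ * (n i * (K ^ (e + suc E′) * head i))) ≲[ suc (d + suc m) ] (λ i → κ ^ (e + suc E′) * (n i ^ (d + suc m) * (K * deg (G i) (z i))))
      first = ≲-order (+-suc d (suc m)) (≲-cong
        (λ i → trans (a₃ κ (n i) K (K ^ e) (y i (z i)) (K ^ E′) (W (G i) (true ∷ bs) (z i))) (cong (λ p → κ * (n i * (p * head i))) (sym (^-distribˡ-+-* K e (suc E′)))))
        (λ i → trans (a₄ κ (n i) K (κ ^ e) (n i ^ d) (κ ^ E′) (n i ^ m) (deg (G i) (z i))) (cong₂ (λ p q → p * (q * (K * deg (G i) (z i)))) (sym (^-distribˡ-+-* κ e (suc E′))) (sym (^-distribˡ-+-* (n i) d (suc m)))))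
        (≲-** (bounded-c κ (bounded-n₁ (bounded-c K (bounded-c (K ^ E′) (bounded-typical (typical-W (true ∷ bs)))))))
          (bounded-c (κ ^ e) (bounded-n^ d)) (at-z T) (≲-*c κ (≲-*n₁ (≲-*c K (op-true-z (typical-W bs)))))))
        where
        a₃ : ∀ κ n K p y q x → p * y * (κ * (n * (K * (q * x)))) ≡ κ * (n * (p * (K * q) * (y * x)))
        a₃ = solve-∀
        a₄ : ∀ κ n K p u q v t → p * u * (κ * (n * (K * (q * v * t)))) ≡ p * (κ * q) * (u * (n * v) * (K * t))
        a₄ = solve-∀
        bounded-n₁ : ∀ {d Z} → Bounded d Z → Bounded (suc d) (λ i → n i * Z i)
        bounded-n₁ {d} (c ,ᵇ b) = c ,ᵇ λ i → ≤-trans (*-monoʳ-≤ (n i) (b i)) (≤-reflexive (x∙yz≈y∙xz (n i) (suc c) (n i ^ d)))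
    strong-split {suc m} {e} {d} {y} T (false ∷ bs) 1≤e = ≲-trans
      (≲-cong (λ i → a₁ κ (n i) (K ^ (e + edgeCount bs)) (head i) (tail i)) (λ _ → refl) (≲-+ (≲-*c κ (≲-*n₁ (term {e} {d} T (false ∷ bs)))) rest′))
      (≤⇒≲ λ i → ≤-reflexive (a₂ (κ ^ (e + edgeCount bs)) (n i ^ (d + suc m)) (K * deg (G i) (z i)) m κ (n i)))
      where
      head tail : Situation → ℕ
      head i = y i (z i) * W (G i) (false ∷ bs) (z i)
      tail = splits (op′ false y) bs
      a₁ : ∀ κ n p x x′ → κ * (n * (p * x)) + κ * (n * (p * x′)) ≡ κ * (n * (p * (x + x′)))
      a₁ = solve-∀
      a₂ : ∀ p q t c κ n → κ * (n * (p * q)) + p * (q * (c * (κ * n) + t)) ≡ p * (q * (suc c * (κ * n) + t))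
      a₂ = solve-∀
      rest′ : Strong m (e + edgeCount bs) (d + suc m) tail
      rest′ = subst (λ q → Strong m (e + edgeCount bs) q tail) (sym (+-suc d m)) (strong-split (typical-false T) bs 1≤e)

    -- `hom-lower` demands m + 1 equal shares, and by `strong-split` the ordinary positions supply
    -- at most m of them. The term with the degree of z must supply the last.
    large-degree : (λ i → κ * n i) ≲[ 1 ] (λ i → K * deg (G i) (z i))
    large-degree = ≲-cancel-n m (≲-cancel-c (κ ^ E) κ^E>0 (≲-cancel-+ (λ i → κ ^ E * (n i ^ m * (m * (κ * n i))))
      (≲-cong (λ i → a₁ κ (n i) m (κ ^ E) (n i ^ m)) (λ i → a₂ (κ ^ E) (n i ^ m) (m * (κ * n i)) (K * deg (G i) (z i)))
        (≲-trans (≲-*c κ (≲-*n₁ hom-lower)) (strong-split typical-one bs 1≤E)))))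
      where
      a₁ : ∀ κ n m p q → κ * (n * (suc m * (p * q))) ≡ p * (q * (κ * n)) + p * (q * (m * (κ * n)))
      a₁ = solve-∀
      a₂ : ∀ p q x y → p * (q * (x + y)) ≡ p * (q * y) + p * (q * x)
      a₂ = solve-∀

    minDegree : ∀ N → ∃[ n₀ ] (∀ {n} (G : Graph (suc n)) → n₀ ≤ suc n → G IsFree F → (∀ v → δ n ≤ through G bs v) →
      ∀ v → N * (K * suc n) ≤ N * (K * deg G v + suc n) + suc n)
    minDegree N = let n₀ , b = within large-degree N in n₀ , λ {n} G le free heavy v → bound n₀ b G le free heavy v
      where
      open ≤-Reasoning
      bound : ∀ n₀ → (∀ i → n₀ ≤ n i → N * (κ * n i) ≤ N * (K * deg (G i) (z i)) + n i ^ 1) →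
        ∀ {n} (G : Graph (suc n)) → n₀ ≤ suc n → G IsFree F → (∀ v → δ n ≤ through G bs v) →
        ∀ v → N * (K * suc n) ≤ N * (K * deg G v + suc n) + suc n
      bound n₀ b {n} G le free heavy v = begin
        N * (K * s)                             ≡⟨ a₁ N κ s ⟩
        N * (κ * s) + N * s                     ≤⟨ +-monoˡ-≤ (N * s) (cases (K * deg G v ≤? κ * s)) ⟩
        N * (K * deg G v) + s + N * s           ≡⟨ a₂ N (K * deg G v) s ⟩
        N * (K * deg G v + s) + s               ∎
        where
        s = suc n
        a₁ : ∀ N κ s → N * (suc κ * s) ≡ N * (κ * s) + N * s
        a₁ = solve-∀
        a₂ : ∀ N x s → N * x + s + N * s ≡ N * (x + s) + s
        a₂ = solve-∀
        cases : Dec (K * deg G v ≤ κ * s) → N * (κ * s) ≤ N * (K * deg G v) + s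
        cases (no high) = ≤-trans (*-monoʳ-≤ N (<⇒≤ (≰⇒> high))) (m≤m+n _ s)
        cases (yes low) = ≤-trans (b (record { order = n ; G = G ; free = free ; heavy = heavy ; z = v ; low = low }) le)
          (≤-reflexive (cong (N * (K * deg G v) +_) (*-identityʳ s)))

-- Progressive induction

edgeless-emb : ∀ {n m} (G G′ : Graph n) (bs : Vec Bool m) → edgeCount bs ≡ 0 → emb G bs ≤ emb G′ bs
edgeless-emb {m = m} G G′ bs e = ∑V-mono (suc m) λ x → *-monoʳ-≤ (distinct x) (same bs e x)
  where
  same : ∀ {m} (bs : Vec Bool m) → edgeCount bs ≡ 0 → ∀ x → hom G bs x ≤ hom G′ bs x
  same []           e x            = ≤-refl
  same (false ∷ bs) e (x ∷ y ∷ xs) = +-monoˡ-≤ 0 (same bs e (y ∷ xs))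

emb≤ : ∀ {n m} (G : Graph n) (bs : Vec Bool m) → emb G bs ≤ n ^ suc m
emb≤ {n} {m} G bs = ≤-trans (∑V-mono (suc m) λ x → *-mono-≤ (distinct≤1 x) (hom≤1 G bs x))
  (≤-reflexive (trans (∑V-const {n} (suc m) 1) (*-identityʳ (n ^ suc m))))

deleteVertex-free : ∀ {f n} {F : Graph f} {G : Graph (suc n)} → G IsFree F → ∀ v → deleteVertex G v IsFree F
deleteVertex-free {F = F} {G} free v (S , copy) with copy⇒emb F (deleteVertex G v) S copy
... | φ , (inj , hm) , _ = free⇒no-emb {F = F} {G} free (punchIn v ∘ φ)
  ((λ i j e → inj i j (punchIn-injective v (φ i) (φ j) e)) , hm)

turán-free : ∀ {f} {F : Graph f} {κ} → χ[ F ]≡ suc (suc κ) → ∀ n → turán n (suc κ) IsFree F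
turán-free {F = F} {κ} (_ , minimal) n (S , copy) with copy⇒emb F (turán n (suc κ)) S copy
... | φ , (_ , hm) , _ = 1+n≰n (minimal (suc κ) (turánColour n κ ∘ φ , λ u v a e → hm u v a (turánColour-≡ n κ {φ u} {φ v} e)))

module Progressive {f κ m : ℕ} (F : Graph f) (bs : Vec Bool m) (n₃ : ℕ)
  (dichotomy : ∀ {n} (G : Graph (suc n)) → n₃ ≤ suc n → G IsFree F →
    (∃[ v ] through G bs v < through (turán (suc n) (suc κ)) bs (fromℕ n)) ⊎ emb G bs ≤ emb (turán (suc n) (suc κ)) bs) where

  -- Bounds every count at order n₃ by `emb≤`, so after this many further vertices no surplus is
  -- left.
  slack : ℕ
  slack = n₃ ^ suc m

  T : ∀ n → Graph n
  T n = turán n (suc κ)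

  -- The surplus over the Turán graph drops by at least one whenever a light vertex is deleted.
  surplus : ∀ j (G : Graph (j + n₃)) → G IsFree F → emb G bs ≤ emb (T (j + n₃)) bs + (slack ∸ j)
  surplus zero    G free = ≤-trans (emb≤ G bs) (m≤n+m slack _)
  surplus (suc j) G free with dichotomy G (≤-trans (m≤n+m n₃ j) (n≤1+n _)) free
  ... | inj₂ le = ≤-trans le (m≤m+n _ _)
  ... | inj₁ (v , light) = begin
    emb G bs                                                        ≡⟨ emb-deleteVertex G bs v ⟩
    emb (deleteVertex G v) bs + through G bs v                      ≤⟨ +-monoˡ-≤ _ (surplus j (deleteVertex G v) (deleteVertex-free {F = F} {G} free v)) ⟩
    emb (T (j + n₃)) bs + (slack ∸ j) + through G bs v              ≤⟨ +-monoˡ-≤ _ (+-monoʳ-≤ (emb (T (j + n₃)) bs) drop) ⟩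
    emb (T (j + n₃)) bs + suc (slack ∸ suc j) + through G bs v      ≡⟨ arrange (emb (T (j + n₃)) bs) (slack ∸ suc j) (through G bs v) ⟩
    emb (T (j + n₃)) bs + suc (through G bs v) + (slack ∸ suc j)    ≤⟨ +-monoˡ-≤ (slack ∸ suc j) (+-monoʳ-≤ (emb (T (j + n₃)) bs) light) ⟩
    emb (T (j + n₃)) bs + through (T (suc j + n₃)) bs (fromℕ (j + n₃)) + (slack ∸ suc j)   ≡⟨ cong (_+ (slack ∸ suc j)) (emb-turán-suc (j + n₃) κ bs) ⟨
    emb (T (suc j + n₃)) bs + (slack ∸ suc j)                       ∎
    where
    open ≤-Reasoning
    arrange : ∀ e s t → e + suc s + t ≡ e + suc t + s
    arrange = solve-∀
    drop : slack ∸ j ≤ suc (slack ∸ suc j)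
    drop = ≤-trans (m≤n+m∸n (slack ∸ j) 1) (s≤s (≤-reflexive (trans (∸-+-assoc slack j 1) (cong (slack ∸_) (+-comm j 1)))))

  eventually : ∀ n → slack + n₃ ≤ n → (G : Graph n) → G IsFree F → emb G bs ≤ emb (T n) bs
  eventually n le = subst (λ n → (G : Graph n) → G IsFree F → emb G bs ≤ emb (T n) bs) (m∸n+n≡m (≤-trans (m≤n+m n₃ slack) le)) bound
    where
    j = n ∸ n₃
    bound : (G : Graph (j + n₃)) → G IsFree F → emb G bs ≤ emb (T (j + n₃)) bs
    bound G free = ≤-trans (surplus j G free) (≤-reflexive (trans (cong (emb (T (j + n₃)) bs +_) (m≤n⇒m∸n≡0 (m+n≤o⇒m≤o∸n slack le))) (+-identityʳ _)))

light-or-extremal : ∀ {f κ m} {F : Graph f} → Critical F (suc κ) → 1 ≤ κ → (bs : Vec Bool m) → 1 ≤ edgeCount bs →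
  ∃[ n₃ ] (∀ {n} (G : Graph (suc n)) → n₃ ≤ suc n → G IsFree F →
    (∃[ v ] through G bs v < through (turán (suc n) (suc κ)) bs (fromℕ n)) ⊎ emb G bs ≤ emb (turán (suc n) (suc κ)) bs)
light-or-extremal {κ = κ} {F = F} C 1≤κ bs 1≤E = combine′ (MinDegree.colourable C) (Heaviness.minDegree C 1≤κ bs 1≤E)
  where
  δ : ℕ → ℕ
  δ n = through (turán (suc n) (suc κ)) bs (fromℕ n)
  combine′ : ∃[ N ] ∃[ n₁ ] (∀ {n} (G : Graph n) → n₁ ≤ n → G IsFree F →
      (∀ v → N * (suc κ * n) ≤ N * (suc κ * deg G v + n) + n) → Colorable G (suc κ)) →
    (∀ N → ∃[ n₂ ] (∀ {n} (G : Graph (suc n)) → n₂ ≤ suc n → G IsFree F → (∀ v → δ n ≤ through G bs v) →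
      ∀ v → N * (suc κ * suc n) ≤ N * (suc κ * deg G v + suc n) + suc n)) →
    ∃[ n₃ ] (∀ {n} (G : Graph (suc n)) → n₃ ≤ suc n → G IsFree F →
      (∃[ v ] through G bs v < δ n) ⊎ emb G bs ≤ emb (turán (suc n) (suc κ)) bs)
  combine′ (N , n₁ , colour) minDeg with minDeg N
  ... | n₂ , md = n₁ + n₂ , decide
    where
    decide : ∀ {n} (G : Graph (suc n)) → n₁ + n₂ ≤ suc n → G IsFree F →
      (∃[ v ] through G bs v < δ n) ⊎ emb G bs ≤ emb (turán (suc n) (suc κ)) bs
    decide {n} G le free with any? (λ v → through G bs v <? δ n)
    ... | yes light = inj₁ light
    ... | no none = inj₂ (emb-colourable κ G bs (colour G (≤-trans (m≤m+n n₁ n₂) le) free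
      (md G (≤-trans (m≤n+m n₂ n₁) le) free λ v → ≮⇒≥ λ lt → none (v , lt))))

-- Two cases lie outside the asymptotic argument. Without edges all graphs of the same order have
-- equally many embeddings. For κ = 0, where κ cannot be cancelled, every graph satisfies the degree
-- condition, so colourability follows at once.
emb-extremal : ∀ {f κ m} {F : Graph f} → Critical F (suc κ) → (bs : Vec Bool m) →
  ∃[ n₀ ] (∀ n → n₀ ≤ n → (G : Graph n) → G IsFree F → emb G bs ≤ emb (turán n (suc κ)) bs)
emb-extremal {κ = κ} {F = F} C bs = by-cases (1 ≤? edgeCount bs) (1 ≤? κ)
  where
  Goal : Set₁
  Goal = ∃[ n₀ ] (∀ n → n₀ ≤ n → (G : Graph n) → G IsFree F → emb G bs ≤ emb (turán n (suc κ)) bs)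
  trivial-degrees : κ ≡ 0 → ∃[ N ] ∃[ n₁ ] (∀ {n} (G : Graph n) → n₁ ≤ n → G IsFree F →
    (∀ v → N * (suc κ * n) ≤ N * (suc κ * deg G v + n) + n) → Colorable G (suc κ)) → Goal
  trivial-degrees refl (N , n₁ , colour) = n₁ , λ n le G free → emb-colourable 0 G bs
    (colour G le free λ v → ≤-trans (*-monoʳ-≤ N (≤-trans (≤-reflexive (*-identityˡ n)) (m≤n+m n _))) (m≤m+n _ n))
  progressive : ∃[ n₃ ] (∀ {n} (G : Graph (suc n)) → n₃ ≤ suc n → G IsFree F →
    (∃[ v ] through G bs v < through (turán (suc n) (suc κ)) bs (fromℕ n)) ⊎ emb G bs ≤ emb (turán (suc n) (suc κ)) bs) → Goal
  progressive (n₃ , dichotomy) = _ , Progressive.eventually F bs n₃ dichotomy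
  by-cases : Dec (1 ≤ edgeCount bs) → Dec (1 ≤ κ) → Goal
  by-cases (no e≱1)  _         = 0 , λ n _ G _ → edgeless-emb G (turán n (suc κ)) bs (n<1⇒n≡0 (≰⇒> e≱1))
  by-cases (yes 1≤e) (yes 1≤κ) = progressive (light-or-extremal C 1≤κ bs 1≤e)
  by-cases (yes _)   (no κ≱1)  = trivial-degrees (n<1⇒n≡0 (≰⇒> κ≱1)) (MinDegree.colourable C)

turánGood : ∀ {f h} (F : Graph f) (H : Graph h) k → HasColorCriticalEdge F → χ[ F ]≡ suc k → LinearForest H → TuránGood k F H
turánGood F H k edge χF lf = with-colours k χF (critical F k edge χF) (𝓝-linearForest H lf)
  where
  with-colours : ∀ k → χ[ F ]≡ suc k → Critical F k →
    (∀ {n} (G G′ : Graph n) → 𝓝 H G ≤ 𝓝 H G′) ⊎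
    (∃[ m ] Σ[ bs ∈ Vec Bool m ] (∀ {n} (G G′ : Graph n) → emb G bs ≤ emb G′ bs → 𝓝 H G ≤ 𝓝 H G′)) → TuránGood k F H
  -- A colouring with no colours contradicts the existence of an end of the critical edge.
  with-colours zero    χF C _ = ⊥-elim (¬Fin0 (Critical.col C (Critical.e₁ C)))
  with-colours (suc κ) χF C (inj₁ same) = χF , 0 , λ n _ → (turán n (suc κ) , turán-free {F = F} χF n , refl) , λ G _ → same G (turán n (suc κ))
  with-colours (suc κ) χF C (inj₂ (m , bs , reduce)) = conclude (emb-extremal C bs)
    where
    conclude : ∃[ n₀ ] (∀ n → n₀ ≤ n → (G : Graph n) → G IsFree F → emb G bs ≤ emb (turán n (suc κ)) bs) → TuránGood (suc κ) F H
    conclude (n₀ , bound) = χF , n₀ , λ n le → (turán n (suc κ) , turán-free {F = F} χF n , refl) ,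
      λ G free → reduce G (turán n (suc κ)) (bound n le G free)

-- Complete graphs and paths

complete-χ : ∀ n → χ[ complete n ]≡ n
complete-χ n = (id , λ u v ne → ne) , λ d (col , proper) → injective⇒≤ {f = col} λ {i} {j} e → decidable-stable (i ≟ j) λ ne → proper i j ne e

-- Once the edge is deleted its ends can share a colour, while all vertices but one still form a
-- clique.
complete-critical : ∀ k → HasColorCriticalEdge (complete (suc (suc k)))
complete-critical k = zero , suc zero , (λ ()) , suc (suc k) , suc k , complete-χ (suc (suc k)) , ((col , proper) , minimal) , ≤-refl
  where
  K′ = deleteEdge (complete (suc (suc k))) zero (suc zero)
  col : Fin (suc (suc k)) → Fin (suc k)
  col zero    = zero
  col (suc i) = i
  proper : ∀ u v → Adj K′ u v → col u ≢ col v
  proper zero    zero    (ne , _)    e    = ne refl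
  proper zero    (suc j) (_ , other) refl = other (inj₁ (refl , refl))
  proper (suc i) zero    (_ , other) refl = other (inj₂ (refl , refl))
  proper (suc i) (suc j) (ne , _)    e    = ne (cong suc e)
  minimal : ∀ d → Colorable K′ d → suc k ≤ d
  minimal d (col′ , proper′) = injective⇒≤ {f = col′ ∘ suc} λ {i} {j} e → decidable-stable (i ≟ j)
    λ ne → proper′ (suc i) (suc j) (ne ∘ suc-injective , λ { (inj₁ (() , _)) ; (inj₂ (_ , ())) }) e

-- A path is a single component: every vertex is reached from the first one, hence from every other.
path-linear : ∀ ℓ → LinearForest (path ℓ)
path-linear (suc ℓ) v = suc ℓ , mkIso id id (λ w → mk⇔ (λ _ → w , refl) (λ _ → reverse (symm (path (suc ℓ))) (from-zero v) ◅◅ from-zero w)) (λ i j → mk⇔ id id)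
  where
  from-zero : ∀ w → Star (Adj (path (suc ℓ))) zero w
  from-zero = <-weakInduction (Star (Adj (path (suc ℓ))) zero) ε λ i s → s ◅◅ (inj₁ (cong suc (sym (toℕ-inject₁ i))) ◅ ε)

mainTheorem1 : (∀ {f h} (F : Graph f) (H : Graph h) (k : ℕ) →
    HasColorCriticalEdge F → χ[ F ]≡ suc k → LinearForest H → TuránGood k F H)
    × (∀ (k ℓ : ℕ) → 2 ≤ k → 1 ≤ ℓ → TuránGood k (complete (suc k)) (path ℓ))
mainTheorem1 = turánGood ,
  λ { (suc k) ℓ _ _ → turánGood (complete (suc (suc k))) (path ℓ) (suc k) (complete-critical k) (complete-χ (suc (suc k))) (path-linear ℓ) }
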